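{- Every matroid in the set $\mathcal E_0=\{U_{2,4}\oplus_2M^*(H): H\in\{K_5,K_{3,3},K_{3,3}'\}\}\cup\{M^*(H_1)\oplus_2M^*(H_2): H_1,H_2\in\{K_5,K_{3,3},K_{3,3}'\}\}$ is an excluded minor for the class of frame matroids.
   Context: $K_{3,3}'$ is the graph obtained from $K_{3,3}$ by adding an edge $e'$ joining two non-adjacent vertices; $e'$ also denotes the corresponding element of $M^*(K_{3,3}')$. $M^*(H)$ is the dual of the cycle matroid of $H$. The 2-sum $M_1\oplus_2M_2$ on $e_1\in E(M_1)$, $e_2\in E(M_2)$ is the matroid on $(E(M_1)\cup E(M_2))\setminus\{e_1,e_2\}$ with circuits the circuits of $M_i$ avoiding $e_i$ together with $(C_1\cup C_2)\setminus\{e_1,e_2\}$ for circuits $C_i\ni e_i$ of $M_i$. In $\mathcal E_0$ the 2-sum is taken on $e'$ whenever a summand is $M^*(K_{3,3}')$, and on an arbitrary element otherwise (the automorphism groups of $U_{2,4}$, $M^*(K_5)$, $M^*(K_{3,3})$ are transitive on elements). A biased graph is a finite graph with a set of balanced cycles such that no theta subgraph contains exactly two balanced cycles; its frame matroid has circuits the edge sets of balanced cycles, of two edge-disjoint unbalanced cycles sharing exactly one vertex, of two vertex-disjoint unbalanced cycles joined by a path, and of thetas with all cycles unbalanced. A matroid is frame if it is the frame matroid of some biased graph. The class of frame matroids is minor-closed; an excluded minor is a matroid not in the class all of whose proper minors are in the class. -}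

module Defs where

open import Data.Nat using (ℕ; zero; suc; _+_; _<_)
open import Data.Fin using (Fin; zero; suc; _≟_; #_)
open import Data.Fin.Subset
  using (Subset; _∈_; _∉_; _⊆_; _∩_; _∪_; _─_; _-_; ∣_∣; Nonempty; ⊤)
  renaming (⊥ to ∅)
open import Data.Fin.Subset.Properties using (_∈?_)
open import Data.Vec using (Vec; []; _∷_; _++_; lookup)
open import Data.List using (List; map; allFin)
open import Data.Nat.ListAction using (sum)
open import Data.Bool using (if_then_else_)
open import Data.Product using (Σ; ∃; ∃-syntax; _×_; _,_; proj₁; proj₂)
open import Data.Sum using (_⊎_)
open import Relation.Nullary using (¬_; does)
open import Relation.Binary.PropositionalEquality using (_≡_; _≢_)
open import Function.Bundles using (_⇔_)
open import Level using (0ℓ)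

-- Graphs.  A finite (multi)graph with vertex set Fin v and edge set
-- labelled by Fin n (loops and parallel edges allowed) is given by the
-- two ends of every edge.  Edge sets are subsets of Fin n.

Graph : ℕ → ℕ → Set
Graph v n = Fin n → Fin v × Fin v

module _ {v n : ℕ} (g : Graph v n) where

  ends-at : Fin n → Fin v → ℕ
  ends-at e w = (if does (proj₁ (g e) ≟ w) then 1 else 0)
              + (if does (proj₂ (g e) ≟ w) then 1 else 0)

  deg : Subset n → Fin v → ℕ
  deg X w = sum (map (λ e → if does (e ∈? X) then ends-at e w else 0) (allFin n))

  OnV : Subset n → Fin v → Set
  OnV X w = 0 < deg X w

  Connected : Subset n → Set
  Connected X = ∀ Y → Y ⊆ X → Nonempty Y → Nonempty (X ─ Y) →
                ∃[ w ] (OnV Y w × OnV (X ─ Y) w)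

  Cycle : Subset n → Set
  Cycle X = Nonempty X × Connected X × (∀ w → deg X w ≡ 0 ⊎ deg X w ≡ 2)

  Path : Fin v → Fin v → Subset n → Set
  Path u v' X = u ≢ v' × Nonempty X × Connected X
              × deg X u ≡ 1 × deg X v' ≡ 1
              × (∀ w → w ≢ u → w ≢ v' → deg X w ≡ 0 ⊎ deg X w ≡ 2)

  IntDisj : Fin v → Fin v → Subset n → Subset n → Set
  IntDisj u v' P Q = P ∩ Q ≡ ∅ × (∀ w → OnV P w → OnV Q w → w ≡ u ⊎ w ≡ v')

  Theta : Subset n → Set
  Theta X = ∃[ u ] ∃[ v' ] ∃[ P₁ ] ∃[ P₂ ] ∃[ P₃ ]
              ( Path u v' P₁ × Path u v' P₂ × Path u v' P₃
              × IntDisj u v' P₁ P₂ × IntDisj u v' P₁ P₃ × IntDisj u v' P₂ P₃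
              × X ≡ (P₁ ∪ P₂) ∪ P₃ )

  -- B is a set of balanced cycles making the graph with edge set E a
  -- biased graph: no theta subgraph contains exactly two balanced cycles
  IsBiased : Subset n → (Subset n → Set) → Set
  IsBiased E B =
      (∀ C → B C → C ⊆ E × Cycle C)
    × (∀ T → T ⊆ E → Theta T →
         ¬ (∃[ C₁ ] ∃[ C₂ ] ( C₁ ≢ C₂ × B C₁ × B C₂ × C₁ ⊆ T × C₂ ⊆ T
                             × (∀ C → B C → C ⊆ T → C ≡ C₁ ⊎ C ≡ C₂))))

  FrameCircuit : (Subset n → Set) → Subset n → Set
  FrameCircuit B X =
      B X
    ⊎ (∃[ C₁ ] ∃[ C₂ ] ( Cycle C₁ × Cycle C₂ × ¬ B C₁ × ¬ B C₂
                        × C₁ ∩ C₂ ≡ ∅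
                        × (∃[ w ] (OnV C₁ w × OnV C₂ w
                                  × (∀ w' → OnV C₁ w' → OnV C₂ w' → w' ≡ w)))
                        × X ≡ C₁ ∪ C₂ ))
    ⊎ (∃[ C₁ ] ∃[ C₂ ] ∃[ P ] ∃[ u ] ∃[ v' ]
          ( Cycle C₁ × Cycle C₂ × ¬ B C₁ × ¬ B C₂
          × (∀ w → OnV C₁ w → OnV C₂ w → Data.Empty.⊥)
          × Path u v' P × OnV C₁ u × OnV C₂ v'
          × P ∩ C₁ ≡ ∅ × P ∩ C₂ ≡ ∅
          × (∀ w → OnV P w → OnV C₁ w → w ≡ u)
          × (∀ w → OnV P w → OnV C₂ w → w ≡ v')
          × X ≡ (C₁ ∪ C₂) ∪ P ))
    ⊎ (Theta X × (∀ C → Cycle C → C ⊆ X → ¬ B C))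
    where import Data.Empty

-- Matroids, presented by their circuits.  A matroid has ground set
-- E ⊆ Fin size and a predicate singling out its circuits (subsets of E).
-- All matroids in the statement are built from genuine matroids by the
-- standard operations below (cycle matroid, dual, 2-sum, minor), so the
-- circuit axioms are not recorded as fields.

record Matroid : Set₁ where
  constructor mat
  field
    size    : ℕ
    ground  : Subset size
    Circuit : Subset size → Set
open Matroid public

cycleMatroid : ∀ {v n} → Graph v n → Matroid
cycleMatroid {v} {n} g = mat n ⊤ (Cycle g)

IsFrame : Matroid → Set₁
IsFrame M = ∃[ v ] Σ (Graph v (size M)) λ g → Σ (Subset (size M) → Set) λ B →
            IsBiased g (ground M) B
          × (∀ X → Circuit M X ⇔ (X ⊆ ground M × FrameCircuit g B X))

module _ (M : Matroid) where
  private
    n = size M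
    E = ground M

  Indep : Subset n → Set
  Indep X = X ⊆ E × (∀ K → K ⊆ X → ¬ Circuit M K)

  Basis : Subset n → Set
  Basis B = Indep B × (∀ Y → Indep Y → B ⊆ Y → Y ≡ B)

  DualIndep : Subset n → Set
  DualIndep X = X ⊆ E × ∃[ B ] (Basis B × X ∩ B ≡ ∅)

  dual : Matroid
  dual = mat n E (λ X → X ⊆ E × ¬ DualIndep X
                        × (∀ Y → Y ⊆ X → Y ≢ X → DualIndep Y))

  MinorForm : Subset n → Subset n → Subset n → Set
  MinorForm C D Y = ∃[ K ] (Circuit M K × K ∩ D ≡ ∅ × Y ≡ K ─ C)

  minor : Subset n → Subset n → Matroid
  minor C D = mat n (E ─ (C ∪ D))
    (λ X → Nonempty X × MinorForm C D X
           × (∀ Y → Nonempty Y → Y ⊆ X → MinorForm C D Y → Y ≡ X))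

  IsProperMinorPair : Subset n → Subset n → Set
  IsProperMinorPair C D = C ⊆ E × D ⊆ E × C ∩ D ≡ ∅ × Nonempty (C ∪ D)

  ExcludedMinorFrame : Set₁
  ExcludedMinorFrame =
      ¬ IsFrame M
    × (∀ C D → IsProperMinorPair C D → IsFrame (minor C D))

-- 2-sum M₁ ⊕₂ M₂ on e₁ ∈ E(M₁), e₂ ∈ E(M₂); the ground set is
-- (E₁ - e₁) ⊎ (E₂ - e₂) placed inside Fin (size M₁ + size M₂)
twoSum : (M₁ : Matroid) → Fin (size M₁) → (M₂ : Matroid) → Fin (size M₂) → Matroid
twoSum M₁ e₁ M₂ e₂ = mat (size M₁ + size M₂)
  ((ground M₁ - e₁) ++ (ground M₂ - e₂))
  (λ X → (∃[ C₁ ] (Circuit M₁ C₁ × e₁ ∉ C₁ × X ≡ C₁ ++ ∅))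
       ⊎ (∃[ C₂ ] (Circuit M₂ C₂ × e₂ ∉ C₂ × X ≡ ∅ ++ C₂))
       ⊎ (∃[ C₁ ] ∃[ C₂ ] ( Circuit M₁ C₁ × e₁ ∈ C₁ × Circuit M₂ C₂ × e₂ ∈ C₂
                          × X ≡ (C₁ - e₁) ++ (C₂ - e₂))))

U24 : Matroid
U24 = mat 4 ⊤ (λ X → ∣ X ∣ ≡ 3)

K5 : Graph 5 10
K5 e = lookup es e
  where
  es : Vec (Fin 5 × Fin 5) 10
  es = (# 0 , # 1) ∷ (# 0 , # 2) ∷ (# 0 , # 3) ∷ (# 0 , # 4) ∷ (# 1 , # 2)
     ∷ (# 1 , # 3) ∷ (# 1 , # 4) ∷ (# 2 , # 3) ∷ (# 2 , # 4) ∷ (# 3 , # 4) ∷ []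

K33 : Graph 6 9
K33 e = lookup es e
  where
  es : Vec (Fin 6 × Fin 6) 9
  es = (# 0 , # 3) ∷ (# 0 , # 4) ∷ (# 0 , # 5)
     ∷ (# 1 , # 3) ∷ (# 1 , # 4) ∷ (# 1 , # 5)
     ∷ (# 2 , # 3) ∷ (# 2 , # 4) ∷ (# 2 , # 5) ∷ []

-- K₃,₃' = K₃,₃ plus the edge e' = 01 joining two non-adjacent vertices;
-- e' is the edge labelled 9
K33' : Graph 6 10
K33' e = lookup es e
  where
  es : Vec (Fin 6 × Fin 6) 10
  es = (# 0 , # 3) ∷ (# 0 , # 4) ∷ (# 0 , # 5)
     ∷ (# 1 , # 3) ∷ (# 1 , # 4) ∷ (# 1 , # 5)
     ∷ (# 2 , # 3) ∷ (# 2 , # 4) ∷ (# 2 , # 5) ∷ (# 0 , # 1) ∷ []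

e' : Fin 10
e' = # 9

data Gr : Set where
  k5 k33 k33' : Gr

Mstar : Gr → Matroid
Mstar k5   = dual (cycleMatroid K5)
Mstar k33  = dual (cycleMatroid K33)
Mstar k33' = dual (cycleMatroid K33')

Basepoint : (H : Gr) → Fin (size (Mstar H)) → Set
Basepoint k5   e = Data.Unit.⊤
  where import Data.Unit
Basepoint k33  e = Data.Unit.⊤
  where import Data.Unit
Basepoint k33' e = e ≡ e'

{-# OPTIONS --safe #-}
-- U₂,₄ and the cographic matroids are ternary, and so is every M₁ ⊕₂ M₂ considered here: its circuits
-- are the minimal supports of a space over 𝔽₃. A matroid whose space is the kernel of a matrix
-- with at most two nonzero entries per column is a frame matroid, the columns being the edges
-- of the graph; such kernels are closed under deletion and contraction, which identifies rows.
-- Deleting or contracting an element of one summand makes that summand graphic, by planar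
-- duality. A graphic summand can be glued into a matrix of the other one along the basepoint,
-- so all proper minors are frame.
--
-- Conversely, let Ω represent M₁ ⊕₂ M₂ and let r be its rank. No circuit meets the star of a vertex
-- in exactly one element, so every star contains a cocircuit, and Ω has at least r vertices. On
-- the side of Mᵢ the stars thus contain tᵢ cocircuits of Mᵢ avoiding the basepoint e, and k cocircuits
-- through e at the vertices shared by both sides, where t₁ + t₂ + k ≥ r, and every element is
-- covered at most twice. Comparing sizes on both sides forces 2tᵢ + k + 1 = 2 rank(Mᵢ), hence k is
-- odd, and leaves at most one uncovered incidence. But when Mᵢ = M*(H) the cocircuits are cycles
-- of H, and since k is odd the degrees at each of the two ends of e leave an uncovered incidence.
module Submission where

open import Defs
open import Algebra.Bundles using (CommutativeSemiring)
import Algebra.Properties.Semiring.Sum as SemiringSum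
open import Data.Bool as Bool using (Bool; true; false; if_then_else_; not)
open import Data.Empty using (⊥; ⊥-elim)
open import Data.Unit using (tt)
open import Data.Fin using (Fin; zero; suc; toℕ; fromℕ<; _≟_; splitAt; _↑ˡ_; _↑ʳ_)
open import Data.Fin.Properties using (any?; all?; toℕ-fromℕ<; splitAt-↑ˡ; splitAt-↑ʳ; splitAt⁻¹-↑ˡ; splitAt⁻¹-↑ʳ; ↑ˡ-injective; ↑ʳ-injective)
open import Data.Fin.Subset
  using (Subset; _∈_; _∉_; _⊆_; _∩_; _∪_; _─_; _-_; ∣_∣; Nonempty; ⊤; ⁅_⁆; inside; outside)
  renaming (⊥ to ∅)
open import Data.Fin.Subset.Properties
  using (_∈?_; nonempty?; ⊆-antisym; ⊆-refl; p⊆q⇒∣p∣≤∣q∣; ∉⊥; ∈⊤; ∣⊥∣≡0; ∣⁅x⁆∣≡1; ∣p∣≤n; ∪-comm; ∪-assoc; Empty-unique; x∈⁅x⁆; x∈⁅y⁆⇒x≡y;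
         x∈p∩q⁺; x∈p∩q⁻; x∈p∪q⁺; x∈p∪q⁻; x∈p∧x∉q⇒x∈p─q; x∈p∧x≢y⇒x∈p-y; p─q⊆p; anySubset?; _⊆?_; p⊂q⇒∣p∣<∣q∣)
import Data.List as List
open import Data.Nat
  using (ℕ; zero; suc; _+_; _*_; _∸_; _^_; _/_; _%_; _≤_; _<_; _≤?_; _<?_; z≤n; s≤s)
open import Data.Nat.Properties as ℕₚ hiding (_≟_; _≤?_; _<?_)
open import Data.Nat.DivMod using (_mod_)
import Data.Nat.ListAction as ListAction
open import Data.Nat.Tactic.RingSolver using (solve-∀)
open import Data.Product using (Σ; ∃; ∃-syntax; _×_; _,_; proj₁; proj₂)
open import Data.Sum using (_⊎_; inj₁; inj₂; [_,_]′)
open import Data.Vec using (Vec; []; _∷_; _++_; lookup; tabulate; here; there)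
open import Data.Vec.Properties 
  using (lookup∘tabulate; tabulate-cong; []=⇒lookup; lookup⇒[]=; lookup-++ˡ; lookup-++ʳ; ≡-dec)
import Data.Vec.Functional as Vector
open import Function using (_∘_; id; case_of_)
open import Function.Bundles using (_⇔_; mk⇔; Equivalence)
open import Level using (0ℓ)
open import Relation.Nullary using (¬_; Dec; yes; no; does; contradiction)
open import Relation.Nullary.Decidable
  using (True; toWitness; map′; ¬?; decidable-stable; _×-dec_; _⊎-dec_; _→-dec_; dec-true; dec-false)
open import Relation.Binary.PropositionalEquality
  using (_≡_; _≢_; _≗_; refl; sym; trans; cong; cong₂; subst; subst₂; module ≡-Reasoning; isEquivalence)

-- The field 𝔽₃

-- 𝔽₃ is the smallest field that represents U₂,₄, and cographic matroids are representable over
-- every field, so one field serves all summands.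
--
-- At a shared vertex the star need not contain a cocircuit through the basepoint; it may contain
-- only one avoiding it. Stars of the first kind are counted by `kx`, those of the second by `kz`,
-- and the parity argument concerns `kx` alone. The sizes rule out `kz > 0` except when there is
-- just one shared vertex. In that case every circuit running across the 2-sum passes this vertex on
-- both sides, which forces a cocircuit through the basepoint there.
--
-- The choice of e' in K₃,₃' matters twice. All triangles of K₃,₃' contain e', so the cocircuits
-- avoiding the basepoint have at least four elements, and the count would fail with three. Moreover
-- K₃,₃' without e' is the nonplanar K₃,₃, so contracting e' would leave a matroid that is not
-- graphic; a basepoint is never contracted.

data F : Set where
  𝟘 𝟙 𝟚 : F

infixl 6 _⊕_
infixl 7 _⊗_

_⊕_ _⊗_ : F → F → F
𝟘 ⊕ b = b
𝟙 ⊕ 𝟘 = 𝟙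
𝟙 ⊕ 𝟙 = 𝟚
𝟙 ⊕ 𝟚 = 𝟘
𝟚 ⊕ 𝟘 = 𝟚
𝟚 ⊕ 𝟙 = 𝟘
𝟚 ⊕ 𝟚 = 𝟙
𝟘 ⊗ b = 𝟘
𝟙 ⊗ b = b
𝟚 ⊗ 𝟘 = 𝟘
𝟚 ⊗ 𝟙 = 𝟚
𝟚 ⊗ 𝟚 = 𝟙

infix 4 _≟F_
_≟F_ : (a b : F) → Dec (a ≡ b)
𝟘 ≟F 𝟘 = yes refl
𝟘 ≟F 𝟙 = no λ ()
𝟘 ≟F 𝟚 = no λ ()
𝟙 ≟F 𝟘 = no λ ()
𝟙 ≟F 𝟙 = yes refl
𝟙 ≟F 𝟚 = no λ ()
𝟚 ≟F 𝟘 = no λ ()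
𝟚 ≟F 𝟙 = no λ ()
𝟚 ≟F 𝟚 = yes refl

allF? : {P : F → Set} → (∀ a → Dec (P a)) → Dec (∀ a → P a)
allF? P? = map′ (λ { (p , q , r) 𝟘 → p ; (p , q , r) 𝟙 → q ; (p , q , r) 𝟚 → r })
                (λ f → f 𝟘 , f 𝟙 , f 𝟚)
                (P? 𝟘 ×-dec P? 𝟙 ×-dec P? 𝟚)

anyF? : {P : F → Set} → (∀ a → Dec (P a)) → Dec (∃ P)
anyF? P? = map′ (λ { (inj₁ p) → 𝟘 , p ; (inj₂ (inj₁ p)) → 𝟙 , p ; (inj₂ (inj₂ p)) → 𝟚 , p })
                (λ { (𝟘 , p) → inj₁ p ; (𝟙 , p) → inj₂ (inj₁ p) ; (𝟚 , p) → inj₂ (inj₂ p) })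
                (P? 𝟘 ⊎-dec P? 𝟙 ⊎-dec P? 𝟚)

by₁ : ∀ {f g : F → F} → {True (allF? λ a → f a ≟F g a)} → ∀ a → f a ≡ g a
by₁ {_} {_} {t} = toWitness t

by₂ : ∀ {f g : F → F → F} → {True (allF? λ a → allF? λ b → f a b ≟F g a b)} →
      ∀ a b → f a b ≡ g a b
by₂ {_} {_} {t} = toWitness t

by₃ : ∀ {f g : F → F → F → F} →
      {True (allF? λ a → allF? λ b → allF? λ c → f a b c ≟F g a b c)} →
      ∀ a b c → f a b c ≡ g a b c
by₃ {_} {_} {t} = toWitness t

by₄ : ∀ {f g : F → F → F → F → F} →
      {True (allF? λ a → allF? λ b → allF? λ c → allF? λ d → f a b c d ≟F g a b c d)} →
      ∀ a b c d → f a b c d ≡ g a b c d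
by₄ {_} {_} {t} = toWitness t

⊗-zeroʳ : ∀ a → a ⊗ 𝟘 ≡ 𝟘
⊗-zeroʳ = by₁

⊗-comm : ∀ a b → a ⊗ b ≡ b ⊗ a
⊗-comm = by₂

⊕-identityʳ : ∀ a → a ⊕ 𝟘 ≡ a
⊕-identityʳ = by₁

⊗-nonzero : ∀ {a b} → a ≢ 𝟘 → b ≢ 𝟘 → a ⊗ b ≢ 𝟘
⊗-nonzero {𝟘} p q r = p refl
⊗-nonzero {𝟙} p q r = q r
⊗-nonzero {𝟚} {𝟘} p q r = q refl
⊗-nonzero {𝟚} {𝟙} p q ()
⊗-nonzero {𝟚} {𝟚} p q ()

⊗-nonzeroʳ : ∀ {a b} → a ⊗ b ≢ 𝟘 → b ≢ 𝟘
⊗-nonzeroʳ {a} p refl = p (⊗-zeroʳ a)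

-- A unit is its own inverse and `𝟚` is minus one, so `𝟚 ⊗ (a ⊗ b)` is -a/b. Elimination
-- coefficients are written in this form throughout.
unit² : ∀ {a} → a ≢ 𝟘 → a ⊗ a ≡ 𝟙
unit² {𝟘} p = ⊥-elim (p refl)
unit² {𝟙} p = refl
unit² {𝟚} p = refl

𝔽₃ : CommutativeSemiring 0ℓ 0ℓ
𝔽₃ = record
  { Carrier = F ; _≈_ = _≡_ ; _+_ = _⊕_ ; _*_ = _⊗_ ; 0# = 𝟘 ; 1# = 𝟙
  ; isCommutativeSemiring = record
    { isSemiring = record
      { isSemiringWithoutAnnihilatingZero = record
        { +-isCommutativeMonoid = record
          { isMonoid = record
            { isSemigroup = record
              { isMagma = record { isEquivalence = isEquivalence ; ∙-cong = cong₂ _⊕_ }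
              ; assoc = by₃ }
            ; identity = (λ _ → refl) , by₁ }
          ; comm = by₂ }
        ; *-cong = cong₂ _⊗_
        ; *-assoc = by₃
        ; *-identity = (λ _ → refl) , by₁
        ; distrib = by₃ , by₃ }
      ; zero = (λ _ → refl) , by₁ }
    ; *-comm = by₂ } }

-- Sums, inner products and Fredholm's alternative

module NS = SemiringSum ℕₚ.+-*-semiring
module FS = SemiringSum (CommutativeSemiring.semiring 𝔽₃)

δ : ∀ {n} → Fin n → Fin n → F
δ i j = if does (i ≟ j) then 𝟙 else 𝟘

δ-refl : ∀ {n} (i : Fin n) → δ i i ≡ 𝟙
δ-refl i = cong (if_then 𝟙 else 𝟘) (dec-true (i ≟ i) refl)

δ-≢ : ∀ {n} {i j : Fin n} → i ≢ j → δ i j ≡ 𝟘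
δ-≢ {i = i} {j} p = cong (if_then 𝟙 else 𝟘) (dec-false (i ≟ j) p)

sum-zero : ∀ {n} {f : Fin n → F} → (∀ i → f i ≡ 𝟘) → FS.sum f ≡ 𝟘
sum-zero {n} p = trans (FS.sum-cong-≗ p) (FS.sum-replicate-zero n)

sum-single : ∀ {n} {f : Fin n → F} i → (∀ j → j ≢ i → f j ≡ 𝟘) → FS.sum f ≡ f i
sum-single {suc n} {f} zero p =
  trans (cong (f zero ⊕_) (sum-zero λ j → p (suc j) λ ())) (⊕-identityʳ _)
sum-single {suc n} {f} (suc i) p =
  cong₂ _⊕_ (p zero λ ()) (sum-single i λ j q → p (suc j) λ { refl → q refl })

infix 8 _∙_
_∙_ : ∀ {n} → (Fin n → F) → (Fin n → F) → F
x ∙ y = FS.sum λ i → x i ⊗ y i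

∙-congˡ : ∀ {n} {x y : Fin n → F} z → x ≗ y → x ∙ z ≡ y ∙ z
∙-congˡ z p = FS.sum-cong-≗ λ i → cong (_⊗ z i) (p i)

∙-congʳ : ∀ {n} z {x y : Fin n → F} → x ≗ y → z ∙ x ≡ z ∙ y
∙-congʳ z p = FS.sum-cong-≗ λ i → cong (z i ⊗_) (p i)

∙-comm : ∀ {n} (x y : Fin n → F) → x ∙ y ≡ y ∙ x
∙-comm x y = FS.sum-cong-≗ λ i → ⊗-comm (x i) (y i)

∙-combʳ : ∀ {n} (z x : Fin n → F) c y → z ∙ (λ i → x i ⊕ c ⊗ y i) ≡ z ∙ x ⊕ c ⊗ (z ∙ y)
∙-combʳ z x c y = begin
  z ∙ (λ i → x i ⊕ c ⊗ y i)
    ≡⟨ FS.sum-cong-≗ (λ i → lem (z i) (x i) c (y i)) ⟩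
  FS.sum (λ i → z i ⊗ x i ⊕ c ⊗ (z i ⊗ y i))
    ≡⟨ FS.∑-distrib-+ (λ i → z i ⊗ x i) (λ i → c ⊗ (z i ⊗ y i)) ⟩
  z ∙ x ⊕ FS.sum (λ i → c ⊗ (z i ⊗ y i))
    ≡⟨ cong (z ∙ x ⊕_) (sym (FS.*-distribˡ-sum c (λ i → z i ⊗ y i))) ⟩
  z ∙ x ⊕ c ⊗ (z ∙ y) ∎
  where
  open ≡-Reasoning
  lem : ∀ z x c y → z ⊗ (x ⊕ c ⊗ y) ≡ z ⊗ x ⊕ c ⊗ (z ⊗ y)
  lem = by₄

∙-combˡ : ∀ {n} (x : Fin n → F) c y z → (λ i → x i ⊕ c ⊗ y i) ∙ z ≡ x ∙ z ⊕ c ⊗ (y ∙ z)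
∙-combˡ x c y z =
  trans (∙-comm _ z) (trans (∙-combʳ z x c y) (cong₂ (λ a b → a ⊕ c ⊗ b) (∙-comm z x) (∙-comm z y)))

∙-δ : ∀ {n} (z : Fin n → F) i → z ∙ δ i ≡ z i
∙-δ z i = trans (sum-single i λ j p → trans (cong (z j ⊗_) (δ-≢ (p ∘ sym))) (⊗-zeroʳ _))
                (trans (cong (z i ⊗_) (δ-refl i)) (lem (z i)))
  where
  lem : ∀ a → a ⊗ 𝟙 ≡ a
  lem = by₁

Matrix : ℕ → ℕ → Set
Matrix v n = Fin v → Fin n → F

-- `Im` is the row space, orthogonal to `Ker`. For the incidence matrix of a graph, the minimal
-- supports of `Ker` are the cycles and those of `Im` the bonds, which are the circuits of the dual
-- matroid.
Ker Im : ∀ {v n} → Matrix v n → (Fin n → F) → Set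
Ker A x = ∀ w → A w ∙ x ≡ 𝟘
Im A x = ∃[ y ] (∀ i → y ∙ (λ w → A w i) ≡ x i)

∙-interchange : ∀ {v n} (A : Matrix v n) y x →
  (λ i → y ∙ (λ w → A w i)) ∙ x ≡ y ∙ (λ w → A w ∙ x)
∙-interchange A y x = begin
  FS.sum (λ i → FS.sum (λ w → y w ⊗ A w i) ⊗ x i)
    ≡⟨ FS.sum-cong-≗ (λ i → FS.*-distribʳ-sum (x i) (λ w → y w ⊗ A w i)) ⟩
  FS.sum (λ i → FS.sum (λ w → y w ⊗ A w i ⊗ x i))
    ≡⟨ FS.∑-comm (λ i w → y w ⊗ A w i ⊗ x i) ⟩
  FS.sum (λ w → FS.sum (λ i → y w ⊗ A w i ⊗ x i))
    ≡⟨ FS.sum-cong-≗ (λ w → FS.sum-cong-≗ (λ i → lem (y w) (A w i) (x i))) ⟩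
  FS.sum (λ w → FS.sum (λ i → y w ⊗ (A w i ⊗ x i)))
    ≡⟨ FS.sum-cong-≗ (λ w → sym (FS.*-distribˡ-sum (y w) (λ i → A w i ⊗ x i))) ⟩
  y ∙ (λ w → A w ∙ x) ∎
  where
  open ≡-Reasoning
  lem : ∀ a b c → a ⊗ b ⊗ c ≡ a ⊗ (b ⊗ c)
  lem = by₃

Im⊥Ker : ∀ {v n} {A : Matrix v n} {x z} → Im A z → Ker A x → z ∙ x ≡ 𝟘
Im⊥Ker {A = A} {x} (y , p) k =
  trans (∙-congˡ x (λ i → sym (p i)))
        (trans (∙-interchange A y x)
               (sum-zero λ w → trans (cong (y w ⊗_) (k w)) (⊗-zeroʳ _)))

-- Elimination, by induction on the number of vectors. A functional `z` that separates `t` from the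
-- later vectors may fail to kill `G zero`. Then a multiple of `G zero` is subtracted from `t` so
-- that `z` kills the difference, and a functional separating the new target is corrected by a
-- multiple of `z`.
fredholm : ∀ {k v} (G : Fin k → Fin v → F) (t : Fin v → F) →
  (∃[ c ] (∀ r → c ∙ (λ j → G j r) ≡ t r)) ⊎ (∃[ y ] ((∀ j → y ∙ G j ≡ 𝟘) × y ∙ t ≢ 𝟘))
fredholm {zero} G t with any? (λ r → ¬? (t r ≟F 𝟘))
... | yes (r , p) = inj₂ (δ r , (λ ()) , λ q → p (trans (sym (∙-δ t r)) (trans (∙-comm t (δ r)) q)))
... | no p = inj₁ ((λ ()) , λ r → sym (decidable-stable (t r ≟F 𝟘) λ q → p (r , q)))
fredholm {suc k} G t with fredholm (G ∘ suc) t
... | inj₁ (c , p) = inj₁ (𝟘 Vector.∷ c , p)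
... | inj₂ (z , zG , zt) with z ∙ G zero ≟F 𝟘
...   | yes zg = inj₂ (z , (λ { zero → zg ; (suc j) → zG j }) , zt)
...   | no zg with fredholm (G ∘ suc) (λ r → t r ⊕ 𝟚 ⊗ (z ∙ t ⊗ z ∙ G zero) ⊗ G zero r)
...     | inj₁ (c , p) = inj₁ ((z ∙ t ⊗ z ∙ G zero) Vector.∷ c , λ r →
            trans (cong (z ∙ t ⊗ z ∙ G zero ⊗ G zero r ⊕_) (p r)) (lem (t r) (z ∙ t ⊗ z ∙ G zero) (G zero r)))
  where
  lem : ∀ a b c → b ⊗ c ⊕ (a ⊕ 𝟚 ⊗ b ⊗ c) ≡ a
  lem = by₃
...     | inj₂ (z' , zG' , zt') = inj₂ (y , orth , λ q → zt' (trans (∙-combʳ z' t _ (G zero)) (trans (lem₂ (z' ∙ t) (z ∙ t) (z ∙ G zero) (z' ∙ G zero)) (trans (sym (∙-combˡ z' _ z t)) q))))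
  where
  γ = 𝟚 ⊗ (z' ∙ G zero ⊗ z ∙ G zero)
  y = λ r → z' r ⊕ γ ⊗ z r
  lem₁ : ∀ a b → b ⊗ b ≡ 𝟙 → a ⊕ 𝟚 ⊗ (a ⊗ b) ⊗ b ≡ 𝟘
  lem₁ 𝟘 𝟘 p = refl
  lem₁ 𝟘 𝟙 p = refl
  lem₁ 𝟘 𝟚 p = refl
  lem₁ 𝟙 𝟙 p = refl
  lem₁ 𝟙 𝟚 p = refl
  lem₁ 𝟚 𝟙 p = refl
  lem₁ 𝟚 𝟚 p = refl
  lem₂ : ∀ a b c d → a ⊕ 𝟚 ⊗ (b ⊗ c) ⊗ d ≡ a ⊕ 𝟚 ⊗ (d ⊗ c) ⊗ b
  lem₂ = by₄
  orth : ∀ j → y ∙ G j ≡ 𝟘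
  orth zero = trans (∙-combˡ z' γ z (G zero)) (lem₁ (z' ∙ G zero) (z ∙ G zero) (unit² zg))
  orth (suc j) = trans (∙-combˡ z' γ z (G (suc j)))
    (trans (cong₂ (λ a b → a ⊕ γ ⊗ b) (zG' j) (zG j)) (⊗-zeroʳ γ))

-- Subsets and supports

module _ {n : ℕ} where

  sel : {P : Fin n → Set} → (∀ i → Dec (P i)) → Subset n
  sel P? = tabulate λ i → does (P? i)

  ∈sel⁺ : {P : Fin n → Set} (P? : ∀ i → Dec (P i)) → ∀ {i} → P i → i ∈ sel P?
  ∈sel⁺ P? {i} p = lookup⇒[]= i _ (trans (lookup∘tabulate _ i) (dec-true (P? i) p))

  ∈sel⁻ : {P : Fin n → Set} (P? : ∀ i → Dec (P i)) → ∀ {i} → i ∈ sel P? → P i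
  ∈sel⁻ P? {i} q with P? i | trans (sym (lookup∘tabulate (λ i → does (P? i)) i)) ([]=⇒lookup q)
  ... | yes p | _ = p
  ... | no _ | ()

  χ : Subset n → Fin n → ℕ
  χ X i = if does (i ∈? X) then 1 else 0

  χ-∈ : ∀ {X i} → i ∈ X → χ X i ≡ 1
  χ-∈ {X} {i} p = cong (if_then 1 else 0) (dec-true (i ∈? X) p)

  χ-∉ : ∀ {X i} → i ∉ X → χ X i ≡ 0
  χ-∉ {X} {i} p = cong (if_then 1 else 0) (dec-false (i ∈? X) p)

  χ≢0 : ∀ {X i} → χ X i ≢ 0 → i ∈ X
  χ≢0 {X} {i} p = decidable-stable (i ∈? X) (p ∘ χ-∉)

∈─⁻ : ∀ {n} (p q : Subset n) {i} → i ∈ p ─ q → i ∈ p × i ∉ q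
∈─⁻ (_ ∷ p) (outside ∷ q) {zero} here = here , λ ()
∈─⁻ (_ ∷ p) (_ ∷ q) {suc i} (there r) with ∈─⁻ p q r
... | a , b = there a , λ { (there c) → b c }

∈-⁻ : ∀ {n} {p : Subset n} {x i} → i ∈ p - x → i ∈ p × i ≢ x
∈-⁻ {p = p} {x} q with ∈─⁻ p ⁅ x ⁆ q
... | a , b = a , λ { refl → b (x∈⁅x⁆ x) }

∣∣-χ : ∀ {n} (X : Subset n) → ∣ X ∣ ≡ NS.sum (χ X)
∣∣-χ [] = refl
∣∣-χ (outside ∷ X) = ∣∣-χ X
∣∣-χ (inside ∷ X) = cong suc (∣∣-χ X)

module _ {n : ℕ} where

  χ-─ : ∀ {X Y : Subset n} → Y ⊆ X → ∀ i → χ X i ≡ χ Y i + χ (X ─ Y) i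
  χ-─ {X} {Y} s i with i ∈? Y | i ∈? X
  ... | yes p | yes q = sym (cong suc (χ-∉ λ r → proj₂ (∈─⁻ X Y r) p))
  ... | yes p | no q = contradiction (s p) q
  ... | no p | yes q = sym (χ-∈ (x∈p∧x∉q⇒x∈p─q q p))
  ... | no p | no q = sym (χ-∉ λ r → q (proj₁ (∈─⁻ X Y r)))

  χ-∪ : ∀ {X Y : Subset n} → (∀ {i} → i ∈ X → i ∉ Y) → ∀ i → χ (X ∪ Y) i ≡ χ X i + χ Y i
  χ-∪ {X} {Y} d i with i ∈? X | i ∈? Y
  ... | yes p | yes q = contradiction q (d p)
  ... | yes p | no q = χ-∈ (x∈p∪q⁺ (inj₁ p))
  ... | no p | yes q = χ-∈ (x∈p∪q⁺ {p = X} (inj₂ q))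
  ... | no p | no q = χ-∉ λ r → [ p , q ]′ (x∈p∪q⁻ X Y r)

  ∩-∅ : ∀ {X Y : Subset n} → X ∩ Y ≡ ∅ → ∀ {i} → i ∈ X → i ∉ Y
  ∩-∅ e p q = ∉⊥ (subst (_ ∈_) e (x∈p∩q⁺ (p , q)))

  ∅-∩ : ∀ {X Y : Subset n} → (∀ {i} → i ∈ X → i ∉ Y) → X ∩ Y ≡ ∅
  ∅-∩ {X} {Y} d = Empty-unique λ (i , p) → let a , b = x∈p∩q⁻ X Y p in d a b

  ∣∣-─ : ∀ {X Y : Subset n} → Y ⊆ X → ∣ X ∣ ≡ ∣ Y ∣ + ∣ X ─ Y ∣
  ∣∣-─ {X} {Y} s = begin
    ∣ X ∣ ≡⟨ ∣∣-χ X ⟩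
    NS.sum (χ X) ≡⟨ NS.sum-cong-≗ (χ-─ s) ⟩
    NS.sum (λ i → χ Y i + χ (X ─ Y) i) ≡⟨ NS.∑-distrib-+ (χ Y) (χ (X ─ Y)) ⟩
    NS.sum (χ Y) + NS.sum (χ (X ─ Y)) ≡⟨ cong₂ _+_ (∣∣-χ Y) (∣∣-χ (X ─ Y)) ⟨
    ∣ Y ∣ + ∣ X ─ Y ∣ ∎
    where open ≡-Reasoning

  ⁅⁆⊆ : ∀ {X : Subset n} {x} → x ∈ X → ⁅ x ⁆ ⊆ X
  ⁅⁆⊆ {x = x} p q = subst (_∈ _) (sym (x∈⁅y⁆⇒x≡y x q)) p

  ∣∣-remove : ∀ {X : Subset n} {x} → x ∈ X → ∣ X ∣ ≡ suc ∣ X - x ∣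
  ∣∣-remove {X} {x} p = trans (∣∣-─ (⁅⁆⊆ p)) (cong (_+ ∣ X - x ∣) (∣⁅x⁆∣≡1 x))

  0<∣∣⇒Nonempty : ∀ {X : Subset n} → 0 < ∣ X ∣ → Nonempty X
  0<∣∣⇒Nonempty {X} p with nonempty? X
  ... | yes q = q
  ... | no q = contradiction (subst (λ Y → 0 < ∣ Y ∣) (Empty-unique q) p)
                             (λ r → ℕₚ.<-irrefl (sym (∣⊥∣≡0 n)) r)

  ⊆⊎∃ : ∀ (X Y : Subset n) → X ⊆ Y ⊎ ∃[ i ] (i ∈ X × i ∉ Y)
  ⊆⊎∃ X Y with any? (λ i → i ∈? X ×-dec ¬? (i ∈? Y))
  ... | yes p = inj₂ p
  ... | no p = inj₁ λ {i} q → decidable-stable (i ∈? Y) λ r → p (i , q , r)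

  ⊆-∣∣-≡ : ∀ {X Y : Subset n} → X ⊆ Y → ∣ Y ∣ ≤ ∣ X ∣ → X ≡ Y
  ⊆-∣∣-≡ {X} {Y} s le with ⊆⊎∃ Y X
  ... | inj₁ t = ⊆-antisym s t
  ... | inj₂ p = contradiction (p⊂q⇒∣p∣<∣q∣ (s , p)) (ℕₚ.≤⇒≯ le)

  ⊆-─-∅ : ∀ {X Y : Subset n} → Y ⊆ X → ¬ Nonempty (X ─ Y) → Y ≡ X
  ⊆-─-∅ {X} {Y} s p with ⊆⊎∃ X Y
  ... | inj₁ t = ⊆-antisym s t
  ... | inj₂ (i , a , b) = contradiction (i , x∈p∧x∉q⇒x∈p─q a b) p

  Minimal : (Subset n → Set) → Subset n → Set
  Minimal P X = P X × (∀ Z → Z ⊆ X → P Z → Z ≡ X)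

  minimal : ∀ {P} → (∀ X → Dec (P X)) → ∀ {X} → P X → ∃[ Y ] (Y ⊆ X × Minimal P Y)
  minimal {P} P? {X} = go ∣ X ∣ X ℕₚ.≤-refl
    where
    go : ∀ m X → ∣ X ∣ ≤ m → P X → ∃[ Y ] (Y ⊆ X × Minimal P Y)
    go m X le p with anySubset? (λ Z → Z ⊆? X ×-dec P? Z ×-dec ∣ Z ∣ <? ∣ X ∣)
    go m X le p | no q =
      X , id , p , λ Z s r → ⊆-∣∣-≡ s (ℕₚ.≮⇒≥ λ lt → q (Z , s , r , lt))
    go zero X le p | yes (Z , s , r , lt) = contradiction (ℕₚ.<-≤-trans lt le) λ ()
    go (suc m) X le p | yes (Z , s , r , lt) with go m Z (ℕₚ.≤-pred (ℕₚ.<-≤-trans lt le)) r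
    ... | Y , s' , q = Y , (λ t → s (s' t)) , q

  -- A `P`-set inside a `Q`-subset of a member of `P` must be that member, by the antichain
  -- condition. This identifies an explicit family of circuits with the minimal supports of a space.
  Minimal-antichain : ∀ {P Q : Subset n → Set} → (∀ {X} → P X → Q X) →
    (∀ {X} → Q X → ∃[ Y ] (Y ⊆ X × P Y)) → (∀ {X Y} → P X → P Y → X ⊆ Y → X ≡ Y) →
    ∀ X → P X ⇔ Minimal Q X
  Minimal-antichain {P} {Q} pq qp anti X = mk⇔ to from
    where
    to : P X → Minimal Q X
    to p = pq p , λ Z s q → let Y , t , r = qp q in
      ⊆-antisym s (λ {j} w → t (subst (j ∈_) (sym (anti r p (λ u → s (t u)))) w))
    from : Minimal Q X → P X
    from (q , m) = let Y , t , r = qp q in subst P (m Y t (pq r)) r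

  Minimal-unique : ∀ {P Q : Subset n → Set} → (∀ {X} → P X → Q X) →
    (∀ {X} → Q X → ∃[ Y ] (Y ⊆ X × P Y)) → ∀ X → Minimal P X ⇔ Minimal Q X
  Minimal-unique {P} {Q} pq qp X = mk⇔ to from
    where
    to : Minimal P X → Minimal Q X
    to (p , m) = pq p , λ Z s q → let Y , t , r = qp q in
      ⊆-antisym s (λ {j} w → t (subst (j ∈_) (sym (m Y (λ u → s (t u)) r)) w))
    from : Minimal Q X → Minimal P X
    from (q , m) = let Y , t , r = qp q in
      subst P (m Y t (pq r)) r , λ Z s p → m Z s (pq p)

  Supported : (Fin n → F) → Subset n → Set
  Supported x X = ∀ {i} → x i ≢ 𝟘 → i ∈ X

  supp : (Fin n → F) → Subset n
  supp x = sel λ i → ¬? (x i ≟F 𝟘)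

  ∉-Supported : ∀ {x X} → Supported x X → ∀ {i} → i ∉ X → x i ≡ 𝟘
  ∉-Supported {x} s {i} p = decidable-stable (x i ≟F 𝟘) (p ∘ s)

-- Subspaces over 𝔽₃ and their minimal supports

record Space (n : ℕ) : Set₁ where
  field
    V    : (Fin n → F) → Set
    -- Decidable membership lets minimal supports be found by search. A space is a predicate and not
    -- a matrix because 2-sums and minors quantify over hidden coordinates.
    V?   : ∀ x → Dec (V x)
    ext  : ∀ {x y} → x ≗ y → V x → V y
    nil  : V (λ _ → 𝟘)
    comb : ∀ {x y} c → V x → V y → V (λ i → x i ⊕ c ⊗ y i)

  scale : ∀ {x} c → V x → V (λ i → c ⊗ x i)
  scale {x} c p = ext (λ i → lem (x i) c) (comb (c ⊕ 𝟚) p p)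
    where
    lem : ∀ a c → a ⊕ (c ⊕ 𝟚) ⊗ a ≡ c ⊗ a
    lem = by₂
open Space public

anyFun? : ∀ {n} {P : (Fin n → F) → Set} → (∀ {x y} → x ≗ y → P x → P y) →
          (∀ x → Dec (P x)) → Dec (∃ P)
anyFun? {zero} {P} e P? = map′ (_ ,_) (λ (x , p) → e (λ ()) p) (P? (λ ()))
anyFun? {suc n} {P} e P? =
  map′ (λ (c , x , p) → c Vector.∷ x , p)
       (λ (x , p) → x zero , x ∘ suc , e (λ { zero → refl ; (suc i) → refl }) p)
       (anyF? λ c → anyFun? (λ q → e λ { zero → refl ; (suc i) → q i }) λ x → P? (c Vector.∷ x))

KerS : ∀ {v n} → Matrix v n → Space n
KerS A = record
  { V = Ker A
  ; V? = λ x → all? λ w → A w ∙ x ≟F 𝟘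
  ; nil = λ w → sum-zero λ i → ⊗-zeroʳ (A w i)
  ; ext = λ p k w → trans (∙-congʳ (A w) (sym ∘ p)) (k w)
  ; comb = λ {x} {y} c p q w → trans (∙-combʳ (A w) x c y)
             (trans (cong₂ (λ a b → a ⊕ c ⊗ b) (p w) (q w)) (⊗-zeroʳ c)) }

ImS : ∀ {v n} → Matrix v n → Space n
ImS A = record
  { V = Im A
  ; V? = λ x → anyFun? (λ e p i → trans (∙-congˡ _ (sym ∘ e)) (p i))
                       (λ y → all? λ i → y ∙ (λ w → A w i) ≟F x i)
  ; nil = (λ _ → 𝟘) , λ i → sum-zero {f = λ w → 𝟘 ⊗ A w i} λ _ → refl
  ; ext = λ e (y , p) → y , λ i → trans (p i) (e i)
  ; comb = λ c (y , p) (y' , p') → (λ w → y w ⊕ c ⊗ y' w) , λ i →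
             trans (∙-combˡ y c y' (λ w → A w i)) (cong₂ (λ a b → a ⊕ c ⊗ b) (p i) (p' i)) }

cancel : ∀ a b → b ⊗ b ≡ 𝟙 → a ⊕ 𝟚 ⊗ (a ⊗ b) ⊗ b ≡ 𝟘
cancel 𝟘 𝟙 p = refl
cancel 𝟘 𝟚 p = refl
cancel 𝟙 𝟙 p = refl
cancel 𝟙 𝟚 p = refl
cancel 𝟚 𝟙 p = refl
cancel 𝟚 𝟚 p = refl

module _ {n : ℕ} (W : Space n) where

  Dep : Subset n → Set
  Dep X = ∃[ x ] (V W x × Supported x X × ∃[ i ] (x i ≢ 𝟘))

  DepAt : Fin n → Subset n → Set
  DepAt i X = ∃[ x ] (V W x × Supported x X × x i ≢ 𝟘)

  private
    supported? : ∀ (x : Fin n → F) X → Dec (∀ i → x i ≢ 𝟘 → i ∈ X)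
    supported? x X = all? λ i → ¬? (x i ≟F 𝟘) →-dec i ∈? X

  DepAt? : ∀ i X → Dec (DepAt i X)
  DepAt? i X = map′ (λ (x , p , q , r) → x , p , (λ {j} → q j) , r)
                    (λ (x , p , q , r) → x , p , (λ j → q {j}) , r)
    (anyFun? (λ e (p , q , r) → ext W e p , (λ j s → q j λ t → s (trans (sym (e j)) t)) ,
                 λ t → r (trans (e i) t))
             (λ x → V? W x ×-dec supported? x X ×-dec ¬? (x i ≟F 𝟘)))

  Dep? : ∀ X → Dec (Dep X)
  Dep? X = map′ (λ (i , x , p , q , r) → x , p , (λ {j} → q {j}) , i , r)
                (λ (x , p , q , i , r) → i , x , p , (λ {j} → q {j}) , r)
                (any? λ i → DepAt? i X)

  MinDep : Subset n → Set
  MinDep = Minimal Dep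

  Dep-mono : ∀ {X Y} → X ⊆ Y → Dep X → Dep Y
  Dep-mono s (x , p , q , r) = x , p , (λ t → s (q t)) , r

  Dep⇒MinDep : ∀ {X} → Dep X → ∃[ K ] (K ⊆ X × MinDep K)
  Dep⇒MinDep = minimal Dep?

  -- A vector vanishing at i can be used to shrink the support of a vector not vanishing at i.
  DepAt⇒MinDep : ∀ {i X} → DepAt i X → ∃[ K ] (K ⊆ X × i ∈ K × MinDep K)
  DepAt⇒MinDep {i} {X} d with minimal (DepAt? i) d
  ... | Y , s , (x , p , q , r) , m = Y , s , q r , (x , p , q , i , r) , min
    where
    min : ∀ Z → Z ⊆ Y → Dep Z → Z ≡ Y
    min Z t (z , zV , zs , j , zj) with z i ≟F 𝟘
    ... | no zi = m Z t (z , zV , zs , zi)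
    ... | yes zi = contradiction (subst (j ∈_) (sym (m (Y - j) (proj₁ ∘ ∈-⁻) (u , comb W c p zV , us , ui))) (t (zs zj)))
                                 (λ e → proj₂ (∈-⁻ {p = Y} e) refl)
      where
      c = 𝟚 ⊗ (x j ⊗ z j)
      u = λ k → x k ⊕ c ⊗ z k
      ui : u i ≢ 𝟘
      ui e = r (trans (sym (trans (cong (λ a → x i ⊕ c ⊗ a) zi) (trans (cong (x i ⊕_) (⊗-zeroʳ c)) (⊕-identityʳ _)))) e)
      uj : u j ≡ 𝟘
      uj = cancel (x j) (z j) (unit² zj)
      us : Supported u (Y - j)
      us {k} e = x∈p∧x≢y⇒x∈p-y kY λ { refl → e uj }
        where
        kY : k ∈ Y
        kY with x k ≟F 𝟘 | z k ≟F 𝟘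
        ... | no a | _ = q a
        ... | yes _ | no b = t (zs b)
        ... | yes a | yes b = ⊥-elim (e (trans (cong₂ (λ a b → a ⊕ c ⊗ b) a b) (⊗-zeroʳ c)))

  MinDep-supp : ∀ {K x} → MinDep K → V W x → Supported x K → (∃[ i ] x i ≢ 𝟘) → ∀ {i} → i ∈ K → x i ≢ 𝟘
  MinDep-supp {K} {x} (_ , m) p q r {i} iK e =
    ∈sel⁻ (λ i → ¬? (x i ≟F 𝟘)) (subst (i ∈_) (sym eq) iK) e
    where
    eq : supp x ≡ K
    eq = m (supp x) (λ j → q (∈sel⁻ (λ i → ¬? (x i ≟F 𝟘)) j))
           (x , p , ∈sel⁺ (λ i → ¬? (x i ≟F 𝟘)) , r)

  MinDep-other : ∀ {e C} → ¬ Dep ⁅ e ⁆ → MinDep C → ∃[ i ] (i ∈ C × i ≢ e)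
  MinDep-other {e} {C} p m with any? (λ i → i ∈? C ×-dec ¬? (i ≟ e))
  ... | yes q = q
  ... | no q = contradiction (Dep-mono (λ {i} r → subst (_∈ ⁅ e ⁆) (sym (decidable-stable (i ≟ e) λ s → q (i , r , s))) (x∈⁅x⁆ e)) (proj₁ m)) p

  MinDep-nonempty : ∀ {K} → MinDep K → Nonempty K
  MinDep-nonempty ((x , _ , s , i , r) , _) = i , s r

  MinDep-vec : ∀ {K} → MinDep K → ∃[ x ] (V W x × Supported x K × (∀ {i} → i ∈ K → x i ≢ 𝟘))
  MinDep-vec m@((x , p , q , r) , _) = x , p , q , λ {i} → MinDep-supp m p q r

  -- The combination of two fully supported vectors that vanishes at `e` is not zero, since
  -- otherwise the vectors would be proportional and `K` would equal `L`.
  circuit-elimination : ∀ {K L e} → MinDep K → MinDep L → K ≢ L → e ∈ K → e ∈ L →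
    ∃[ J ] (J ⊆ (K ∪ L) - e × MinDep J)
  circuit-elimination {K} {L} {e} mK mL K≢L eK eL = go (MinDep-vec mK) (MinDep-vec mL)
    where
    go : ∃[ x ] (V W x × Supported x K × (∀ {i} → i ∈ K → x i ≢ 𝟘)) →
         ∃[ y ] (V W y × Supported y L × (∀ {i} → i ∈ L → y i ≢ 𝟘)) → ∃[ J ] (J ⊆ (K ∪ L) - e × MinDep J)
    go (x , xV , xs , xn) (y , yV , ys , yn) = Dep⇒MinDep (z , comb W c xV yV , (λ {i} → zs {i}) , nonzero)
      where
      c = 𝟚 ⊗ (x e ⊗ y e)
      c≢0 : c ≢ 𝟘
      c≢0 = ⊗-nonzero {𝟚} (λ ()) (⊗-nonzero (xn eK) (yn eL))
      z = λ i → x i ⊕ c ⊗ y i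
      ze : z e ≡ 𝟘
      ze = cancel (x e) (y e) (unit² (yn eL))
      zs : Supported z ((K ∪ L) - e)
      zs {i} p = x∈p∧x≢y⇒x∈p-y (case x i ≟F 𝟘 of λ
        { (no q) → x∈p∪q⁺ (inj₁ (xs q))
        ; (yes q) → x∈p∪q⁺ {p = K} (inj₂ (ys λ r → p (trans (cong₂ (λ a b → a ⊕ c ⊗ b) q r) (⊗-zeroʳ c)))) }) λ { refl → p ze }
      opposite : ∀ {a b} → a ⊕ c ⊗ b ≡ 𝟘 → a ≢ 𝟘 → b ≢ 𝟘
      opposite {a} p q refl = q (trans (sym (trans (cong (a ⊕_) (⊗-zeroʳ c)) (⊕-identityʳ a))) p)
      opposite' : ∀ {a b} → a ⊕ c ⊗ b ≡ 𝟘 → b ≢ 𝟘 → a ≢ 𝟘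
      opposite' p q refl = ⊗-nonzero c≢0 q p
      nonzero : ∃[ i ] z i ≢ 𝟘
      nonzero with any? (λ i → ¬? (z i ≟F 𝟘))
      ... | yes p = p
      ... | no p = contradiction (⊆-antisym (λ r → ys (opposite (z0 _) (xn r))) (λ r → xs (opposite' (z0 _) (yn r)))) K≢L
        where
        z0 : ∀ i → z i ≡ 𝟘
        z0 i = decidable-stable (z i ≟F 𝟘) λ q → p (i , q)

-- More unknowns than equations, where `b` pays for the rows that meet `X`. Such a row is solved for
-- one element `e`, which spends at least one unit of `b` and exactly one element of `X`; a row not
-- meeting `X` is dropped.
pigeonhole : ∀ {v n} (A : Matrix v n) (X : Subset n) (b : Fin v → ℕ) →
  (∀ w {i} → b w ≡ 0 → i ∈ X → A w i ≡ 𝟘) → NS.sum b < ∣ X ∣ → Dep (KerS A) X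
pigeonhole {zero} A X b h lt with 0<∣∣⇒Nonempty lt
... | i , p = δ i , (λ ()) , sup , i , λ e → 𝟙≢𝟘 (trans (sym (δ-refl i)) e)
  where
  𝟙≢𝟘 : 𝟙 ≢ 𝟘
  𝟙≢𝟘 ()
  sup : Supported (δ i) X
  sup {j} e with i ≟ j
  ... | yes refl = p
  ... | no q = contradiction refl e
pigeonhole {suc v} {n} A X b h lt with any? (λ i → i ∈? X ×-dec ¬? (A zero i ≟F 𝟘))
... | no none = let x , k , s , r = pigeonhole (A ∘ suc) X (b ∘ suc) (h ∘ suc) (ℕₚ.≤-<-trans (ℕₚ.m≤n+m _ (b zero)) lt)
                in x , (λ { zero → row₀ s ; (suc w) → k w }) , s , r
  where
  row₀ : ∀ {x} → Supported x X → A zero ∙ x ≡ 𝟘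
  row₀ {x} s = sum-zero λ i → case x i ≟F 𝟘 of λ
    { (yes e) → trans (cong (A zero i ⊗_) e) (⊗-zeroʳ _)
    ; (no e) → cong (_⊗ x i) (decidable-stable (A zero i ≟F 𝟘) λ t → none (i , s e , t)) }
... | yes (e , eX , r≢0) =
  let x' , k , s , j , q = pigeonhole A' (X - e) (b ∘ suc) h' lt'
      r = A zero
      α = 𝟚 ⊗ (r ∙ x' ⊗ r e)
      x = λ i → x' i ⊕ α ⊗ δ e i
      r∙x : r ∙ x ≡ 𝟘
      r∙x = trans (∙-combʳ r x' α (δ e)) (trans (cong (λ a → r ∙ x' ⊕ α ⊗ a) (∙-δ r e)) (cancel (r ∙ x') (r e) (unit² r≢0)))
      x≡x' : ∀ {i} → i ≢ e → x i ≡ x' i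
      x≡x' {i} p = trans (cong (λ a → x' i ⊕ α ⊗ a) (δ-≢ (p ∘ sym))) (trans (cong (x' i ⊕_) (⊗-zeroʳ α)) (⊕-identityʳ _))
      rows : ∀ w → A (suc w) ∙ x ≡ 𝟘
      rows w = let c = 𝟚 ⊗ (A (suc w) e ⊗ r e) in
        trans (sym (trans (∙-combˡ (A (suc w)) c r x) (trans (cong (λ a → A (suc w) ∙ x ⊕ c ⊗ a) r∙x) (trans (cong (A (suc w) ∙ x ⊕_) (⊗-zeroʳ c)) (⊕-identityʳ _)))))
          (trans (∙-combʳ (A' w) x' α (δ e)) (trans (cong₂ (λ a b → a ⊕ α ⊗ b) (k w) (trans (∙-δ (A' w) e) (A'e w))) (⊗-zeroʳ α)))
      sup : Supported x X
      sup {i} p = case i ≟ e of λ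
        { (yes refl) → eX
        ; (no t) → proj₁ (∈-⁻ (s λ u → p (trans (x≡x' t) u))) }
  in x , (λ { zero → r∙x ; (suc w) → rows w }) , sup , j ,
     λ t → q (trans (sym (x≡x' (proj₂ (∈-⁻ {p = X} (s q))))) t)
  where
  A' : Matrix v n
  A' w i = A (suc w) i ⊕ 𝟚 ⊗ (A (suc w) e ⊗ A zero e) ⊗ A zero i
  A'e : ∀ w → A' w e ≡ 𝟘
  A'e w = cancel (A (suc w) e) (A zero e) (unit² r≢0)
  h' : ∀ w {i} → b (suc w) ≡ 0 → i ∈ X - e → A' w i ≡ 𝟘
  h' w {i} p q = cong₂ (λ a c → a ⊕ 𝟚 ⊗ (c ⊗ A zero e) ⊗ A zero i)
                       (h (suc w) p (proj₁ (∈-⁻ q))) (h (suc w) p eX)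
  b₀ : 1 ≤ b zero
  b₀ = ℕₚ.n≢0⇒n>0 λ p → r≢0 (h zero p eX)
  lt' : NS.sum (b ∘ suc) < ∣ X - e ∣
  lt' = ℕₚ.≤-pred (ℕₚ.≤-trans (s≤s (ℕₚ.+-monoˡ-≤ (NS.sum (b ∘ suc)) b₀)) (subst (NS.sum b <_) (∣∣-remove eX) lt))

-- Degrees in graphs

pt : ∀ {n} → Fin n → Fin n → ℕ
pt u w = if does (u ≟ w) then 1 else 0

pt-refl : ∀ {n} (u : Fin n) → pt u u ≡ 1
pt-refl u = cong (if_then 1 else 0) (dec-true (u ≟ u) refl)

pt-≢ : ∀ {n} {u w : Fin n} → u ≢ w → pt u w ≡ 0
pt-≢ {u = u} {w} p = cong (if_then 1 else 0) (dec-false (u ≟ w) p)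

sum≡0⁺ : ∀ {n} {f : Fin n → ℕ} → (∀ i → f i ≡ 0) → NS.sum f ≡ 0
sum≡0⁺ {n} p = trans (NS.sum-cong-≗ p) (NS.sum-replicate-zero n)

sum-pt : ∀ {n} (u : Fin n) → NS.sum (pt u) ≡ 1
sum-pt {suc n} zero = cong suc (sum≡0⁺ {n} λ i → refl)
sum-pt {suc n} (suc u) = sum-pt u

sum-mono : ∀ {n} {f g : Fin n → ℕ} → (∀ i → f i ≤ g i) → NS.sum f ≤ NS.sum g
sum-mono {zero} p = z≤n
sum-mono {suc n} p = +-mono-≤ (p zero) (sum-mono (p ∘ suc))

sum≡0 : ∀ {n} {f : Fin n → ℕ} → NS.sum f ≡ 0 → ∀ i → f i ≡ 0
sum≡0 {f = f} p zero = m+n≡0⇒m≡0 (f zero) p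
sum≡0 {f = f} p (suc i) = sum≡0 (m+n≡0⇒n≡0 (f zero) p) i

≤-sum : ∀ {n} (f : Fin n → ℕ) i → f i ≤ NS.sum f
≤-sum f zero = m≤m+n _ _
≤-sum f (suc i) = ≤-trans (≤-sum (f ∘ suc) i) (m≤n+m _ _)

sum-squeeze : ∀ {n} {f g : Fin n → ℕ} → (∀ i → f i ≤ g i) → NS.sum g ≤ NS.sum f → f ≗ g
sum-squeeze {n} {f} {g} p q i = ≤-antisym (p i) (m∸n≡0⇒m≤n (sum≡0 eq i))
  where
  eq : NS.sum (λ i → g i ∸ f i) ≡ 0
  eq = n≤0⇒n≡0 (+-cancelˡ-≤ (NS.sum f) _ 0
    (subst₂ _≤_ (trans (NS.sum-cong-≗ λ i → sym (m+[n∸m]≡n (p i))) (NS.∑-distrib-+ f (λ i → g i ∸ f i)))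
                (sym (+-identityʳ _)) q))

sum≡1 : ∀ {n} {f : Fin n → ℕ} → NS.sum f ≡ 1 → ∃[ i ] (f i ≡ 1 × (∀ j → j ≢ i → f j ≡ 0))
sum≡1 {suc n} {f} p with f zero in eq
... | 0 = let i , q , r = sum≡1 p in suc i , q , λ { zero _ → eq ; (suc j) t → r j λ { refl → t refl } }
... | 1 = zero , eq , λ { zero t → contradiction refl t ; (suc j) _ → sum≡0 (suc-injective p) j }

sum≡2 : ∀ {n} {f : Fin n → ℕ} → NS.sum f ≡ 2 →
  (∃[ i ] (f i ≡ 2 × (∀ j → j ≢ i → f j ≡ 0))) ⊎
  (∃[ i ] ∃[ j ] (i ≢ j × f i ≡ 1 × f j ≡ 1 × (∀ k → k ≢ i → k ≢ j → f k ≡ 0)))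
sum≡2 {suc n} {f} p with f zero in eq
... | 0 with sum≡2 p
...   | inj₁ (i , q , r) = inj₁ (suc i , q , λ { zero _ → eq ; (suc j) t → r j λ { refl → t refl } })
...   | inj₂ (i , j , d , q , q' , r) = inj₂ (suc i , suc j , (λ { refl → d refl }) , q , q' ,
          λ { zero _ _ → eq ; (suc k) s t → r k (λ { refl → s refl }) (λ { refl → t refl }) })
sum≡2 {suc n} {f} p | 1 = let j , q , r = sum≡1 (suc-injective p) in
  inj₂ (zero , suc j , (λ ()) , eq , q ,
        λ { zero s _ → contradiction refl s ; (suc k) _ t → r k λ { refl → t refl } })
sum≡2 {suc n} {f} p | 2 =
  inj₁ (zero , eq , λ { zero t → contradiction refl t ; (suc j) _ → sum≡0 (suc-injective (suc-injective p)) j })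

sg : ℕ → ℕ
sg 0 = 0
sg (suc _) = 1

sg-mono : ∀ {m n} → m ≤ n → sg m ≤ sg n
sg-mono {0} p = z≤n
sg-mono {suc m} (s≤s p) = s≤s z≤n

sg-split : ∀ m → m ≢ 1 → m ≡ 2 * sg m + (m ∸ 2)
sg-split 0 p = refl
sg-split 1 p = contradiction refl p
sg-split (suc (suc m)) p = refl

sg≡0 : ∀ {m} → sg m ≡ 0 → m ≡ 0
sg≡0 {0} _ = refl

sg-pos : ∀ {m} → 0 < m → sg m ≡ 1
sg-pos (s≤s _) = refl

0or2 : ℕ → Set
0or2 m = m ≡ 0 ⊎ m ≡ 2

half : ∀ {m} → 0or2 m → m ≡ 2 * sg m
half (inj₁ refl) = refl
half (inj₂ refl) = refl

even≢1 : ∀ {m} → 0or2 m → m ≢ 1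
even≢1 (inj₁ refl) ()
even≢1 (inj₂ refl) ()

two : ∀ {m} → 0or2 m → 0 < m → m ≡ 2
two (inj₁ refl) ()
two (inj₂ p) q = p

list-sum : ∀ {m n} (h : Fin n → Fin m) (f : Fin m → ℕ) →
  ListAction.sum (List.map f (List.tabulate h)) ≡ NS.sum (f ∘ h)
list-sum {n = zero} h f = refl
list-sum {n = suc n} h f = cong (f (h zero) +_) (list-sum (h ∘ suc) f)

module _ {v n : ℕ} (g : Graph v n) where

  deg-sum : ∀ X w → deg g X w ≡ NS.sum (λ e → χ X e * ends-at g e w)
  deg-sum X w = trans (list-sum id (λ e → if does (e ∈? X) then ends-at g e w else 0)) (NS.sum-cong-≗ pointwise)
    where
    pointwise : ∀ e → (if does (e ∈? X) then ends-at g e w else 0) ≡ χ X e * ends-at g e w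
    pointwise e with does (e ∈? X)
    ... | true = sym (+-identityʳ _)
    ... | false = refl

  private
    deg-+ : ∀ {X Y Z} → (∀ e → χ X e ≡ χ Y e + χ Z e) → ∀ w → deg g X w ≡ deg g Y w + deg g Z w
    deg-+ {X} {Y} {Z} p w = begin
      deg g X w ≡⟨ deg-sum X w ⟩
      NS.sum (λ e → χ X e * ends-at g e w)
        ≡⟨ NS.sum-cong-≗ (λ e → trans (cong (_* ends-at g e w) (p e)) (*-distribʳ-+ (ends-at g e w) (χ Y e) (χ Z e))) ⟩
      NS.sum (λ e → χ Y e * ends-at g e w + χ Z e * ends-at g e w)
        ≡⟨ NS.∑-distrib-+ (λ e → χ Y e * ends-at g e w) (λ e → χ Z e * ends-at g e w) ⟩
      _ ≡⟨ cong₂ _+_ (deg-sum Y w) (deg-sum Z w) ⟨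
      deg g Y w + deg g Z w ∎
      where open ≡-Reasoning

  deg-─ : ∀ {X Y} → Y ⊆ X → ∀ w → deg g X w ≡ deg g Y w + deg g (X ─ Y) w
  deg-─ s = deg-+ (χ-─ s)

  deg-∪ : ∀ {X Y} → (∀ {i} → i ∈ X → i ∉ Y) → ∀ w → deg g (X ∪ Y) w ≡ deg g X w + deg g Y w
  deg-∪ d = deg-+ (χ-∪ d)

  deg-mono : ∀ {X Y} → Y ⊆ X → ∀ w → deg g Y w ≤ deg g X w
  deg-mono s w = subst (_ ≤_) (sym (deg-─ s w)) (m≤m+n _ _)

  deg-∅ : ∀ w → deg g ∅ w ≡ 0
  deg-∅ w = trans (deg-sum ∅ w) (sum≡0⁺ λ e → cong (_* ends-at g e w) (χ-∉ {X = ∅} {e} ∉⊥))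

  ends≤deg : ∀ {X e} → e ∈ X → ∀ w → ends-at g e w ≤ deg g X w
  ends≤deg {X} {e} p w = begin
    ends-at g e w ≡⟨ *-identityˡ _ ⟨
    1 * ends-at g e w ≡⟨ cong (_* ends-at g e w) (χ-∈ p) ⟨
    χ X e * ends-at g e w ≤⟨ ≤-sum (λ e → χ X e * ends-at g e w) e ⟩
    NS.sum (λ e → χ X e * ends-at g e w) ≡⟨ deg-sum X w ⟨
    deg g X w ∎
    where open ≤-Reasoning

  OnV⇒edge : ∀ {X w} → OnV g X w → ∃[ e ] (e ∈ X × 0 < ends-at g e w)
  OnV⇒edge {X} {w} p with any? (λ e → e ∈? X ×-dec 0 <? ends-at g e w)
  ... | yes q = q
  ... | no q = contradiction p (≤⇒≯ (≤-reflexive (trans (deg-sum X w) (sum≡0⁺ term))))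
    where
    term : ∀ e → χ X e * ends-at g e w ≡ 0
    term e with e ∈? X
    ... | yes r = trans (+-identityʳ _) (n≤0⇒n≡0 (≮⇒≥ λ t → q (e , r , t)))
    ... | no r = refl

  sum-ends : ∀ e → NS.sum (ends-at g e) ≡ 2
  sum-ends e = trans (NS.∑-distrib-+ (pt (proj₁ (g e))) (pt (proj₂ (g e))))
                     (cong₂ _+_ (sum-pt (proj₁ (g e))) (sum-pt (proj₂ (g e))))

  handshake : ∀ X → NS.sum (deg g X) ≡ 2 * ∣ X ∣
  handshake X = begin
    NS.sum (deg g X) ≡⟨ NS.sum-cong-≗ (deg-sum X) ⟩
    NS.sum (λ w → NS.sum (λ e → χ X e * ends-at g e w)) ≡⟨ NS.∑-comm (λ w e → χ X e * ends-at g e w) ⟩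
    NS.sum (λ e → NS.sum (λ w → χ X e * ends-at g e w))
      ≡⟨ NS.sum-cong-≗ (λ e → trans (sym (NS.*-distribˡ-sum (χ X e) (ends-at g e)))
           (trans (cong (χ X e *_) (sum-ends e)) (*-comm (χ X e) 2))) ⟩
    NS.sum (λ e → 2 * χ X e) ≡⟨ NS.*-distribˡ-sum 2 (χ X) ⟨
    2 * NS.sum (χ X) ≡⟨ cong (2 *_) (∣∣-χ X) ⟨
    2 * ∣ X ∣ ∎
    where open ≡-Reasoning

  nv : Subset n → ℕ
  nv X = NS.sum (λ w → sg (deg g X w))

  nv-mono : ∀ {X Y} → Y ⊆ X → nv Y ≤ nv X
  nv-mono s = sum-mono λ w → sg-mono (deg-mono s w)

  -- The sum of deg ∸ 2 measures by how much the number of edges exceeds the number of vertices.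
  excess : Subset n → ℕ
  excess X = NS.sum (λ w → deg g X w ∸ 2)

  excess-eq : ∀ {X} → (∀ w → deg g X w ≢ 1) → 2 * ∣ X ∣ ≡ 2 * nv X + excess X
  excess-eq {X} p = begin
    2 * ∣ X ∣ ≡⟨ handshake X ⟨
    NS.sum (deg g X) ≡⟨ NS.sum-cong-≗ (λ w → sg-split _ (p w)) ⟩
    NS.sum (λ w → 2 * sg (deg g X w) + (deg g X w ∸ 2))
      ≡⟨ NS.∑-distrib-+ (λ w → 2 * sg (deg g X w)) (λ w → deg g X w ∸ 2) ⟩
    NS.sum (λ w → 2 * sg (deg g X w)) + excess X
      ≡⟨ cong (_+ excess X) (NS.*-distribˡ-sum 2 (λ w → sg (deg g X w))) ⟨
    2 * nv X + excess X ∎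
    where open ≡-Reasoning

  Separate : Subset n → Subset n → Set
  Separate Y Z = ∀ w → deg g Y w ≡ 0 ⊎ deg g Z w ≡ 0

  separate? : ∀ Y Z → Separate Y Z ⊎ ∃[ w ] (OnV g Y w × OnV g Z w)
  separate? Y Z with any? (λ w → 0 <? deg g Y w ×-dec 0 <? deg g Z w)
  ... | yes p = inj₂ p
  ... | no p = inj₁ λ w → case (deg g Y w ℕₚ.≟ 0) of λ
    { (yes q) → inj₁ q
    ; (no q) → inj₂ (n≤0⇒n≡0 (≮⇒≥ λ r → p (w , n≢0⇒n>0 q , r))) }

  conn-closed : ∀ {X Y} → Connected g X → Y ⊆ X → Nonempty Y → Separate Y (X ─ Y) → Y ≡ X
  conn-closed {X} {Y} c s ne sep = ⊆-─-∅ s λ ne' → let w , p , q = c Y s ne ne' in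
    [ (λ e → <-irrefl (sym e) p) , (λ e → <-irrefl (sym e) q) ]′ (sep w)

  deg-─-─ : ∀ {X Z Y} → Z ⊆ X → Y ⊆ Z → ∀ w → deg g (X ─ Y) w ≡ deg g (X ─ Z) w + deg g (Z ─ Y) w
  deg-─-─ {X} {Z} {Y} s t w = +-cancelˡ-≡ (deg g Y w) _ _ (begin
    deg g Y w + deg g (X ─ Y) w ≡⟨ deg-─ (λ p → s (t p)) w ⟨
    deg g X w ≡⟨ deg-─ s w ⟩
    deg g Z w + deg g (X ─ Z) w ≡⟨ cong (_+ deg g (X ─ Z) w) (deg-─ t w) ⟩
    deg g Y w + deg g (Z ─ Y) w + deg g (X ─ Z) w ≡⟨ lem (deg g Y w) _ _ ⟩
    deg g Y w + (deg g (X ─ Z) w + deg g (Z ─ Y) w) ∎)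
    where
    open ≡-Reasoning
    lem : ∀ a b c → a + b + c ≡ a + (c + b)
    lem = solve-∀

  deg-─-inv : ∀ {Z Y} → Y ⊆ Z → ∀ w → deg g (Z ─ (Z ─ Y)) w ≡ deg g Y w
  deg-─-inv {Z} {Y} t w = +-cancelˡ-≡ (deg g (Z ─ Y) w) _ _
    (trans (sym (deg-─ (p─q⊆p Z Y) w)) (trans (deg-─ t w) (+-comm (deg g Y w) _)))

  -- If one side of a separated split of `Z` is also cut off from `X ─ Z`, it is cut off from
  -- everything else in `X`, against the connectedness of `X`.
  conn-sub : ∀ {X Z} → Connected g X → Z ⊆ X →
    (∀ Y → Y ⊆ Z → Separate Y (Z ─ Y) → Separate Y (X ─ Z) ⊎ Separate (Z ─ Y) (X ─ Z)) →
    Connected g Z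
  conn-sub {X} {Z} c s h Y t ne ne' with separate? Y (Z ─ Y)
  ... | inj₂ p = p
  ... | inj₁ sep with h Y t sep
  ...   | inj₁ a = let i , p = ne' in
    contradiction (subst (i ∈_) (sym (conn-closed c (λ q → s (t q)) ne closed)) (s (proj₁ (∈─⁻ Z Y p))))
                  (proj₂ (∈─⁻ Z Y p))
    where
    closed : Separate Y (X ─ Y)
    closed w with sep w | a w
    ... | inj₁ p | _ = inj₁ p
    ... | inj₂ _ | inj₁ q = inj₁ q
    ... | inj₂ p | inj₂ q = inj₂ (trans (deg-─-─ s t w) (cong₂ _+_ q p))
  ...   | inj₂ a = let i , p = ne in
    contradiction p (proj₂ (∈─⁻ Z Y (subst (i ∈_) (sym (conn-closed c (λ q → s (p─q⊆p Z Y q)) ne' closed)) (s (t p)))))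
    where
    closed : Separate (Z ─ Y) (X ─ (Z ─ Y))
    closed w with sep w | a w
    ... | inj₂ p | _ = inj₁ p
    ... | inj₁ _ | inj₁ q = inj₁ q
    ... | inj₁ p | inj₂ q = inj₂ (trans (deg-─-─ s (p─q⊆p Z Y) w) (cong₂ _+_ q (trans (deg-─-inv t w) p)))

  conn-sub₁ : ∀ {X Z u} → Connected g X → Z ⊆ X →
    (∀ w → w ≢ u → deg g Z w ≡ 0 ⊎ deg g (X ─ Z) w ≡ 0) → Connected g Z
  conn-sub₁ {X} {Z} {u} c s h = conn-sub c s split
    where
    split : ∀ Y → Y ⊆ Z → Separate Y (Z ─ Y) → Separate Y (X ─ Z) ⊎ Separate (Z ─ Y) (X ─ Z)
    split Y t sep = [ (λ p → inj₁ (go t p)) , (λ p → inj₂ (go (p─q⊆p Z Y) p)) ]′ (sep u)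
      where
      go : ∀ {Y} → Y ⊆ Z → deg g Y u ≡ 0 → Separate Y (X ─ Z)
      go {Y} t p w with w ≟ u
      ... | yes refl = inj₁ p
      ... | no q = [ (λ r → inj₁ (n≤0⇒n≡0 (subst (deg g Y w ≤_) r (deg-mono t w)))) , inj₂ ]′ (h w q)

  parity : ∀ Y u → deg g Y u ≡ 1 → ¬ (∀ w → w ≢ u → 0or2 (deg g Y w))
  parity Y u p h = even≢odd ∣ Y ∣ (NS.sum k) (begin
    2 * ∣ Y ∣ ≡⟨ handshake Y ⟨
    NS.sum (deg g Y) ≡⟨ NS.sum-cong-≗ pointwise ⟩
    NS.sum (λ w → pt u w + 2 * k w) ≡⟨ NS.∑-distrib-+ (pt u) (λ w → 2 * k w) ⟩
    NS.sum (pt u) + NS.sum (λ w → 2 * k w) ≡⟨ cong₂ _+_ (sum-pt u) (sym (NS.*-distribˡ-sum 2 k)) ⟩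
    suc (2 * NS.sum k) ∎)
    where
    open ≡-Reasoning
    k : Fin v → ℕ
    k w = if does (u ≟ w) then 0 else sg (deg g Y w)
    pointwise : ∀ w → deg g Y w ≡ pt u w + 2 * k w
    pointwise w with u ≟ w
    ... | yes refl = p
    ... | no q = half (h w (q ∘ sym))

  -- By parity, the two ends of degree 1 lie in the same component.
  mkPath : ∀ {X P u u'} → Connected g X → P ⊆ X → u ≢ u' →
    (∀ w → w ≢ u → w ≢ u' → 0or2 (deg g X w)) →
    deg g P u ≡ 1 → deg g P u' ≡ 1 → (∀ w → w ≢ u → w ≢ u' → 0or2 (deg g P w)) →
    Path g u u' P
  mkPath {X} {P} {u} {u'} c s d hX p p' hP = d , (let e , q , _ = OnV⇒edge (subst (0 <_) (sym p) (s≤s z≤n)) in e , q) ,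
    conn-sub c s split , p , p' , hP
    where
    attach : ∀ {Y} → Y ⊆ P → deg g Y u ≡ 0 → deg g Y u' ≡ 0 → Separate Y (X ─ P)
    attach {Y} t q q' w with w ≟ u | w ≟ u'
    ... | yes refl | _ = inj₁ q
    ... | no _ | yes refl = inj₁ q'
    ... | no a | no b with hP w a b | hX w a b
    ...   | inj₁ r | _ = inj₁ (n≤0⇒n≡0 (subst (deg g Y w ≤_) r (deg-mono t w)))
    ...   | inj₂ r | inj₁ r' = inj₂ (n≤0⇒n≡0 (subst (deg g (X ─ P) w ≤_) r' (deg-mono (p─q⊆p X P) w)))
    ...   | inj₂ r | inj₂ r' = inj₂ (+-cancelˡ-≡ 2 _ 0 (trans (cong (_+ deg g (X ─ P) w) (sym r)) (trans (sym (deg-─ s w)) r')))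
    part : ∀ {Y w} → Y ⊆ P → Separate Y (P ─ Y) → deg g P w ≡ 1 → deg g Y w ≡ 1 ⊎ deg g Y w ≡ 0
    part {Y} {w} t sep r with sep w
    ... | inj₁ a = inj₂ a
    ... | inj₂ a = inj₁ (trans (sym (trans (deg-─ t w) (trans (cong (deg g Y w +_) a) (+-identityʳ _)))) r)
    part02 : ∀ {Y w} → Y ⊆ P → Separate Y (P ─ Y) → 0or2 (deg g P w) → 0or2 (deg g Y w)
    part02 {Y} {w} t sep r with sep w
    ... | inj₁ a = inj₁ a
    ... | inj₂ a = subst 0or2 (trans (deg-─ t w) (trans (cong (deg g Y w +_) a) (+-identityʳ _))) r
    rest : ∀ {Y} w → Y ⊆ P → deg g P w ≡ 1 → deg g Y w ≡ 1 → deg g (P ─ Y) w ≡ 0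
    rest {Y} w t r r' = +-cancelˡ-≡ 1 _ 0 (trans (cong (_+ deg g (P ─ Y) w) (sym r')) (trans (sym (deg-─ t w)) r))
    split : ∀ Y → Y ⊆ P → Separate Y (P ─ Y) → Separate Y (X ─ P) ⊎ Separate (P ─ Y) (X ─ P)
    split Y t sep with part t sep p | part t sep p'
    ... | inj₂ a | inj₂ b = inj₁ (attach t a b)
    ... | inj₁ a | inj₁ b = inj₂ (attach (p─q⊆p P Y) (rest u t p a) (rest u' t p' b))
    ... | inj₁ a | inj₂ b = contradiction (λ w q → case w ≟ u' of λ
            { (yes refl) → inj₁ b ; (no r) → part02 t sep (hP w q r) }) (parity Y u a)
    ... | inj₂ a | inj₁ b = contradiction (λ w q → case w ≟ u of λ
            { (yes refl) → inj₁ a ; (no r) → part02 t sep (hP w r q) }) (parity Y u' b)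

  -- The thetas and handcuffs; the degree conditions are all that minimality arguments need.
  Bicycle : Subset n → Set
  Bicycle X = Connected g X × (∀ w → deg g X w ≢ 1) × excess X ≡ 2

  cycle-∣∣ : ∀ {X} → Cycle g X → ∣ X ∣ ≡ nv X
  cycle-∣∣ {X} (_ , _ , h) = *-cancelˡ-≡ _ _ 2 (trans (excess-eq (even≢1 ∘ h))
    (trans (cong (2 * nv X +_) (sum≡0⁺ λ w → z (h w))) (+-identityʳ _)))
    where
    z : ∀ {m} → 0or2 m → m ∸ 2 ≡ 0
    z (inj₁ refl) = refl
    z (inj₂ refl) = refl

  bicycle-∣∣ : ∀ {X} → Bicycle X → ∣ X ∣ ≡ suc (nv X)
  bicycle-∣∣ {X} (_ , h , e) = *-cancelˡ-≡ _ _ 2 (trans (excess-eq h) (trans (cong (2 * nv X +_) e) (lem (nv X))))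
    where
    lem : ∀ a → 2 * a + 2 ≡ 2 * suc a
    lem = solve-∀

  -- Wherever `Y` meets a vertex it already uses both edge ends that `X` has there, so it is
  -- separated from the rest of the connected set `X`.
  cycle-minimal : ∀ {X Y} → Cycle g X → Y ⊆ X → Nonempty Y → (∀ w → deg g Y w ≢ 1) → Y ≡ X
  cycle-minimal {X} {Y} (_ , c , h) s ne d = conn-closed c s ne sep
    where
    sep : Separate Y (X ─ Y)
    sep w with deg g Y w | deg g (X ─ Y) w | subst 0or2 (deg-─ s w) (h w) | d w
    ... | 0 | _ | _ | _ = inj₁ refl
    ... | suc _ | 0 | _ | _ = inj₂ refl
    ... | 1 | suc b | _ | q = contradiction refl q
    ... | suc (suc a) | suc b | inj₂ q | _ = contradiction (trans (sym (+-suc a b)) (suc-injective (suc-injective q))) λ ()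

  -- Equal excess makes the degrees agree above 2, so `Y` takes up the whole degree of `X` at every
  -- vertex it meets. Connectedness finishes the argument as for cycles.
  bicycle-minimal : ∀ {X Y} → Bicycle X → Bicycle Y → Y ⊆ X → Nonempty Y → Y ≡ X
  bicycle-minimal {X} {Y} (c , h , e) (_ , h' , e') s ne = conn-closed c s ne sep
    where
    eq : ∀ w → deg g Y w ∸ 2 ≡ deg g X w ∸ 2
    eq = sum-squeeze (λ w → ∸-monoˡ-≤ 2 (deg-mono s w)) (≤-reflexive (trans e (sym e')))
    sep : Separate Y (X ─ Y)
    sep w with deg g Y w | deg g X w | deg g (X ─ Y) w | deg-─ s w | eq w | h' w
    ... | 0 | _ | _ | _ | _ | _ = inj₁ refl
    ... | 1 | _ | _ | _ | _ | q = contradiction refl q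
    ... | suc (suc a) | _ | b | refl | q | _ = inj₂ (+-cancelˡ-≡ a b 0 (trans (sym q) (sym (+-identityʳ a))))

  bicycle-nonempty : ∀ {X} → Bicycle X → Nonempty X
  bicycle-nonempty b = 0<∣∣⇒Nonempty (subst (0 <_) (sym (bicycle-∣∣ b)) (s≤s z≤n))

-- Thetas and handcuffs

∪-─ : ∀ {n} {X Y : Subset n} → Y ⊆ X → X ≡ Y ∪ (X ─ Y)
∪-─ {X = X} {Y} s = ⊆-antisym
  (λ {i} p → case i ∈? Y of λ { (yes q) → x∈p∪q⁺ (inj₁ q) ; (no q) → x∈p∪q⁺ {p = Y} (inj₂ (x∈p∧x∉q⇒x∈p─q p q)) })
  (λ p → [ s , (λ q → p─q⊆p X Y q) ]′ (x∈p∪q⁻ Y (X ─ Y) p))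

minus : ∀ a b {x y z} → x ≡ y + z → x ≡ a + b → y ≡ a → z ≡ b
minus a b {z = z} p q refl = +-cancelˡ-≡ a z b (trans (sym p) q)

module _ {v n : ℕ} (g : Graph v n) where

  -- The two handcuff clauses of `FrameCircuit` stripped of balance, so that shapes can be studied
  -- before any cycles are declared balanced.
  Tight Loose : Subset n → Set
  Tight X = ∃[ C₁ ] ∃[ C₂ ] (Cycle g C₁ × Cycle g C₂ × C₁ ∩ C₂ ≡ ∅
    × (∃[ w ] (OnV g C₁ w × OnV g C₂ w × (∀ w' → OnV g C₁ w' → OnV g C₂ w' → w' ≡ w)))
    × X ≡ C₁ ∪ C₂)
  Loose X = ∃[ C₁ ] ∃[ C₂ ] ∃[ P ] ∃[ u ] ∃[ u' ] (Cycle g C₁ × Cycle g C₂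
    × (∀ w → OnV g C₁ w → OnV g C₂ w → ⊥)
    × Path g u u' P × OnV g C₁ u × OnV g C₂ u'
    × P ∩ C₁ ≡ ∅ × P ∩ C₂ ≡ ∅
    × (∀ w → OnV g P w → OnV g C₁ w → w ≡ u)
    × (∀ w → OnV g P w → OnV g C₂ w → w ≡ u')
    × X ≡ (C₁ ∪ C₂) ∪ P)

  0or2? : ∀ {m} → 0or2 m → m ≡ 0 ⊎ 0 < m
  0or2? (inj₁ p) = inj₁ p
  0or2? (inj₂ refl) = inj₂ (s≤s z≤n)

  private
    on : ∀ {m k} → m ≡ suc k → 0 < m
    on refl = s≤s z≤n

    fits : ∀ {x y z} → x ≡ y + z → 0or2 x → 0or2 y → 0or2 z
    fits {z = z} p hx (inj₁ refl) = subst (0or2) p hx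
    fits {z = z} p (inj₁ refl) (inj₂ refl) = contradiction p λ ()
    fits {z = z} p (inj₂ q) (inj₂ refl) = inj₁ (minus 2 0 p q refl)

    twice : ∀ {x y z} → x ≡ y + z → 0or2 x → 0or2 y → 0or2 z → 0 < y → 0 < z → ⊥
    twice p hx hy hz q r with two hy q | two hz r
    twice refl (inj₁ ()) _ _ _ _ | refl | refl
    twice refl (inj₂ ()) _ _ _ _ | refl | refl

  -- A cycle leaves a path whose interior vertices have no other edges only at its ends.
  path-absorb : ∀ {X P C u u'} → Path g u u' P → P ⊆ X →
    (∀ w → w ≢ u → w ≢ u' → OnV g P w → deg g (X ─ P) w ≡ 0) →
    Cycle g C → C ⊆ X → Nonempty (C ∩ P) → P ⊆ C
  path-absorb {X} {P} {C} {u} {u'} (_ , _ , cP , p , p' , hP) s h (_ , _ , hC) t ne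
    with nonempty? (P ─ (C ∩ P))
  ... | no q = λ r → proj₁ (x∈p∩q⁻ C P (subst (_ ∈_) (sym (⊆-─-∅ (λ a → proj₂ (x∈p∩q⁻ C P a)) q)) r))
  ... | yes q with cP (C ∩ P) (λ a → proj₂ (x∈p∩q⁻ C P a)) ne q
  ...   | w , a , b = ⊥-elim absurd
    where
    Q = C ∩ P
    Q⊆P : Q ⊆ P
    Q⊆P r = proj₂ (x∈p∩q⁻ C P r)
    Q⊆C : Q ⊆ C
    Q⊆C r = proj₁ (x∈p∩q⁻ C P r)
    end : deg g P w ≢ 1
    end r = <-irrefl (sym r) (subst (2 ≤_) (sym (deg-─ g Q⊆P w)) (+-mono-≤ a b))
    absurd : ⊥
    absurd with w ≟ u | w ≟ u'
    ... | yes refl | _ = end p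
    ... | no _ | yes refl = end p'
    ... | no d | no d' = even≢1 (hC w) (trans (deg-─ g Q⊆C w) (cong₂ _+_ degQ deg0))
      where
      onP : OnV g P w
      onP = <-≤-trans a (deg-mono g Q⊆P w)
      deg0 : deg g (C ─ Q) w ≡ 0
      deg0 = n≤0⇒n≡0 (subst (deg g (C ─ Q) w ≤_) (h w d d' onP) (deg-mono g (λ r →
        let r₁ , r₂ = ∈─⁻ C Q r in x∈p∧x∉q⇒x∈p─q (t r₁) (λ r₃ → r₂ (x∈p∩q⁺ (r₁ , r₃)))) w))
      degQ : deg g Q w ≡ 1
      degQ = ≤-antisym (≤-pred (subst (suc (deg g Q w) ≤_) (trans (sym (deg-─ g Q⊆P w)) (two (hP w d d') onP))
               (subst (_≤ deg g Q w + deg g (P ─ Q) w) (+-comm (deg g Q w) 1) (+-monoʳ-≤ (deg g Q w) b)))) a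

  mkIntDisj : ∀ {X P Q u u'} → P ⊆ X → Q ⊆ X → (∀ {i} → i ∈ P → i ∉ Q) →
    (∀ w → w ≢ u → w ≢ u' → 0or2 (deg g X w)) →
    (∀ w → w ≢ u → w ≢ u' → 0or2 (deg g P w)) →
    (∀ w → w ≢ u → w ≢ u' → 0or2 (deg g Q w)) → IntDisj g u u' P Q
  mkIntDisj {X} {P} {Q} {u} {u'} s t d hX hP hQ = ∅-∩ d , meet
    where
    meet : ∀ w → OnV g P w → OnV g Q w → w ≡ u ⊎ w ≡ u'
    meet w a b with w ≟ u | w ≟ u'
    ... | yes e | _ = inj₁ e
    ... | no _ | yes e = inj₂ e
    ... | no e | no e' = ⊥-elim (contradiction
          (≤-trans (≤-reflexive (sym (trans (deg-∪ g d w) (cong₂ _+_ (two (hP w e e') a) (two (hQ w e e') b)))))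
                   (deg-mono g {X} {P ∪ Q} (λ r → [ s , t ]′ (x∈p∪q⁻ P Q r)) w))
          (big (hX w e e')))
      where
      big : ∀ {m} → 0or2 m → ¬ 4 ≤ m
      big (inj₂ refl) (s≤s (s≤s ()))

  -- A cycle of `X` passes through none, one or both of the vertices of degree 3. In the first case
  -- it would be a component, in the second it belongs to a loose handcuff, in the third to a theta.
  module TwoBranch {X u u'} (c : Connected g X) (ud : u ≢ u') (d₃ : deg g X u ≡ 3) (d₃' : deg g X u' ≡ 3)
                   (hX : ∀ w → w ≢ u → w ≢ u' → 0or2 (deg g X w))
                   (findCycle : ∀ {Z} → Z ⊆ X → Nonempty Z → nv g Z ≤ ∣ Z ∣ → ∃[ C ] (C ⊆ Z × Cycle g C))
                   (sizeX : suc (nv g X) ≡ ∣ X ∣) where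

    module _ {Y} (s : Y ⊆ X) (cyc : Cycle g Y) where
      private
        hY = proj₂ (proj₂ cyc)
        Z = X ─ Y
        Z⊆X : Z ⊆ X
        Z⊆X = p─q⊆p X Y
        hZ : ∀ w → w ≢ u → w ≢ u' → 0or2 (deg g Z w)
        hZ w a b = fits (deg-─ g s w) (hX w a b) (hY w)

      untouched : deg g Y u ≡ 0 → deg g Y u' ≡ 0 → ⊥
      untouched p p' = contradiction (trans (sym p) (trans (cong (λ S → deg g S u) eq) d₃)) λ ()
        where
        sep : Separate g Y (X ─ Y)
        sep w with w ≟ u | w ≟ u'
        ... | yes refl | _ = inj₁ p
        ... | no _ | yes refl = inj₁ p'
        ... | no a | no b with hY w
        ...   | inj₁ q = inj₁ q
        ...   | inj₂ q with hX w a b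
        ...     | inj₁ r = contradiction (trans (sym r) (trans (deg-─ g s w) (cong (_+ deg g (X ─ Y) w) q))) λ ()
        ...     | inj₂ r = inj₂ (minus 2 0 (deg-─ g s w) r q)
        eq : Y ≡ X
        eq = conn-closed g c s (proj₁ cyc) sep

      loose : deg g Y u ≡ 2 → deg g Y u' ≡ 0 → (∀ {C} → C ⊆ X → Cycle g C → deg g C u ≡ 0 → deg g C u' ≡ 0 → ⊥) → Loose X
      loose p p' un with findCycle {Z} Z⊆X neZ (≤-reflexive (sym sizeZ))
        where
        zu : deg g Z u ≡ 1
        zu = minus 2 1 (deg-─ g s u) d₃ p
        zu' : deg g Z u' ≡ 3
        zu' = minus 0 3 (deg-─ g s u') d₃' p'
        neZ : Nonempty Z
        neZ = let e , q , _ = OnV⇒edge g (on zu) in e , q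
        -- Without `Y` the degree is 1 at `u`, 3 at `u'`, and 0 or 2 elsewhere. The surplus at `u'`
        -- balances the deficit at `u`, so `Z` has as many edges as vertices and contains a cycle.
        pointwise : ∀ w → deg g Z w + pt u w ≡ 2 * sg (deg g Z w) + pt u' w
        pointwise w with u ≟ w | u' ≟ w
        ... | yes refl | yes refl = contradiction refl ud
        ... | yes refl | no _ rewrite zu = refl
        ... | no _ | yes refl rewrite zu' = refl
        ... | no a | no b = cong (_+ 0) (half (hZ w (a ∘ sym) (b ∘ sym)))
        sizeZ : ∣ Z ∣ ≡ nv g Z
        sizeZ = *-cancelˡ-≡ _ _ 2 (+-cancelʳ-≡ 1 _ _ (begin
          2 * ∣ Z ∣ + 1 ≡⟨ cong₂ _+_ (handshake g Z) (sum-pt u) ⟨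
          NS.sum (deg g Z) + NS.sum (pt u) ≡⟨ NS.∑-distrib-+ (deg g Z) (pt u) ⟨
          NS.sum (λ w → deg g Z w + pt u w) ≡⟨ NS.sum-cong-≗ pointwise ⟩
          NS.sum (λ w → 2 * sg (deg g Z w) + pt u' w) ≡⟨ NS.∑-distrib-+ (λ w → 2 * sg (deg g Z w)) (pt u') ⟩
          _ ≡⟨ cong₂ _+_ (sym (NS.*-distribˡ-sum 2 (λ w → sg (deg g Z w)))) (sum-pt u') ⟩
          2 * nv g Z + 1 ∎))
          where open ≡-Reasoning
      ... | C , C⊆Z , cycC@(_ , _ , hC) =
        Y , C , P , u , u' , cyc , cycC , disj , path , on p , on cu' ,
        ∅-∩ P∉Y , ∅-∩ (λ q → proj₂ (∈─⁻ Z C q)) , meetY , meetC , eq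
        where
        zu : deg g Z u ≡ 1
        zu = minus 2 1 (deg-─ g s u) d₃ p
        zu' : deg g Z u' ≡ 3
        zu' = minus 0 3 (deg-─ g s u') d₃' p'
        C⊆X : C ⊆ X
        C⊆X q = Z⊆X (C⊆Z q)
        P = Z ─ C
        cu : deg g C u ≡ 0
        cu with hC u
        ... | inj₁ q = q
        ... | inj₂ q = contradiction (subst₂ _≤_ q zu (deg-mono g C⊆Z u)) λ { (s≤s ()) }
        cu' : deg g C u' ≡ 2
        cu' with hC u'
        ... | inj₁ q = ⊥-elim (un C⊆X cycC cu q)
        ... | inj₂ q = q
        P⊆X : P ⊆ X
        P⊆X q = Z⊆X (p─q⊆p Z C q)
        P∉Y : ∀ {i} → i ∈ P → i ∉ Y
        P∉Y q = proj₂ (∈─⁻ X Y (p─q⊆p Z C q))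
        pu : deg g P u ≡ 1
        pu = minus 0 1 (deg-─ g C⊆Z u) zu cu
        pu' : deg g P u' ≡ 1
        pu' = minus 2 1 (deg-─ g C⊆Z u') zu' cu'
        hP : ∀ w → w ≢ u → w ≢ u' → 0or2 (deg g P w)
        hP w a b = fits (deg-─ g C⊆Z w) (hZ w a b) (hC w)
        path : Path g u u' P
        path = mkPath g c P⊆X ud hX pu pu' hP
        zero≢on : ∀ {m} → m ≡ 0 → ¬ 0 < m
        zero≢on refl ()
        disj : ∀ w → OnV g Y w → OnV g C w → ⊥
        disj w a b with w ≟ u | w ≟ u'
        ... | yes refl | _ = zero≢on cu b
        ... | no _ | yes refl = zero≢on p' a
        ... | no q | no r = twice (deg-─ g s w) (hX w q r) (hY w) (hZ w q r) a (<-≤-trans b (deg-mono g C⊆Z w))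
        meetY : ∀ w → OnV g P w → OnV g Y w → w ≡ u
        meetY w a b with w ≟ u | w ≟ u'
        ... | yes e | _ = e
        ... | no _ | yes refl = contradiction b (zero≢on p')
        ... | no q | no r = ⊥-elim (twice (deg-─ g s w) (hX w q r) (hY w) (hZ w q r) b (<-≤-trans a (deg-mono g (p─q⊆p Z C) w)))
        meetC : ∀ w → OnV g P w → OnV g C w → w ≡ u'
        meetC w a b with w ≟ u | w ≟ u'
        ... | _ | yes e = e
        ... | yes refl | no _ = contradiction b (zero≢on cu)
        ... | no q | no r = ⊥-elim (twice (deg-─ g C⊆Z w) (hZ w q r) (hC w) (hP w q r) b a)
        eq : X ≡ (Y ∪ C) ∪ P
        eq = ⊆-antisym
          (λ {i} q → case i ∈? Y of λ
            { (yes r) → x∈p∪q⁺ {p = Y ∪ C} (inj₁ (x∈p∪q⁺ (inj₁ r)))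
            ; (no r) → case i ∈? C of λ
              { (yes t) → x∈p∪q⁺ {p = Y ∪ C} (inj₁ (x∈p∪q⁺ {p = Y} (inj₂ t)))
              ; (no t) → x∈p∪q⁺ {p = Y ∪ C} (inj₂ (x∈p∧x∉q⇒x∈p─q (x∈p∧x∉q⇒x∈p─q q r) t)) } })
          (λ q → [ (λ r → [ s , C⊆X ]′ (x∈p∪q⁻ Y C r)) , P⊆X ]′ (x∈p∪q⁻ (Y ∪ C) P q))

      theta : deg g Y u ≡ 2 → deg g Y u' ≡ 2 → Theta g X
      -- Removing an edge of `Y` leaves at least as many edges as vertices, hence a second cycle
      -- `C`. It must contain the path `Z` outside `Y`; the other two paths are the rest of `C` and
      -- what that rest leaves of `Y`.
      theta p p' with findCycle {X - e} (λ q → proj₁ (∈-⁻ q)) ne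
                        (≤-pred (≤-trans (s≤s (nv-mono g λ q → proj₁ (∈-⁻ q)))
                                         (≤-reflexive (trans sizeX (∣∣-remove (s eY))))))
        where
        e = proj₁ (proj₁ cyc)
        eY = proj₂ (proj₁ cyc)
        ne : Nonempty (X - e)
        ne = let i , q , _ = OnV⇒edge g (on (minus 2 1 (deg-─ g s u) d₃ p)) ; a , b = ∈─⁻ X Y q in
             i , x∈p∧x≢y⇒x∈p-y a λ { refl → b eY }
      ... | C , C⊆ , cycC@(neC , _ , hC) =
        u , u' , P₁ , P₂ , Z , path₁ , path₂ , pathZ ,
        mkIntDisj P₁⊆X P₂⊆X (λ q r → proj₂ (∈─⁻ Y P₁ r) q) hX h₁ h₂ ,
        mkIntDisj P₁⊆X Z⊆X (λ q r → proj₂ (∈─⁻ C Z q) r) hX h₁ hZ ,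
        mkIntDisj P₂⊆X Z⊆X (λ q r → proj₂ (∈─⁻ X Y r) (p─q⊆p Y P₁ q)) hX h₂ hZ ,
        eq
        where
        e = proj₁ (proj₁ cyc)
        eY = proj₂ (proj₁ cyc)
        C⊆X : C ⊆ X
        C⊆X q = proj₁ (∈-⁻ (C⊆ q))
        zu : deg g Z u ≡ 1
        zu = minus 2 1 (deg-─ g s u) d₃ p
        zu' : deg g Z u' ≡ 1
        zu' = minus 2 1 (deg-─ g s u') d₃' p'
        pathZ : Path g u u' Z
        pathZ = mkPath g c Z⊆X ud hX zu zu' hZ
        C∩Z : Nonempty (C ∩ Z)
        C∩Z with ⊆⊎∃ C Y
        ... | inj₂ (i , a , b) = i , x∈p∩q⁺ (a , x∈p∧x∉q⇒x∈p─q (C⊆X a) b)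
        ... | inj₁ t = contradiction refl (proj₂ (∈-⁻ {p = X} (C⊆ (subst (e ∈_) (sym (cycle-minimal g cyc t neC (λ w → even≢1 (hC w)))) eY))))
        inner : ∀ w → w ≢ u → w ≢ u' → OnV g Z w → deg g (X ─ Z) w ≡ 0
        inner w a b q with hX w a b
        ... | inj₁ r = contradiction (subst (0 <_) (n≤0⇒n≡0 (subst (deg g Z w ≤_) r (deg-mono g Z⊆X w))) q) λ ()
        ... | inj₂ r = minus 2 0 (deg-─ g Z⊆X w) r (two (hZ w a b) q)
        Z⊆C : Z ⊆ C
        Z⊆C = path-absorb pathZ Z⊆X inner cycC C⊆X C∩Z
        P₁ = C ─ Z
        P₂ = Y ─ P₁
        P₁⊆Y : P₁ ⊆ Y
        P₁⊆Y {i} q = decidable-stable (i ∈? Y) λ r → let a , b = ∈─⁻ C Z q in b (x∈p∧x∉q⇒x∈p─q (C⊆X a) r)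
        P₁⊆X : P₁ ⊆ X
        P₁⊆X q = s (P₁⊆Y q)
        P₂⊆X : P₂ ⊆ X
        P₂⊆X q = s (p─q⊆p Y P₁ q)
        c₂ : ∀ w → deg g Z w ≡ 1 → deg g C w ≡ 2
        c₂ w q = two (hC w) (<-≤-trans (on q) (deg-mono g Z⊆C w))
        h₁ : ∀ w → w ≢ u → w ≢ u' → 0or2 (deg g P₁ w)
        h₁ w a b = fits (deg-─ g Z⊆C w) (hC w) (hZ w a b)
        u₁ : deg g P₁ u ≡ 1
        u₁ = minus 1 1 (deg-─ g Z⊆C u) (c₂ u zu) zu
        u₁' : deg g P₁ u' ≡ 1
        u₁' = minus 1 1 (deg-─ g Z⊆C u') (c₂ u' zu') zu'
        path₁ : Path g u u' P₁
        path₁ = mkPath g c P₁⊆X ud hX u₁ u₁' h₁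
        h₂ : ∀ w → w ≢ u → w ≢ u' → 0or2 (deg g P₂ w)
        h₂ w a b = fits (deg-─ g P₁⊆Y w) (hY w) (h₁ w a b)
        path₂ : Path g u u' P₂
        path₂ = mkPath g c P₂⊆X ud hX (minus 1 1 (deg-─ g P₁⊆Y u) p u₁) (minus 1 1 (deg-─ g P₁⊆Y u') p' u₁') h₂
        eq : X ≡ (P₁ ∪ P₂) ∪ Z
        eq = trans (∪-─ Z⊆X) (trans (∪-comm Z (X ─ Z))
               (cong (_∪ Z) (trans X─Z≡Y (∪-─ P₁⊆Y))))
          where
          X─Z≡Y : X ─ Z ≡ Y
          X─Z≡Y = ⊆-antisym
            (λ {i} q → decidable-stable (i ∈? Y) λ r → let a , b = ∈─⁻ X Z q in b (x∈p∧x∉q⇒x∈p─q a r))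
            (λ q → x∈p∧x∉q⇒x∈p─q (s q) λ r → proj₂ (∈─⁻ X Y r) q)

  open TwoBranch


  -- Excess 2 sits either at one vertex of degree 4 or at two vertices of degree 3. The existence of
  -- cycles is a hypothesis because it is derived from dependence of incidence vectors, which needs
  -- the matrices introduced afterwards.
  classify : (∀ {Z} → Nonempty Z → nv g Z ≤ ∣ Z ∣ → ∃[ C ] (C ⊆ Z × Cycle g C)) →
    ∀ {X} → Bicycle g X → Tight X ⊎ Loose X ⊎ Theta g X
  classify findCycle {X} b@(c , odd , ex) with findCycle (bicycle-nonempty g b) (≤-trans (n≤1+n _) (≤-reflexive (sym (bicycle-∣∣ g b)))) | sum≡2 ex
  ... | Y , s , cyc@(neY , _ , hY) | inj₁ (w , d , h) = inj₁ (Y , Z , cyc , (neZ , cZ , hZ) , ∅-∩ (λ p q → proj₂ (∈─⁻ X Y q) p) , (w , on yw , on zw , meet) , ∪-─ s)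
    where
    Z = X ─ Y
    ∸2≡2 : ∀ {m} → m ∸ 2 ≡ 2 → m ≡ 4
    ∸2≡2 {suc (suc m)} refl = refl
    xw : deg g X w ≡ 4
    xw = ∸2≡2 d
    ev : ∀ {m} → m ≢ 1 → m ∸ 2 ≡ 0 → 0or2 m
    ev {0} p q = inj₁ refl
    ev {1} p q = contradiction refl p
    ev {2} p q = inj₂ refl
    hX : ∀ x → x ≢ w → 0or2 (deg g X x)
    hX x p = ev (odd x) (h x p)
    hZ′ : ∀ x → x ≢ w → 0or2 (deg g Z x)
    hZ′ x p = fits (deg-─ g s x) (hX x p) (hY x)
    sep : ∀ x → x ≢ w → deg g Z x ≡ 0 ⊎ deg g Y x ≡ 0
    sep x p with 0or2? (hZ′ x p) | 0or2? (hY x)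
    ... | inj₁ q | _ = inj₁ q
    ... | inj₂ _ | inj₁ q = inj₂ q
    ... | inj₂ q | inj₂ r = ⊥-elim (twice (deg-─ g s x) (hX x p) (hY x) (hZ′ x p) r q)
    yw : deg g Y w ≡ 2
    yw with hY w
    ... | inj₂ p = p
    ... | inj₁ p = contradiction (trans (sym p) (trans (cong (λ S → deg g S w) eq) xw)) λ ()
      where
      sep′ : Separate g Y (X ─ Y)
      sep′ x with x ≟ w
      ... | yes refl = inj₁ p
      ... | no q = [ inj₂ , inj₁ ]′ (sep x q)
      eq : Y ≡ X
      eq = conn-closed g c s neY sep′
    zw : deg g Z w ≡ 2
    zw = minus 2 2 (deg-─ g s w) xw yw
    hZ : ∀ x → 0or2 (deg g Z x)
    hZ x with x ≟ w
    ... | yes refl = inj₂ zw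
    ... | no p = hZ′ x p
    neZ : Nonempty Z
    neZ = let e , q , _ = OnV⇒edge g (on zw) in e , q
    cZ : Connected g Z
    cZ = conn-sub₁ g c (p─q⊆p X Y) λ x p → [ inj₁ , (λ q → inj₂ (trans (deg-─-inv g s x) q)) ]′ (sep x p)
    meet : ∀ x → OnV g Y x → OnV g Z x → x ≡ w
    meet x p q with x ≟ w
    ... | yes e = e
    ... | no r = ⊥-elim (twice (deg-─ g s x) (hX x r) (hY x) (hZ′ x r) p q)
  ... | Y , s , cyc@(_ , _ , hY) | inj₂ (u , u' , ud , d , d' , h) = inj₂ (go (hY u) (hY u'))
    where
    ∸2≡1 : ∀ {m} → m ∸ 2 ≡ 1 → m ≡ 3
    ∸2≡1 {suc (suc m)} refl = refl
    ev : ∀ {m} → m ≢ 1 → m ∸ 2 ≡ 0 → 0or2 m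
    ev {0} p q = inj₁ refl
    ev {1} p q = contradiction refl p
    ev {2} p q = inj₂ refl
    hX : ∀ x → x ≢ u → x ≢ u' → 0or2 (deg g X x)
    hX x p q = ev (odd x) (h x p q)
    sizeX = sym (bicycle-∣∣ g b)
    find : ∀ {Z} → Z ⊆ X → Nonempty Z → nv g Z ≤ ∣ Z ∣ → ∃[ C ] (C ⊆ Z × Cycle g C)
    find _ = findCycle
    un : ∀ {C} → C ⊆ X → Cycle g C → deg g C u ≡ 0 → deg g C u' ≡ 0 → ⊥
    un t y = untouched c ud (∸2≡1 d) (∸2≡1 d') hX find sizeX t y
    go : 0or2 (deg g Y u) → 0or2 (deg g Y u') → Loose X ⊎ Theta g X
    go (inj₁ p) (inj₁ q) = ⊥-elim (un s cyc p q)
    go (inj₂ p) (inj₁ q) = inj₁ (loose c ud (∸2≡1 d) (∸2≡1 d') hX find sizeX s cyc p q un)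
    go (inj₁ p) (inj₂ q) = inj₁ (loose c (ud ∘ sym) (∸2≡1 d') (∸2≡1 d) (λ x a b → hX x b a) find sizeX s cyc q p
                                       (λ t y a b → un t y b a))
    go (inj₂ p) (inj₂ q) = inj₂ (theta c ud (∸2≡1 d) (∸2≡1 d') hX find sizeX s cyc p q)

-- Matrices carried by graphs

-- At the end of a loop the entry of A is unconstrained, so that loops may be balanced or not.
Carried : ∀ {v n} → Graph v n → Matrix v n → Set
Carried g A = ∀ e w → (ends-at g e w ≡ 0 → A w e ≡ 𝟘) × (ends-at g e w ≡ 1 → A w e ≢ 𝟘)

-- The oriented incidence matrix, with minus one at the second end. A loop gets a zero column and is
-- therefore dependent, as a cycle of length one has to be.
incidence : ∀ {v n} → Graph v n → Matrix v n
incidence g w e = δ (proj₁ (g e)) w ⊕ 𝟚 ⊗ δ (proj₂ (g e)) w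

sum-δ : ∀ {n} (i : Fin n) → FS.sum (δ i) ≡ 𝟙
sum-δ i = trans (sum-single i λ j p → δ-≢ (p ∘ sym)) (δ-refl i)

ones : ∀ {n} → Fin n → F
ones _ = 𝟙

incidence-col : ∀ {v n} (g : Graph v n) e → ones ∙ (λ w → incidence g w e) ≡ 𝟘
incidence-col g e = trans (FS.∑-distrib-+ (δ (proj₁ (g e))) (λ w → 𝟚 ⊗ δ (proj₂ (g e)) w))
  (cong₂ _⊕_ (sum-δ (proj₁ (g e))) (trans (sym (FS.*-distribˡ-sum 𝟚 (δ (proj₂ (g e))))) (cong (𝟚 ⊗_) (sum-δ (proj₂ (g e))))))

module _ {v n : ℕ} (g : Graph v n) where

  incidence-carried : Carried g (incidence g)
  incidence-carried e w with does (proj₁ (g e) ≟ w) | does (proj₂ (g e) ≟ w)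
  ... | true  | true  = (λ ()) , (λ ())
  ... | true  | false = (λ ()) , (λ _ ())
  ... | false | true  = (λ ()) , (λ _ ())
  ... | false | false = (λ _ → refl) , (λ ())

  module _ {A : Matrix v n} (car : Carried g A) where

    large⇒Dep : ∀ {X} → nv g X < ∣ X ∣ → Dep (KerS A) X
    large⇒Dep {X} = pigeonhole A X (λ w → sg (deg g X w)) λ w {e} p q →
      proj₁ (car e w) (n≤0⇒n≡0 (subst (ends-at g e w ≤_) (sg≡0 p) (ends≤deg g q w)))

    -- At a vertex of degree 1 the row equation would have a single nonzero term.
    Ker-deg≢1 : ∀ {K x} → Ker A x → Supported x K → (∀ {i} → i ∈ K → x i ≢ 𝟘) → ∀ w → deg g K w ≢ 1
    Ker-deg≢1 {K} {x} k s nz w p with sum≡1 (trans (sym (deg-sum g K w)) p)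
    ... | e , q , r = ⊗-nonzero (proj₂ (car e w) (m*n≡1⇒n≡1 (χ K e) _ q)) (nz eK) (trans (sym (sum-single e others)) (k w))
      where
      eK : e ∈ K
      eK = χ≢0 {X = K} λ t → contradiction (trans (sym q) (cong (_* ends-at g e w) t)) λ ()
      others : ∀ j → j ≢ e → A w j ⊗ x j ≡ 𝟘
      others j d with j ∈? K
      ... | no t = trans (cong (A w j ⊗_) (∉-Supported {x = x} s t)) (⊗-zeroʳ _)
      ... | yes t = cong (_⊗ x j) (proj₁ (car j w)
              (trans (sym (*-identityˡ _)) (trans (cong (_* ends-at g j w) (sym (χ-∈ t))) (r j d))))

    MinDep-deg≢1 : ∀ {K} → MinDep (KerS A) K → ∀ w → deg g K w ≢ 1
    MinDep-deg≢1 m = let x , k , s , nz = MinDep-vec (KerS A) m in Ker-deg≢1 {x = x} k s nz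

    private
      restrict : Subset n → (Fin n → F) → Fin n → F
      restrict Y x i = if does (i ∈? Y) then x i else 𝟘

      restrict-∈ : ∀ {Y x i} → i ∈ Y → restrict Y x i ≡ x i
      restrict-∈ {Y} {x} {i} p = cong (if_then x i else 𝟘) (dec-true (i ∈? Y) p)

      restrict-∉ : ∀ {Y x i} → i ∉ Y → restrict Y x i ≡ 𝟘
      restrict-∉ {Y} {x} {i} p = cong (if_then x i else 𝟘) (dec-false (i ∈? Y) p)

    -- Restricting the vector to a separated part turns each row sum into itself or into an empty
    -- one, so the restriction stays in the kernel and minimality applies to it.
    MinDep-connected : ∀ {K} → MinDep (KerS A) K → Connected g K
    MinDep-connected {K} m Y t (i , iY) (j , jK─Y) with separate? g Y (K ─ Y)
    ... | inj₂ p = p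
    ... | inj₁ sep = contradiction (subst (j ∈_) (sym eq) (proj₁ (∈─⁻ K Y jK─Y))) (proj₂ (∈─⁻ K Y jK─Y))
      where
      vec = MinDep-vec (KerS A) m
      x = proj₁ vec
      y = restrict Y x
      row : ∀ w → A w ∙ y ≡ 𝟘
      row w with sep w
      ... | inj₁ p = sum-zero λ e → case e ∈? Y of λ
        { (yes q) → cong (_⊗ y e) (proj₁ (car e w) (n≤0⇒n≡0 (subst (ends-at g e w ≤_) p (ends≤deg g q w))))
        ; (no q) → trans (cong (A w e ⊗_) (restrict-∉ {Y} {x} q)) (⊗-zeroʳ _) }
      ... | inj₂ p = trans (FS.sum-cong-≗ term) (proj₁ (proj₂ vec) w)
        where
        term : ∀ e → A w e ⊗ y e ≡ A w e ⊗ x e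
        term e with e ∈? K
        ... | no q = cong (A w e ⊗_) (trans (restrict-∉ {Y} {x} (q ∘ t)) (sym (∉-Supported {x = x} (proj₁ (proj₂ (proj₂ vec))) q)))
        ... | yes q = case e ∈? Y of λ
          { (yes r) → cong (A w e ⊗_) (restrict-∈ {Y} {x} r)
          ; (no r) → let A≡𝟘 = proj₁ (car e w) (n≤0⇒n≡0 (subst (ends-at g e w ≤_) p (ends≤deg g (x∈p∧x∉q⇒x∈p─q q r) w))) in
                     trans (cong (_⊗ y e) A≡𝟘) (sym (cong (_⊗ x e) A≡𝟘)) }
      eq : Y ≡ K
      eq = proj₂ m Y t (y , row ,
             (λ {e} p → decidable-stable (e ∈? Y) λ q → p (restrict-∉ {Y} {x} q)) ,
             i , λ p → proj₂ (proj₂ (proj₂ vec)) (t iY) (trans (sym (restrict-∈ {Y} {x} iY)) p))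

  -- A minimal set with more edges than vertices. Deleting one edge shows that the surplus is
  -- exactly one and that no vertex has degree 1; a separated split would leave a surplus on one of
  -- its sides.
  large⇒Bicycle : ∀ {X} → nv g X < ∣ X ∣ → ∃[ T ] (T ⊆ X × Bicycle g T)
  large⇒Bicycle {X} lt with minimal (λ X → nv g X <? ∣ X ∣) lt
  ... | T , s , big , min = T , s , conn , odd , exc
    where
    shrink : ∀ {e} → e ∈ T → ¬ nv g (T - e) < ∣ T - e ∣
    shrink {e} p q = proj₂ (∈-⁻ {p = T} (subst (e ∈_) (sym (min (T - e) (λ r → proj₁ (∈-⁻ r)) q)) p)) refl
    ∣T∣ : ∣ T ∣ ≡ suc (nv g T)
    ∣T∣ = ≤-antisym (≮⇒≥ λ q → let e , p = 0<∣∣⇒Nonempty {X = T} (≤-<-trans z≤n big) in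
            shrink p (≤-<-trans (nv-mono g λ r → proj₁ (∈-⁻ r)) (≤-pred (subst (suc (suc (nv g T)) ≤_) (∣∣-remove p) q)))) big
    odd : ∀ w → deg g T w ≢ 1
    odd w d with OnV⇒edge g (subst (0 <_) (sym d) (s≤s z≤n))
    ... | e , p , q = shrink p (≤-trans drop (≤-reflexive (suc-injective (trans (sym ∣T∣) (∣∣-remove p)))))
      where
      gone : deg g (T - e) w ≡ 0
      gone = n≤0⇒n≡0 (≤-pred (≤-trans (+-monoˡ-≤ (deg g (T - e) w) (≤-trans q (ends≤deg g (x∈⁅x⁆ e) w)))
               (≤-reflexive (trans (sym (deg-─ g (⁅⁆⊆ p) w)) d))))
      drop : nv g (T - e) < nv g T
      drop = ≤∧≢⇒< (nv-mono g λ r → proj₁ (∈-⁻ r)) λ eq → contradiction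
        (trans (sym (cong sg gone)) (trans (sum-squeeze (λ x → sg-mono (deg-mono g {T} {T - e} (λ r → proj₁ (∈-⁻ r)) x)) (≤-reflexive (sym eq)) w) (cong sg d))) λ ()
    exc : excess g T ≡ 2
    exc = +-cancelˡ-≡ (2 * nv g T) _ 2 (trans (sym (excess-eq g odd)) (trans (cong (2 *_) ∣T∣) (lem (nv g T))))
      where
      lem : ∀ a → 2 * suc a ≡ 2 * a + 2
      lem = solve-∀
    conn : Connected g T
    conn Y t ne (j , jR) with separate? g Y (T ─ Y)
    ... | inj₂ p = p
    ... | inj₁ sep with nv g Y <? ∣ Y ∣
    ...   | yes p = contradiction (subst (j ∈_) (sym (min Y t p)) (proj₁ (∈─⁻ T Y jR))) (proj₂ (∈─⁻ T Y jR))
    ...   | no p = let i , iY = ne in contradiction iY (proj₂ (∈─⁻ T Y (subst (i ∈_) (sym (min (T ─ Y) (p─q⊆p T Y) q)) (t iY))))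
      where
      nv-+ : nv g T ≡ nv g Y + nv g (T ─ Y)
      nv-+ = trans (NS.sum-cong-≗ λ w → trans (cong sg (deg-─ g t w)) (lem (sep w)))
                   (NS.∑-distrib-+ (λ w → sg (deg g Y w)) (λ w → sg (deg g (T ─ Y) w)))
        where
        lem : ∀ {a b} → a ≡ 0 ⊎ b ≡ 0 → sg (a + b) ≡ sg a + sg b
        lem (inj₁ refl) = refl
        lem {a} (inj₂ refl) = trans (cong sg (+-identityʳ a)) (sym (+-identityʳ _))
      q : nv g (T ─ Y) < ∣ T ─ Y ∣
      q = +-cancelˡ-< (nv g Y) _ _ (subst₂ _<_ nv-+ refl (<-≤-trans big (≤-trans (≤-reflexive (∣∣-─ t)) (+-monoˡ-≤ ∣ T ─ Y ∣ (≮⇒≥ p)))))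

  -- If `K` has more edges than vertices, it contains a bicycle, which is dependent and hence all of
  -- `K`. Otherwise the average degree is at most 2 on the vertices met, and since no degree is 1,
  -- all of them are 2 there.
  MinDep-shape : ∀ {A} → Carried g A → ∀ {K} → MinDep (KerS A) K → Cycle g K ⊎ Bicycle g K
  MinDep-shape {A} car {K} m with nv g K <? ∣ K ∣
  ... | yes p = let T , s , b = large⇒Bicycle p in
    inj₂ (subst (Bicycle g) (proj₂ m T s (large⇒Dep car (≤-reflexive (sym (bicycle-∣∣ g b))))) b)
  ... | no p = inj₁ (MinDep-nonempty (KerS A) m , MinDep-connected car m , λ w → even (eq w))
    where
    even : ∀ {m} → 2 * sg m ≡ m → 0or2 m
    even {0} _ = inj₁ refl
    even {suc m} q = inj₂ (sym q)
    eq : ∀ w → 2 * sg (deg g K w) ≡ deg g K w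
    eq = sum-squeeze
      (λ w → subst (2 * sg (deg g K w) ≤_) (sym (sg-split _ (MinDep-deg≢1 car m w))) (m≤m+n _ _))
      (≤-trans (≤-reflexive (handshake g K)) (≤-trans (*-monoʳ-≤ 2 (≮⇒≥ p)) (≤-reflexive (NS.*-distribˡ-sum 2 (λ w → sg (deg g K w))))))

  -- The rows of an incidence matrix sum to zero, so one of them may be dropped.
  incidence-Dep : ∀ {X} → Nonempty X → nv g X ≤ ∣ X ∣ → Dep (KerS (incidence g)) X
  incidence-Dep {X} (e , p) le = let x , k , s , nz = pigeonhole A X b h small in x , ker k , s , nz
    where
    w₀ = proj₁ (g e)
    A : Matrix v n
    A w i = if does (w₀ ≟ w) then 𝟘 else incidence g w i
    b : Fin v → ℕ
    b w = if does (w₀ ≟ w) then 0 else sg (deg g X w)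
    h : ∀ w {i} → b w ≡ 0 → i ∈ X → A w i ≡ 𝟘
    h w {i} q r with does (w₀ ≟ w)
    ... | true = refl
    ... | false = proj₁ (incidence-carried i w) (n≤0⇒n≡0 (subst (ends-at g i w ≤_) (sg≡0 q) (ends≤deg g r w)))
    one : sg (deg g X w₀) ≡ 1
    one = sg-pos (<-≤-trans (subst (0 <_) (sym (cong (_+ (pt (proj₂ (g e)) w₀)) (pt-refl w₀))) (s≤s z≤n)) (ends≤deg g p w₀))
    split : ∀ w → sg (deg g X w) ≡ pt w₀ w + b w
    split w with w₀ ≟ w
    ... | yes refl = one
    ... | no _ = refl
    small : NS.sum b < ∣ X ∣
    small = ≤-trans (≤-reflexive (trans (cong (_+ NS.sum b) (sym (sum-pt w₀))) (trans (sym (NS.∑-distrib-+ (pt w₀) b)) (sym (NS.sum-cong-≗ split))))) le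
    ker : ∀ {x} → Ker A x → Ker (incidence g) x
    ker {x} k = rows
      where
      others : ∀ w → w ≢ w₀ → incidence g w ∙ x ≡ 𝟘
      others w q = trans (cong (λ c → (λ i → if c then 𝟘 else incidence g w i) ∙ x) (sym (dec-false (w₀ ≟ w) (q ∘ sym)))) (k w)
      rows : ∀ w → incidence g w ∙ x ≡ 𝟘
      rows w with w ≟ w₀
      ... | no q = others w q
      ... | yes refl = trans (sym (sum-single {f = λ w → ones {v} w ⊗ (incidence g w ∙ x)} w₀ others))
              (trans (sym (∙-interchange (incidence g) ones x)) (sum-zero λ i → cong (_⊗ x i) (incidence-col g i)))

  -- A bicycle minus an edge still has as many edges as vertices, and for an incidence matrix this
  -- already means dependence.
  MinDep⇒Cycle : ∀ {K} → MinDep (KerS (incidence g)) K → Cycle g K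
  MinDep⇒Cycle {K} m with MinDep-shape incidence-carried m
  ... | inj₁ c = c
  ... | inj₂ b = contradiction (subst (e ∈_) (sym (proj₂ m (K - e) (λ q → proj₁ (∈-⁻ q)) (incidence-Dep ne le))) eK)
                               (λ q → proj₂ (∈-⁻ {p = K} q) refl)
    where
    e = proj₁ (bicycle-nonempty g b)
    eK = proj₂ (bicycle-nonempty g b)
    ∣K-e∣ : ∣ K - e ∣ ≡ nv g K
    ∣K-e∣ = suc-injective (trans (sym (∣∣-remove eK)) (bicycle-∣∣ g b))
    le : nv g (K - e) ≤ ∣ K - e ∣
    le = ≤-trans (nv-mono g λ q → proj₁ (∈-⁻ q)) (≤-reflexive (sym ∣K-e∣))
    ne : Nonempty (K - e)
    ne = 0<∣∣⇒Nonempty (subst (0 <_) (sym ∣K-e∣) (≤-trans (≤-reflexive (sym (sg-pos (<-≤-trans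
           (subst (0 <_) (sym (cong (_+ pt (proj₂ (g e)) (proj₁ (g e))) (pt-refl (proj₁ (g e))))) (s≤s z≤n)) (ends≤deg g eK (proj₁ (g e)))))))
           (≤-sum (λ w → sg (deg g K w)) (proj₁ (g e)))))

  findCycle : ∀ {Z} → Nonempty Z → nv g Z ≤ ∣ Z ∣ → ∃[ C ] (C ⊆ Z × Cycle g C)
  findCycle ne le = let K , s , m = Dep⇒MinDep (KerS (incidence g)) (incidence-Dep ne le) in K , s , MinDep⇒Cycle m

  Cycle⇒MinDep : ∀ {K} → Cycle g K → MinDep (KerS (incidence g)) K
  Cycle⇒MinDep {K} c =
    let K' , s , m = Dep⇒MinDep (KerS (incidence g)) (incidence-Dep (proj₁ c) (≤-reflexive (sym (cycle-∣∣ g c)))) in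
    subst (MinDep (KerS (incidence g)))
          (cycle-minimal g c s (MinDep-nonempty (KerS (incidence g)) m) (MinDep-deg≢1 incidence-carried m)) m

  classification : ∀ {X} → Bicycle g X → Tight g X ⊎ Loose g X ⊎ Theta g X
  classification = classify g findCycle

-- Frame circuits as cycles and bicycles

module _ {v n : ℕ} (g : Graph v n) where

  private
    on : ∀ {m k} → m ≡ suc k → 0 < m
    on refl = s≤s z≤n

    off : ∀ {m} → ¬ 0 < m → m ≡ 0
    off p = n≤0⇒n≡0 (≮⇒≥ p)

    exclusive : ∀ {a b} → 0or2 a → 0or2 b → ¬ (0 < a × 0 < b) → 0or2 (a + b)
    exclusive (inj₁ refl) q h = q
    exclusive (inj₂ refl) (inj₁ refl) h = inj₂ refl
    exclusive (inj₂ refl) (inj₂ refl) h = ⊥-elim (h (s≤s z≤n , s≤s z≤n))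

    pos-+ : ∀ {a b} → 0 < a + b → 0 < a ⊎ 0 < b
    pos-+ {0} p = inj₂ p
    pos-+ {suc a} p = inj₁ (s≤s z≤n)

    ∸2 : ∀ {m} → 0or2 m → m ∸ 2 ≡ 0
    ∸2 (inj₁ refl) = refl
    ∸2 (inj₂ refl) = refl

  connected-side : ∀ {A T Y} → Connected g A → A ⊆ T → Separate g Y (T ─ Y) → A ⊆ Y ⊎ A ⊆ T ─ Y
  connected-side {A} {T} {Y} c s sep with nonempty? (A ∩ Y) | nonempty? (A ─ (A ∩ Y))
  ... | no p | _ = inj₂ λ q → x∈p∧x∉q⇒x∈p─q (s q) λ r → p (_ , x∈p∩q⁺ (q , r))
  ... | yes _ | no q = inj₁ λ {i} r → proj₂ (x∈p∩q⁻ A Y (subst (i ∈_) (sym (⊆-─-∅ (λ t → proj₁ (x∈p∩q⁻ A Y t)) q)) r))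
  ... | yes p | yes q with c (A ∩ Y) (λ t → proj₁ (x∈p∩q⁻ A Y t)) p q
  ...   | w , a , b with sep w
  ...     | inj₁ e = contradiction (<-≤-trans a (deg-mono g (λ t → proj₂ (x∈p∩q⁻ A Y t)) w)) λ t → <-irrefl (sym e) t
  ...     | inj₂ e = contradiction (<-≤-trans b (deg-mono g {T ─ Y} (λ t →
              let t₁ , t₂ = ∈─⁻ A (A ∩ Y) t in x∈p∧x∉q⇒x∈p─q (s t₁) λ t₃ → t₂ (x∈p∩q⁺ (t₁ , t₃))) w))
              λ t → <-irrefl (sym e) t

  conn-∪ : ∀ {A B w} → Connected g A → Connected g B → OnV g A w → OnV g B w → Connected g (A ∪ B)
  conn-∪ {A} {B} {w} cA cB a b Y s (i , iY) (j , jR) with separate? g Y ((A ∪ B) ─ Y)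
  ... | inj₂ p = p
  ... | inj₁ sep with connected-side cA (x∈p∪q⁺ ∘ inj₁) sep | connected-side cB (x∈p∪q⁺ {p = A} ∘ inj₂) sep
  ...   | inj₁ p | inj₁ q = let j₁ , j₂ = ∈─⁻ (A ∪ B) Y jR in contradiction ([ p , q ]′ (x∈p∪q⁻ A B j₁)) j₂
  ...   | inj₂ p | inj₂ q = contradiction iY (proj₂ (∈─⁻ (A ∪ B) Y ([ p , q ]′ (x∈p∪q⁻ A B (s iY)))))
  ...   | inj₁ p | inj₂ q = w , <-≤-trans a (deg-mono g p w) , <-≤-trans b (deg-mono g q w)
  ...   | inj₂ p | inj₁ q = w , <-≤-trans b (deg-mono g q w) , <-≤-trans a (deg-mono g p w)

  mkBicycle : ∀ {X} u u' → Connected g X → (∀ w → deg g X w ≢ 1) →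
    (∀ w → deg g X w ∸ 2 ≡ pt u w + pt u' w) → Bicycle g X
  mkBicycle u u' c h e = c , h , trans (NS.sum-cong-≗ e)
    (trans (NS.∑-distrib-+ (pt u) (pt u')) (cong₂ _+_ (sum-pt u) (sum-pt u')))

  branch-odd : ∀ {X u u'} → deg g X u ≡ 3 → deg g X u' ≡ 3 →
    (∀ w → w ≢ u → w ≢ u' → 0or2 (deg g X w)) → ∀ w → deg g X w ≢ 1
  branch-odd {u = u} {u'} p p' h w q with w ≟ u | w ≟ u'
  ... | yes refl | _ = contradiction (trans (sym q) p) λ ()
  ... | no _ | yes refl = contradiction (trans (sym q) p') λ ()
  ... | no a | no b = even≢1 (h w a b) q

  branch-excess : ∀ {X u u'} → u ≢ u' → deg g X u ≡ 3 → deg g X u' ≡ 3 →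
    (∀ w → w ≢ u → w ≢ u' → 0or2 (deg g X w)) → ∀ w → deg g X w ∸ 2 ≡ pt u w + pt u' w
  branch-excess {u = u} {u'} d p p' h w with u ≟ w | u' ≟ w
  ... | yes refl | yes refl = contradiction refl d
  ... | yes refl | no _ rewrite p = refl
  ... | no _ | yes refl rewrite p' = refl
  ... | no a | no b = ∸2 (h w (a ∘ sym) (b ∘ sym))

  Tight⇒Bicycle : ∀ {X} → Tight g X → Bicycle g X
  Tight⇒Bicycle {X} (C₁ , C₂ , (_ , c₁ , h₁) , (_ , c₂ , h₂) , disj , (w , a , b , meet) , refl) =
    mkBicycle w w (conn-∪ c₁ c₂ a b) odd exc
    where
    degX : ∀ x → deg g (C₁ ∪ C₂) x ≡ deg g C₁ x + deg g C₂ x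
    degX = deg-∪ g (∩-∅ disj)
    degw : deg g (C₁ ∪ C₂) w ≡ 4
    degw = trans (degX w) (cong₂ _+_ (two (h₁ w) a) (two (h₂ w) b))
    h : ∀ x → x ≢ w → 0or2 (deg g (C₁ ∪ C₂) x)
    h x p = subst (0or2) (sym (degX x)) (exclusive (h₁ x) (h₂ x) λ (q , r) → p (meet x q r))
    odd : ∀ x → deg g (C₁ ∪ C₂) x ≢ 1
    odd x with x ≟ w
    ... | yes refl = λ q → contradiction (trans (sym q) degw) λ ()
    ... | no p = even≢1 (h x p)
    exc : ∀ x → deg g (C₁ ∪ C₂) x ∸ 2 ≡ pt w x + pt w x
    exc x with w ≟ x
    ... | yes refl rewrite degw = refl
    ... | no p = ∸2 (h x (p ∘ sym))

  module LooseData {C₁ C₂ P u u'} (y₁ : Cycle g C₁) (y₂ : Cycle g C₂) (disj : ∀ w → OnV g C₁ w → OnV g C₂ w → ⊥)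
    (path : Path g u u' P) (a : OnV g C₁ u) (b : OnV g C₂ u') (d₁ : P ∩ C₁ ≡ ∅) (d₂ : P ∩ C₂ ≡ ∅)
    (m₁ : ∀ w → OnV g P w → OnV g C₁ w → w ≡ u) (m₂ : ∀ w → OnV g P w → OnV g C₂ w → w ≡ u') where
    X : Subset n
    X = (C₁ ∪ C₂) ∪ P
    private
      h₁ = proj₂ (proj₂ y₁)
      h₂ = proj₂ (proj₂ y₂)
      ud = proj₁ path
      p = proj₁ (proj₂ (proj₂ (proj₂ path)))
      p' = proj₁ (proj₂ (proj₂ (proj₂ (proj₂ path))))
      hP = proj₂ (proj₂ (proj₂ (proj₂ (proj₂ path))))
    apart : ∀ {i} → i ∈ C₁ → i ∉ C₂
    apart {i} q r = disj (proj₁ (g i)) (at q) (at r)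
      where
      at : ∀ {C} → i ∈ C → OnV g C (proj₁ (g i))
      at q = <-≤-trans (subst (0 <_) (sym (cong (_+ pt (proj₂ (g i)) (proj₁ (g i))) (pt-refl (proj₁ (g i))))) (s≤s z≤n)) (ends≤deg g q (proj₁ (g i)))
    degX : ∀ w → deg g X w ≡ deg g C₁ w + deg g C₂ w + deg g P w
    degX w = trans (deg-∪ g (λ q r → [ ∩-∅ d₁ r , ∩-∅ d₂ r ]′ (x∈p∪q⁻ C₁ C₂ q)) w) (cong (_+ deg g P w) (deg-∪ g apart w))
    c₂u : deg g C₂ u ≡ 0
    c₂u = off (disj u a)
    c₁u' : deg g C₁ u' ≡ 0
    c₁u' = off (λ q → disj u' q b)
    degu : deg g X u ≡ 3
    degu = trans (degX u) (cong₂ _+_ (cong₂ _+_ (two (h₁ u) a) c₂u) p)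
    degu' : deg g X u' ≡ 3
    degu' = trans (degX u') (cong₂ _+_ (cong₂ _+_ c₁u' (two (h₂ u') b)) p')
    h : ∀ w → w ≢ u → w ≢ u' → 0or2 (deg g X w)
    h w q r = subst (0or2) (sym (degX w)) (exclusive (exclusive (h₁ w) (h₂ w) λ (s , t) → disj w s t) (hP w q r)
      λ (s , t) → [ (λ s → q (m₁ w t s)) , (λ s → r (m₂ w t s)) ]′ (pos-+ s))
    bicycle : Bicycle g X
    bicycle = mkBicycle u u'
      (subst (Connected g) (sym eq) (conn-∪ (conn-∪ (proj₁ (proj₂ y₁)) (proj₁ (proj₂ (proj₂ path))) a (on p)) (proj₁ (proj₂ y₂))
          (<-≤-trans (on p') (deg-mono g (x∈p∪q⁺ {p = C₁} ∘ inj₂) u')) b))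
      (branch-odd degu degu' h) (branch-excess ud degu degu' h)
      where
      eq : (C₁ ∪ C₂) ∪ P ≡ (C₁ ∪ P) ∪ C₂
      eq = trans (∪-assoc C₁ C₂ P)
        (trans (cong (C₁ ∪_) (∪-comm C₂ P)) (sym (∪-assoc C₁ P C₂)))

  Loose⇒Bicycle : ∀ {X} → Loose g X → Bicycle g X
  Loose⇒Bicycle (_ , _ , _ , _ , _ , y₁ , y₂ , disj , path , a , b , d₁ , d₂ , m₁ , m₂ , refl) =
    LooseData.bicycle y₁ y₂ disj path a b d₁ d₂ m₁ m₂

  module ThetaData {u u' P₁ P₂ P₃} (q₁ : Path g u u' P₁) (q₂ : Path g u u' P₂) (q₃ : Path g u u' P₃)
    (i₁₂ : IntDisj g u u' P₁ P₂) (i₁₃ : IntDisj g u u' P₁ P₃) (i₂₃ : IntDisj g u u' P₂ P₃) where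
    X : Subset n
    X = (P₁ ∪ P₂) ∪ P₃
    private
      deg-u : ∀ {P} → Path g u u' P → deg g P u ≡ 1
      deg-u q = proj₁ (proj₂ (proj₂ (proj₂ q)))
      deg-u' : ∀ {P} → Path g u u' P → deg g P u' ≡ 1
      deg-u' q = proj₁ (proj₂ (proj₂ (proj₂ (proj₂ q))))
      inn : ∀ {P} → Path g u u' P → ∀ w → w ≢ u → w ≢ u' → 0or2 (deg g P w)
      inn q = proj₂ (proj₂ (proj₂ (proj₂ (proj₂ q))))
      conn : ∀ {P} → Path g u u' P → Connected g P
      conn q = proj₁ (proj₂ (proj₂ q))
    degX : ∀ w → deg g X w ≡ deg g P₁ w + deg g P₂ w + deg g P₃ w
    degX w = trans (deg-∪ g (λ q → [ ∩-∅ (proj₁ i₁₃) , ∩-∅ (proj₁ i₂₃) ]′ (x∈p∪q⁻ P₁ P₂ q)) w)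
                   (cong (_+ deg g P₃ w) (deg-∪ g (∩-∅ (proj₁ i₁₂)) w))
    degu : deg g X u ≡ 3
    degu = trans (degX u) (cong₂ _+_ (cong₂ _+_ (deg-u q₁) (deg-u q₂)) (deg-u q₃))
    degu' : deg g X u' ≡ 3
    degu' = trans (degX u') (cong₂ _+_ (cong₂ _+_ (deg-u' q₁) (deg-u' q₂)) (deg-u' q₃))
    h : ∀ w → w ≢ u → w ≢ u' → 0or2 (deg g X w)
    h w q r = subst (0or2) (sym (degX w)) (exclusive (exclusive (inn q₁ w q r) (inn q₂ w q r) λ (s , t) → [ q , r ]′ (proj₂ i₁₂ w s t)) (inn q₃ w q r)
      λ (s , t) → [ (λ s → [ q , r ]′ (proj₂ i₁₃ w s t)) , (λ s → [ q , r ]′ (proj₂ i₂₃ w s t)) ]′ (pos-+ s))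
    bicycle : Bicycle g X
    bicycle = mkBicycle u u'
      (conn-∪ (conn-∪ (conn q₁) (conn q₂) (on (deg-u q₁)) (on (deg-u q₂))) (conn q₃)
        (<-≤-trans (on (deg-u q₁)) (deg-mono g (x∈p∪q⁺ ∘ inj₁) u)) (on (deg-u q₃)))
      (branch-odd degu degu' h) (branch-excess (proj₁ q₁) degu degu' h)

    P₁⊆X : P₁ ⊆ X
    P₁⊆X r = x∈p∪q⁺ {p = P₁ ∪ P₂} (inj₁ (x∈p∪q⁺ (inj₁ r)))
    P₂⊆X : P₂ ⊆ X
    P₂⊆X r = x∈p∪q⁺ {p = P₁ ∪ P₂} (inj₁ (x∈p∪q⁺ {p = P₁} (inj₂ r)))
    P₃⊆X : P₃ ⊆ X
    P₃⊆X r = x∈p∪q⁺ {p = P₁ ∪ P₂} (inj₂ r)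

    private
      absorb : ∀ {P C} → Path g u u' P → P ⊆ X → (∀ w → w ≢ u → w ≢ u' → OnV g P w → deg g X w ≡ deg g P w + 0) →
        Cycle g C → C ⊆ X → P ⊆ C ⊎ (∀ {i} → i ∈ C → i ∉ P)
      absorb {P} {C} q s h y t with nonempty? (C ∩ P)
      ... | yes ne = inj₁ (path-absorb g q s (λ w a b c → minus (deg g P w) 0 (deg-─ g s w) (h w a b c) refl) y t ne)
      ... | no ne = inj₂ λ a b → ne (_ , x∈p∩q⁺ (a , b))

      within : ∀ {P C} → Path g u u' P → Cycle g C → ¬ C ⊆ P
      within {P} {C} q y s = even≢1 (subst (λ S → 0or2 (deg g S u)) eq (proj₂ (proj₂ y) u)) (deg-u q)
        where
        eq : C ≡ P
        eq = ⊆-antisym s (path-absorb g q ⊆-refl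
          (λ w _ _ _ → minus (deg g P w) 0 (deg-─ g ⊆-refl w) (sym (+-identityʳ _)) refl) y s
          (let i , r = proj₁ y in i , x∈p∩q⁺ (r , s r)))

    module _ {C} (y : Cycle g C) (t : C ⊆ X) where
      private
        a₁ : P₁ ⊆ C ⊎ (∀ {i} → i ∈ C → i ∉ P₁)
        a₁ = absorb q₁ P₁⊆X (λ w q r c → trans (degX w) (trans (cong₂ (λ a b → deg g P₁ w + a + b)
               (off λ c' → [ q , r ]′ (proj₂ i₁₂ w c c')) (off λ c' → [ q , r ]′ (proj₂ i₁₃ w c c'))) (+-identityʳ _))) y t
        a₂ : P₂ ⊆ C ⊎ (∀ {i} → i ∈ C → i ∉ P₂)
        a₂ = absorb q₂ P₂⊆X (λ w q r c → trans (degX w) (cong₂ (λ a b → a + deg g P₂ w + b)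
               (off λ c' → [ q , r ]′ (proj₂ i₁₂ w c' c)) (off λ c' → [ q , r ]′ (proj₂ i₂₃ w c c')))) y t
        a₃ : P₃ ⊆ C ⊎ (∀ {i} → i ∈ C → i ∉ P₃)
        a₃ = absorb q₃ P₃⊆X (λ w q r c → trans (degX w) (trans (cong₂ (λ a b → a + b + deg g P₃ w)
               (off λ c' → [ q , r ]′ (proj₂ i₁₃ w c' c)) (off λ c' → [ q , r ]′ (proj₂ i₂₃ w c' c))) (sym (+-identityʳ _)))) y t
        rest : ∀ {i} → i ∈ X → i ∉ P₁ → i ∉ P₂ → i ∈ P₃
        rest r x₁ x₂ = [ (λ r → ⊥-elim ([ x₁ , x₂ ]′ (x∈p∪q⁻ P₁ P₂ r))) , id ]′ (x∈p∪q⁻ (P₁ ∪ P₂) P₃ r)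
        rest₂ : ∀ {i} → i ∈ X → i ∉ P₁ → i ∉ P₃ → i ∈ P₂
        rest₂ {i} r x₁ x₃ = decidable-stable (i ∈? P₂) λ x₂ → x₃ (rest r x₁ x₂)
        rest₁ : ∀ {i} → i ∈ X → i ∉ P₂ → i ∉ P₃ → i ∈ P₁
        rest₁ {i} r x₂ x₃ = decidable-stable (i ∈? P₁) λ x₁ → x₃ (rest r x₁ x₂)

      -- A cycle contains or misses each of the three paths entirely, and it cannot lie inside one
      -- path, whose ends have degree 1.
      two-paths : P₁ ⊆ C × P₂ ⊆ C ⊎ P₁ ⊆ C × P₃ ⊆ C ⊎ P₂ ⊆ C × P₃ ⊆ C
      two-paths with a₁ | a₂ | a₃
      ... | inj₁ x | inj₁ z | _ = inj₁ ((λ {i} → x {i}) , (λ {i} → z {i}))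
      ... | inj₁ x | inj₂ _ | inj₁ z = inj₂ (inj₁ ((λ {i} → x {i}) , (λ {i} → z {i})))
      ... | inj₂ _ | inj₁ x | inj₁ z = inj₂ (inj₂ ((λ {i} → x {i}) , (λ {i} → z {i})))
      ... | inj₂ x | inj₂ z | _ = ⊥-elim (within q₃ y λ r → rest (t r) (x r) (z r))
      ... | inj₂ x | _ | inj₂ z = ⊥-elim (within q₂ y λ r → rest₂ (t r) (x r) (z r))
      ... | _ | inj₂ x | inj₂ z = ⊥-elim (within q₁ y λ r → rest₁ (t r) (x r) (z r))

  Theta⇒Bicycle : ∀ {X} → Theta g X → Bicycle g X
  Theta⇒Bicycle (_ , _ , _ , _ , _ , q₁ , q₂ , q₃ , i₁₂ , i₁₃ , i₂₃ , refl) = ThetaData.bicycle q₁ q₂ q₃ i₁₂ i₁₃ i₂₃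

  -- Two pairs chosen from three paths have a path in common.
  theta-cycles-meet : ∀ {X C D} → Theta g X → Cycle g C → Cycle g D → C ⊆ X → D ⊆ X → ∃[ e ] (e ∈ C × e ∈ D)
  theta-cycles-meet {C = C} {D} (_ , _ , P₁ , P₂ , P₃ , q₁ , q₂ , q₃ , i₁₂ , i₁₃ , i₂₃ , refl) y y' s t
    with T.two-paths y s | T.two-paths y' t
    where module T = ThetaData q₁ q₂ q₃ i₁₂ i₁₃ i₂₃
  ... | inj₁ (a , _) | inj₁ (b , _) = let e , r = proj₁ (proj₂ q₁) in e , a r , b r
  ... | inj₁ (a , _) | inj₂ (inj₁ (b , _)) = let e , r = proj₁ (proj₂ q₁) in e , a r , b r
  ... | inj₁ (_ , a) | inj₂ (inj₂ (b , _)) = let e , r = proj₁ (proj₂ q₂) in e , a r , b r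
  ... | inj₂ (inj₁ (a , _)) | inj₁ (b , _) = let e , r = proj₁ (proj₂ q₁) in e , a r , b r
  ... | inj₂ (inj₁ (a , _)) | inj₂ (inj₁ (b , _)) = let e , r = proj₁ (proj₂ q₁) in e , a r , b r
  ... | inj₂ (inj₁ (_ , a)) | inj₂ (inj₂ (_ , b)) = let e , r = proj₁ (proj₂ q₃) in e , a r , b r
  ... | inj₂ (inj₂ (a , _)) | inj₁ (_ , b) = let e , r = proj₁ (proj₂ q₂) in e , a r , b r
  ... | inj₂ (inj₂ (_ , a)) | inj₂ (inj₁ (_ , b)) = let e , r = proj₁ (proj₂ q₃) in e , a r , b r
  ... | inj₂ (inj₂ (a , _)) | inj₂ (inj₂ (b , _)) = let e , r = proj₁ (proj₂ q₂) in e , a r , b r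

  -- A cycle attached to the rest of X at one vertex w cannot be partially covered by another
  -- cycle: the covered part would have a single vertex of odd degree.
  cycle-absorb : ∀ {X C K} w → Cycle g C → C ⊆ X → (∀ x → x ≢ w → OnV g C x → deg g (X ─ C) x ≡ 0) →
    Cycle g K → K ⊆ X → Nonempty (K ∩ C) → C ≡ K
  cycle-absorb {X} {C} {K} w y@(_ , _ , hC) s h y'@(_ , _ , hK) t ne =
    cycle-minimal g y' (λ {i} r → proj₁ (x∈p∩q⁻ K C (subst (i ∈_) (sym Q≡C) r))) (proj₁ y) (λ x → even≢1 (hC x))
    where
    Q = K ∩ C
    Q⊆K : Q ⊆ K
    Q⊆K r = proj₁ (x∈p∩q⁻ K C r)
    Q⊆C : Q ⊆ C
    Q⊆C r = proj₂ (x∈p∩q⁻ K C r)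
    oddQ : ∀ x → x ≢ w → deg g Q x ≢ 1
    oddQ x p q = even≢1 (hK x) (trans (deg-─ g Q⊆K x) (cong₂ _+_ q (n≤0⇒n≡0
      (subst (deg g (K ─ Q) x ≤_) (h x p (<-≤-trans (on q) (deg-mono g Q⊆C x))) (deg-mono g (λ r →
        let r₁ , r₂ = ∈─⁻ K Q r in x∈p∧x∉q⇒x∈p─q (t r₁) λ r₃ → r₂ (x∈p∩q⁺ (r₁ , r₃))) x)))))
    small : ∀ {a b} → a ≤ b → 0or2 b → a ≢ 1 → 0or2 a
    small {0} p q r = inj₁ refl
    small {1} p q r = contradiction refl r
    small {2} p q r = inj₂ refl
    small {suc (suc (suc a))} p (inj₁ refl) r = contradiction p λ ()
    small {suc (suc (suc a))} p (inj₂ refl) r = contradiction p λ { (s≤s (s≤s ())) }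
    oddw : deg g Q w ≢ 1
    oddw q = parity g Q w q λ x p → small (deg-mono g Q⊆C x) (hC x) (oddQ x p)
    Q≡C : Q ≡ C
    Q≡C = cycle-minimal g y Q⊆C ne λ x → case x ≟ w of λ { (yes refl) → oddw ; (no p) → oddQ x p }

  tight-cycle : ∀ {X K} → (b : Tight g X) → Cycle g K → K ⊆ X → proj₁ b ≡ K ⊎ proj₁ (proj₂ b) ≡ K
  tight-cycle {X} {K} (C₁ , C₂ , y₁ , y₂ , disj , (w , a , b , meet) , refl) y s with nonempty? (K ∩ C₁)
  ... | yes p = inj₁ (cycle-absorb w y₁ (x∈p∪q⁺ ∘ inj₁) (λ x q r →
        minus (deg g C₁ x) 0 (deg-─ g (x∈p∪q⁺ ∘ inj₁) x) (trans (deg-∪ g (∩-∅ disj) x) (cong (deg g C₁ x +_) (off λ t → q (meet x r t)))) refl) y s p)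
  ... | no p = inj₂ (sym (cycle-minimal g y₂ (λ r → [ (λ t → ⊥-elim (p (_ , x∈p∩q⁺ (r , t)))) , id ]′ (x∈p∪q⁻ C₁ C₂ (s r)))
                     (proj₁ y) (λ x → even≢1 (proj₂ (proj₂ y) x))))

  loose-cycle : ∀ {X K} → (b : Loose g X) → Cycle g K → K ⊆ X → proj₁ b ≡ K ⊎ proj₁ (proj₂ b) ≡ K
  loose-cycle {X} {K} (C₁ , C₂ , P , u , u' , y₁ , y₂ , disj , path , a , b , d₁ , d₂ , m₁ , m₂ , refl) y s
    with nonempty? (K ∩ C₁) | nonempty? (K ∩ C₂)
  ... | yes p | _ = inj₁ (cycle-absorb u y₁ sub (λ x q r →
        minus (deg g C₁ x) 0 (deg-─ g sub x) (trans (L.degX x)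
          (trans (cong₂ (λ m k → deg g C₁ x + m + k) (off (disj x r)) (off λ t → q (m₁ x t r))) (+-identityʳ _))) refl) y s p)
    where
    module L = LooseData y₁ y₂ disj path a b d₁ d₂ m₁ m₂
    sub : C₁ ⊆ (C₁ ∪ C₂) ∪ P
    sub q = x∈p∪q⁺ {p = C₁ ∪ C₂} (inj₁ (x∈p∪q⁺ (inj₁ q)))
  ... | no _ | yes p = inj₂ (cycle-absorb u' y₂ sub (λ x q r →
        minus (deg g C₂ x) 0 (deg-─ g sub x) (trans (L.degX x)
          (cong₂ (λ m k → m + deg g C₂ x + k) (off λ t → disj x t r) (off λ t → q (m₂ x t r)))) refl) y s p)
    where
    module L = LooseData y₁ y₂ disj path a b d₁ d₂ m₁ m₂
    sub : C₂ ⊆ (C₁ ∪ C₂) ∪ P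
    sub q = x∈p∪q⁺ {p = C₁ ∪ C₂} (inj₁ (x∈p∪q⁺ {p = C₁} (inj₂ q)))
  ... | no p | no q = ⊥-elim (even≢1 (subst (λ S → 0or2 (deg g S u)) (⊆-antisym K⊆P P⊆K) (proj₂ (proj₂ y) u)) (proj₁ (proj₂ (proj₂ (proj₂ path)))))
    where
    K⊆P : K ⊆ P
    K⊆P r = [ (λ t → ⊥-elim ([ (λ t → p (_ , x∈p∩q⁺ (r , t))) , (λ t → q (_ , x∈p∩q⁺ (r , t))) ]′ (x∈p∪q⁻ C₁ C₂ t))) , id ]′ (x∈p∪q⁻ (C₁ ∪ C₂) P (s r))
    P⊆K : P ⊆ K
    P⊆K = path-absorb g path ⊆-refl
          (λ w _ _ _ → minus (deg g P w) 0 (deg-─ g ⊆-refl w) (sym (+-identityʳ _)) refl) y K⊆P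
          (let i , r = proj₁ y in i , x∈p∩q⁺ (r , K⊆P r))

  FrameCircuit-shape : ∀ {B X} → (∀ {C} → B C → Cycle g C) → FrameCircuit g B X → Cycle g X ⊎ Bicycle g X
  FrameCircuit-shape h (inj₁ b) = inj₁ (h b)
  FrameCircuit-shape h (inj₂ (inj₁ (C₁ , C₂ , y₁ , y₂ , _ , _ , r))) = inj₂ (Tight⇒Bicycle (C₁ , C₂ , y₁ , y₂ , r))
  FrameCircuit-shape h (inj₂ (inj₂ (inj₁ (C₁ , C₂ , P , u , u' , y₁ , y₂ , _ , _ , r)))) =
    inj₂ (Loose⇒Bicycle (C₁ , C₂ , P , u , u' , y₁ , y₂ , r))
  FrameCircuit-shape h (inj₂ (inj₂ (inj₂ (t , _)))) = inj₂ (Theta⇒Bicycle t)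

  Shape⇒FrameCircuit : ∀ {B X} → (∀ C → Cycle g C → C ⊆ X → ¬ B C) →
    Tight g X ⊎ Loose g X ⊎ Theta g X → FrameCircuit g B X
  Shape⇒FrameCircuit {B} nb (inj₁ (C₁ , C₂ , y₁ , y₂ , d , m , e)) =
    inj₂ (inj₁ (C₁ , C₂ , y₁ , y₂ , nb C₁ y₁ s₁ , nb C₂ y₂ s₂ , d , m , e))
    where
    s₁ : C₁ ⊆ _
    s₁ {i} r = subst (i ∈_) (sym e) (x∈p∪q⁺ {p = C₁} {C₂} (inj₁ r))
    s₂ : C₂ ⊆ _
    s₂ {i} r = subst (i ∈_) (sym e) (x∈p∪q⁺ {p = C₁} {C₂} (inj₂ r))
  Shape⇒FrameCircuit {B} nb (inj₂ (inj₁ (C₁ , C₂ , P , u , u' , y₁ , y₂ , d , path , a , b' , d₁ , d₂ , m₁ , m₂ , e))) =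
    inj₂ (inj₂ (inj₁ (C₁ , C₂ , P , u , u' , y₁ , y₂ , nb C₁ y₁ s₁ , nb C₂ y₂ s₂ ,
      d , path , a , b' , d₁ , d₂ , m₁ , m₂ , e)))
    where
    s₁ : C₁ ⊆ _
    s₁ {i} r = subst (i ∈_) (sym e) (x∈p∪q⁺ {p = C₁ ∪ C₂} {P} (inj₁ (x∈p∪q⁺ {p = C₁} {C₂} (inj₁ r))))
    s₂ : C₂ ⊆ _
    s₂ {i} r = subst (i ∈_) (sym e) (x∈p∪q⁺ {p = C₁ ∪ C₂} {P} (inj₁ (x∈p∪q⁺ {p = C₁} {C₂} (inj₂ r))))
  Shape⇒FrameCircuit nb (inj₂ (inj₂ t)) = inj₂ (inj₂ (inj₂ (t , nb)))

  Bicycle⇒FrameCircuit : ∀ {B X} → Bicycle g X → (∀ C → Cycle g C → C ⊆ X → ¬ B C) → FrameCircuit g B X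
  Bicycle⇒FrameCircuit b nb = Shape⇒FrameCircuit nb (classification g b)

  module Represented {A : Matrix v n} (car : Carried g A) (E : Subset n) where

    Balanced : Subset n → Set
    Balanced C = C ⊆ E × Cycle g C × Dep (KerS A) C

    private
      K⇒B : ∀ {K} → K ⊆ E → Cycle g K → MinDep (KerS A) K → Balanced K
      K⇒B s y m = s , y , proj₁ m

      Balanced⇒MinDep : ∀ {C} → Balanced C → MinDep (KerS A) C
      Balanced⇒MinDep (_ , y , d) = let K , s , m = Dep⇒MinDep (KerS A) d in
        subst (MinDep (KerS A)) (cycle-minimal g y s (MinDep-nonempty (KerS A) m) (MinDep-deg≢1 g car m)) m

    MinDep⇒FrameCircuit : ∀ {X} → X ⊆ E → MinDep (KerS A) X → FrameCircuit g Balanced X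
    MinDep⇒FrameCircuit {X} s m with MinDep-shape g car m
    ... | inj₁ y = inj₁ (K⇒B s y m)
    -- A balanced cycle inside would be all of `X` by minimality, yet a bicycle has one edge more
    -- than it has vertices and a cycle has none to spare.
    ... | inj₂ b = Bicycle⇒FrameCircuit b λ C y t (_ , _ , d) → contradiction
          (trans (sym (cycle-∣∣ g y)) (trans (cong ∣_∣ (proj₂ m C t d)) (trans (bicycle-∣∣ g b) (cong (suc ∘ nv g) (sym (proj₂ m C t d))))))
          (λ e → m≢1+m+n _ (trans e (cong suc (sym (+-identityʳ _)))))

    private
      -- With more edges than vertices `X` is dependent. A minimal dependent set inside it is a
      -- balanced cycle, which is excluded, or a bicycle, which must be all of `X`.
      unbalanced-bicycle : ∀ {X} → X ⊆ E → Bicycle g X → (∀ {K} → K ⊆ X → Cycle g K → ¬ Balanced K) → MinDep (KerS A) X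
      unbalanced-bicycle {X} s b nb with Dep⇒MinDep (KerS A) (large⇒Dep g car (≤-reflexive (sym (bicycle-∣∣ g b))))
      ... | K , t , m with MinDep-shape g car m
      ...   | inj₁ y = contradiction (K⇒B (λ r → s (t r)) y m) (nb t y)
      ...   | inj₂ b' = subst (MinDep (KerS A)) (bicycle-minimal g b b' t (bicycle-nonempty g b')) m

      either : ∀ {C₁ C₂ K} → ¬ Balanced C₁ → ¬ Balanced C₂ → C₁ ≡ K ⊎ C₂ ≡ K → ¬ Balanced K
      either p q (inj₁ refl) = p
      either p q (inj₂ refl) = q

    FrameCircuit⇒MinDep : ∀ {X} → X ⊆ E → FrameCircuit g Balanced X → MinDep (KerS A) X
    FrameCircuit⇒MinDep s (inj₁ b) = Balanced⇒MinDep b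
    FrameCircuit⇒MinDep s (inj₂ (inj₁ (C₁ , C₂ , y₁ , y₂ , n₁ , n₂ , r))) =
      unbalanced-bicycle s (Tight⇒Bicycle (C₁ , C₂ , y₁ , y₂ , r)) λ t y → either n₁ n₂ (tight-cycle (C₁ , C₂ , y₁ , y₂ , r) y t)
    FrameCircuit⇒MinDep s (inj₂ (inj₂ (inj₁ (C₁ , C₂ , P , u , u' , y₁ , y₂ , n₁ , n₂ , r)))) =
      unbalanced-bicycle s (Loose⇒Bicycle (C₁ , C₂ , P , u , u' , y₁ , y₂ , r))
        λ t y → either n₁ n₂ (loose-cycle (C₁ , C₂ , P , u , u' , y₁ , y₂ , r) y t)
    FrameCircuit⇒MinDep s (inj₂ (inj₂ (inj₂ (t , nb)))) =
      unbalanced-bicycle s (Theta⇒Bicycle t) λ {K} r y → nb K y r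

    private
      third-cycle : ∀ {T C₁ C₂ K e} → T ⊆ E → Bicycle g T → (∀ C → Balanced C → C ⊆ T → C ≡ C₁ ⊎ C ≡ C₂) →
        e ∈ C₁ → e ∈ C₂ → e ∈ T → K ⊆ T → e ∉ K → MinDep (KerS A) K → Cycle g K ⊎ Bicycle g K → ⊥
      third-cycle {K = K} {e} sT bT only e₁ e₂ eT sK eK m (inj₁ y) =
        [ (λ eq → eK (subst (e ∈_) (sym eq) e₁)) , (λ eq → eK (subst (e ∈_) (sym eq) e₂)) ]′
          (only K (K⇒B (λ r → sT (sK r)) y m) sK)
      third-cycle {e = e} sT bT only e₁ e₂ eT sK eK m (inj₂ b) =
        eK (subst (e ∈_) (sym (bicycle-minimal g bT b sK (bicycle-nonempty g b))) eT)

    -- If exactly two cycles of a theta were balanced, eliminating a common edge between their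
    -- kernel vectors would produce a third balanced cycle.
    biased : IsBiased g E Balanced
    biased = (λ C (s , y , _) → (λ {i} → s {i}) , y) , no-two
      where
      no-two : ∀ T → T ⊆ E → Theta g T → ¬ (∃[ C₁ ] ∃[ C₂ ] (C₁ ≢ C₂ × Balanced C₁ × Balanced C₂ × C₁ ⊆ T × C₂ ⊆ T
                           × (∀ C → Balanced C → C ⊆ T → C ≡ C₁ ⊎ C ≡ C₂)))
      no-two T sT θ (C₁ , C₂ , ne , b₁ , b₂ , s₁ , s₂ , only) =
        let e , e₁ , e₂ = theta-cycles-meet θ (proj₁ (proj₂ b₁)) (proj₁ (proj₂ b₂)) s₁ s₂
            K , sK , m = circuit-elimination (KerS A) (Balanced⇒MinDep b₁) (Balanced⇒MinDep b₂) ne e₁ e₂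
        in third-cycle sT (Theta⇒Bicycle θ) only e₁ e₂ (s₁ e₁)
             (λ {i} r → [ s₁ , s₂ ]′ (x∈p∪q⁻ C₁ C₂ (proj₁ (∈-⁻ {p = C₁ ∪ C₂} (sK r)))))
             (λ r → proj₂ (∈-⁻ {p = C₁ ∪ C₂} (sK r)) refl) m (MinDep-shape g car m)

carried⇒IsFrame : ∀ {v} (M : Matroid) (g : Graph v (size M)) {A} → Carried g A →
  (∀ X → Circuit M X ⇔ (X ⊆ ground M × MinDep (KerS A) X)) → IsFrame M
carried⇒IsFrame {v} M g {A} car rep = v , g , R.Balanced , R.biased , λ X → mk⇔
  (λ p → let s , m = Equivalence.to (rep X) p in (λ {i} → s {i}) , R.MinDep⇒FrameCircuit s m)
  (λ (s , f) → Equivalence.from (rep X) ((λ {i} → s {i}) , R.FrameCircuit⇒MinDep s f))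
  where module R = Represented g car (ground M)

-- Circuits of duals, 2-sums and minors

MinDep-Supported : ∀ {n} (W : Space n) {E : Subset n} → (∀ {x} → V W x → Supported x E) → ∀ {X} → MinDep W X → X ⊆ E
MinDep-Supported W h m p = let x , q , _ , nz = MinDep-vec W m in h q (nz p)

¬Dep-∅ : ∀ {n} (W : Space n) → ¬ Dep W ∅
¬Dep-∅ W (_ , _ , s , _ , p) = ∉⊥ (s p)

-- Fredholm's alternative for column `i` against the columns in `S`, the other columns being
-- replaced by zero to keep the indexing. In matroid terms, `i` is in the closure of `S` or some
-- cocircuit through `i` avoids `S`.
alternative : ∀ {v n} (A : Matrix v n) (S : Subset n) {i} → i ∉ S →
  DepAt (KerS A) i (S ∪ ⁅ i ⁆) ⊎ ∃[ z ] (Im A z × (∀ {j} → j ∈ S → z j ≡ 𝟘) × z i ≢ 𝟘)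
alternative {v} {n} A S {i} iS with fredholm G (λ w → A w i)
  where
  G : Fin n → Fin v → F
  G j w = if does (j ∈? S) then A w j else 𝟘
... | inj₂ (y , orth , p) = inj₂ ((λ j → y ∙ (λ w → A w j)) , (y , λ _ → refl) ,
        (λ {j} q → trans (sym (cong (λ b → y ∙ (λ w → if b then A w j else 𝟘)) (dec-true (j ∈? S) q))) (orth j)) , p)
... | inj₁ (c , p) = inj₁ (x , ker , sup , λ e → 𝟙≢𝟘 (trans (sym xi) e))
  where
  𝟙≢𝟘 : 𝟙 ≢ 𝟘
  𝟙≢𝟘 ()
  d : Fin n → F
  d j = if does (j ∈? S) then c j else 𝟘
  x : Fin n → F
  x j = δ i j ⊕ 𝟚 ⊗ d j
  di : d i ≡ 𝟘
  di = cong (if_then c i else 𝟘) (dec-false (i ∈? S) iS)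
  xi : x i ≡ 𝟙
  xi = cong₂ (λ a b → a ⊕ 𝟚 ⊗ b) (δ-refl i) di
  swap : ∀ w j → A w j ⊗ d j ≡ c j ⊗ (if does (j ∈? S) then A w j else 𝟘)
  swap w j with does (j ∈? S)
  ... | true = ⊗-comm (A w j) (c j)
  ... | false = trans (⊗-zeroʳ _) (sym (⊗-zeroʳ _))
  ker : Ker A x
  ker w = trans (∙-combʳ (A w) (δ i) 𝟚 d) (trans (cong₂ (λ a b → a ⊕ 𝟚 ⊗ b) (∙-δ (A w) i)
            (trans (FS.sum-cong-≗ (swap w)) (p w))) (lem (A w i)))
    where
    lem : ∀ a → a ⊕ 𝟚 ⊗ a ≡ 𝟘
    lem = by₁
  sup : Supported x (S ∪ ⁅ i ⁆)
  sup {j} p with i ≟ j | j ∈? S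
  ... | yes refl | _ = x∈p∪q⁺ {p = S} (inj₂ (x∈⁅x⁆ i))
  ... | no _ | yes q = x∈p∪q⁺ (inj₁ q)
  ... | no _ | no _ = contradiction refl p

maximum : ∀ {n} {P : Subset n → Set} → (∀ X → Dec (P X)) → ∀ {X} → P X →
  ∃[ Y ] (P Y × (∀ Z → P Z → ∣ Z ∣ ≤ ∣ Y ∣))
maximum {n} {P} P? {X} = go n X (m≤m+n n ∣ X ∣)
  where
  go : ∀ k X → n ≤ k + ∣ X ∣ → P X → ∃[ Y ] (P Y × (∀ Z → P Z → ∣ Z ∣ ≤ ∣ Y ∣))
  go k X le p with anySubset? (λ Z → P? Z ×-dec ∣ X ∣ <? ∣ Z ∣)
  go k X le p | no q = X , p , λ Z r → ≮⇒≥ λ lt → q (Z , r , lt)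
  go zero X le p | yes (Z , _ , lt) = contradiction (≤-trans (∣p∣≤n Z) le) (<⇒≱ lt)
  go (suc k) X le p | yes (Z , r , lt) =
    go k Z (≤-trans le (≤-trans (≤-reflexive (sym (+-suc k ∣ X ∣))) (+-monoʳ-≤ k lt))) r

module _ {v n : ℕ} (g : Graph v n) where
  private
    M = cycleMatroid g
    K = KerS (incidence g)
    I = ImS (incidence g)

    Indep⇒¬Dep : ∀ {X} → Indep M X → ¬ Dep K X
    Indep⇒¬Dep (_ , h) d = let C , s , m = Dep⇒MinDep K d in h C s (MinDep⇒Cycle g m)

    ¬Dep⇒Indep : ∀ {X} → ¬ Dep K X → Indep M X
    ¬Dep⇒Indep p = (λ _ → ∈⊤) , λ C s y → p (Dep-mono K s (proj₁ (Cycle⇒MinDep g y)))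

    -- A vector of K supported on B ∪ i and one of I vanishing on B meet only at i.
    meet : ∀ {B i} {x z} → i ∉ B → Ker (incidence g) x → Im (incidence g) z → ¬ Dep K B →
      (∃[ j ] x j ≢ 𝟘) → Supported x (B ∪ ⁅ i ⁆) → (∀ {j} → j ∈ B → z j ≡ 𝟘) → z i ≡ 𝟘
    meet {B} {i} {x} {z} iB k im ind nz s h with x i ≟F 𝟘
    ... | yes xi = contradiction (x , k , (λ {j} p → [ id , (λ q → contradiction (trans (cong x (x∈⁅y⁆⇒x≡y i q)) xi) p) ]′ (x∈p∪q⁻ B ⁅ i ⁆ (s p))) , nz) ind
    ... | no xi = decidable-stable (z i ≟F 𝟘) λ zi →
            ⊗-nonzero zi xi (trans (sym (sum-single i others)) (Im⊥Ker {x = x} im k))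
      where
      others : ∀ j → j ≢ i → z j ⊗ x j ≡ 𝟘
      others j p with j ∈? B
      ... | yes q = cong (_⊗ x j) (h q)
      ... | no q = trans (cong (z j ⊗_) (∉-Supported {x = x} s λ r → [ q , (λ t → p (x∈⁅y⁆⇒x≡y i t)) ]′ (x∈p∪q⁻ B ⁅ i ⁆ r))) (⊗-zeroʳ _)

    DualIndep⇒¬Dep : ∀ {X} → DualIndep M X → ¬ Dep I X
    DualIndep⇒¬Dep {X} (_ , B , (indB , maxB) , disj) (z , im , sz , i , zi) with Dep? K (B ∪ ⁅ i ⁆)
    ... | no q = iB (subst (i ∈_) (maxB (B ∪ ⁅ i ⁆) (¬Dep⇒Indep q) (x∈p∪q⁺ ∘ inj₁)) (x∈p∪q⁺ {p = B} (inj₂ (x∈⁅x⁆ i))))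
      where
      iB : i ∉ B
      iB = ∩-∅ disj (sz zi)
    ... | yes (x , k , sx , nz) = zi (meet {x = x} (∩-∅ disj (sz zi)) k im (Indep⇒¬Dep indB) nz sx
            (λ {j} p → decidable-stable (z j ≟F 𝟘) λ q → ∩-∅ disj (sz q) p))

    -- A largest independent set `B` outside `X` is a basis. If it could be enlarged by some `i` in
    -- `X`, a vector of the row space would vanish on `B` but not at `i`. Every element outside `X`
    -- is spanned by `B`, so orthogonality confines that vector to `X`, which was independent for
    -- the row space.
    ¬Dep⇒DualIndep : ∀ {X} → ¬ Dep I X → DualIndep M X
    ¬Dep⇒DualIndep {X} ¬d with maximum (λ Y → ¬? (Dep? K Y) ×-dec Y ⊆? (⊤ ─ X)) {∅} (¬Dep-∅ K , λ p → ⊥-elim (∉⊥ p))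
    ... | B , (ind , sB) , max = (λ _ → ∈⊤) , B , (¬Dep⇒Indep ind , basis) , ∅-∩ λ p q → proj₂ (∈─⁻ ⊤ X (sB q)) p
      where
      grow : ∀ {j} → j ∉ X → j ∉ B → Dep K (B ∪ ⁅ j ⁆)
      grow {j} p q with Dep? K (B ∪ ⁅ j ⁆)
      ... | yes d = d
      ... | no d = contradiction (max (B ∪ ⁅ j ⁆) (d , λ r → [ sB , (λ t → subst (_∈ ⊤ ─ X) (sym (x∈⁅y⁆⇒x≡y j t)) (x∈p∧x∉q⇒x∈p─q ∈⊤ p)) ]′ (x∈p∪q⁻ B ⁅ j ⁆ r)))
                     (<⇒≱ (p⊂q⇒∣p∣<∣q∣ ((x∈p∪q⁺ ∘ inj₁) , j , x∈p∪q⁺ {p = B} (inj₂ (x∈⁅x⁆ j)) , q)))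
      basis : ∀ Y → Indep M Y → B ⊆ Y → Y ≡ B
      basis Y iY s with ⊆⊎∃ Y B
      ... | inj₁ t = ⊆-antisym t s
      ... | inj₂ (i , iY' , iB) = ⊥-elim absurd
        where
        sub : B ∪ ⁅ i ⁆ ⊆ Y
        sub r = [ s , (λ t → subst (_∈ Y) (sym (x∈⁅y⁆⇒x≡y i t)) iY') ]′ (x∈p∪q⁻ B ⁅ i ⁆ r)
        absurd : ⊥
        absurd with i ∈? X
        ... | no q = Indep⇒¬Dep iY (Dep-mono K sub (grow q iB))
        ... | yes q with alternative (incidence g) B iB
        ...   | inj₁ (x , k , sx , nz) = Indep⇒¬Dep iY (Dep-mono K sub (x , k , (λ {j} → sx {j}) , i , nz))
        ...   | inj₂ (z , im , zB , zi) = ¬d (z , im , sz , i , zi)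
          where
          sz : Supported z X
          sz {j} zj with j ∈? X | j ∈? B
          ... | yes r | _ = r
          ... | no _ | yes r = contradiction (zB r) zj
          ... | no r | no t = let x , k , sx , nz = grow r t in contradiction (meet {x = x} t k im ind nz sx zB) zj

  dual-circuits : ∀ X → Circuit (dual (cycleMatroid g)) X ⇔ MinDep I X
  dual-circuits X = mk⇔ to from
    where
    to : Circuit (dual M) X → MinDep I X
    to (_ , p , q) = decidable-stable (Dep? I X) (λ d → p (¬Dep⇒DualIndep d)) ,
      λ Z s d → case ≡-dec Bool._≟_ Z X of λ
        { (yes e) → e
        ; (no e) → contradiction d (DualIndep⇒¬Dep (q Z s e)) }
    from : MinDep I X → Circuit (dual M) X
    from (d , m) = (λ _ → ∈⊤) , (λ p → DualIndep⇒¬Dep p d) , λ Y s e → ¬Dep⇒DualIndep λ d' → e (m Y s d')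

-- 2-sums as glued spaces

infixr 5 _⧺_
_⧺_ : ∀ {m n} → (Fin m → F) → (Fin n → F) → Fin (m + n) → F
_⧺_ {m} x y k = [ x , y ]′ (splitAt m k)

set : ∀ {n} → (Fin n → F) → Fin n → F → Fin n → F
set x e t i = if does (i ≟ e) then t else x i

set-same : ∀ {n} (x : Fin n → F) e t → set x e t e ≡ t
set-same x e t = cong (if_then t else x e) (dec-true (e ≟ e) refl)

set-other : ∀ {n} (x : Fin n → F) {e i} t → i ≢ e → set x e t i ≡ x i
set-other x {e} {i} t p = cong (if_then t else x i) (dec-false (i ≟ e) p)

set-cong : ∀ {n} {x y : Fin n → F} {e} t → (∀ i → i ≢ e → x i ≡ y i) → set x e t ≗ set y e t
set-cong {e = e} t p i with i ≟ e
... | yes _ = refl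
... | no q = p i q

set-id : ∀ {n} {x : Fin n → F} {e t} → x e ≡ t → set x e t ≗ x
set-id {e = e} p i with i ≟ e
... | yes refl = sym p
... | no _ = refl

module _ {m n : ℕ} where

  ⧺-ˡ : ∀ (x : Fin m → F) (y : Fin n → F) i → (x ⧺ y) (i ↑ˡ n) ≡ x i
  ⧺-ˡ x y i = cong [ x , y ]′ (splitAt-↑ˡ m i n)

  ⧺-ʳ : ∀ (x : Fin m → F) (y : Fin n → F) j → (x ⧺ y) (m ↑ʳ j) ≡ y j
  ⧺-ʳ x y j = cong [ x , y ]′ (splitAt-↑ʳ m n j)

  data Side : Fin (m + n) → Set where
    left  : ∀ i → Side (i ↑ˡ n)
    right : ∀ j → Side (m ↑ʳ j)

  side : ∀ k → Side k
  side k with splitAt m k in eq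
  ... | inj₁ i = subst Side (splitAt⁻¹-↑ˡ eq) (left i)
  ... | inj₂ j = subst Side (splitAt⁻¹-↑ʳ eq) (right j)

  module _ {X : Subset m} {Y : Subset n} where
    ++-∈ˡ : ∀ {i} → i ∈ X → i ↑ˡ n ∈ X ++ Y
    ++-∈ˡ {i} p = lookup⇒[]= _ _ (trans (lookup-++ˡ X Y i) ([]=⇒lookup p))

    ++-∈ʳ : ∀ {j} → j ∈ Y → m ↑ʳ j ∈ X ++ Y
    ++-∈ʳ {j} p = lookup⇒[]= _ _ (trans (lookup-++ʳ X Y j) ([]=⇒lookup p))

    ++-∈ˡ⁻ : ∀ {i} → i ↑ˡ n ∈ X ++ Y → i ∈ X
    ++-∈ˡ⁻ {i} p = lookup⇒[]= _ _ (trans (sym (lookup-++ˡ X Y i)) ([]=⇒lookup p))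

    ++-∈ʳ⁻ : ∀ {j} → m ↑ʳ j ∈ X ++ Y → j ∈ Y
    ++-∈ʳ⁻ {j} p = lookup⇒[]= _ _ (trans (sym (lookup-++ʳ X Y j)) ([]=⇒lookup p))

    ++-⊆ : ∀ {Z} → (∀ {i} → i ∈ X → i ↑ˡ n ∈ Z) → (∀ {j} → j ∈ Y → m ↑ʳ j ∈ Z) → X ++ Y ⊆ Z
    ++-⊆ p q {k} r with side k
    ... | left i = p (++-∈ˡ⁻ r)
    ... | right j = q (++-∈ʳ⁻ r)

  lhs : Subset (m + n) → Subset m
  lhs X = sel λ i → (i ↑ˡ n) ∈? X

  rhs : Subset (m + n) → Subset n
  rhs X = sel λ j → (m ↑ʳ j) ∈? X

  ∈lhs⁺ : ∀ {X i} → i ↑ˡ n ∈ X → i ∈ lhs X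
  ∈lhs⁺ {X} = ∈sel⁺ λ i → (i ↑ˡ n) ∈? X
  ∈lhs⁻ : ∀ {X i} → i ∈ lhs X → i ↑ˡ n ∈ X
  ∈lhs⁻ {X} = ∈sel⁻ λ i → (i ↑ˡ n) ∈? X
  ∈rhs⁺ : ∀ {X j} → m ↑ʳ j ∈ X → j ∈ rhs X
  ∈rhs⁺ {X} = ∈sel⁺ λ j → (m ↑ʳ j) ∈? X
  ∈rhs⁻ : ∀ {X j} → j ∈ rhs X → m ↑ʳ j ∈ X
  ∈rhs⁻ {X} = ∈sel⁻ λ j → (m ↑ʳ j) ∈? X

-- The parallel connection with the common element deleted: `t` is the value shared at that element.
-- The coordinates of both basepoints stay in the index set and are held at zero.
glue : ∀ {m n} → Space m → Fin m → Space n → Fin n → Space (m + n)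
glue {m} {n} W₁ e₁ W₂ e₂ = record
  { V = λ x → x (e₁ ↑ˡ n) ≡ 𝟘 × x (m ↑ʳ e₂) ≡ 𝟘 ×
              ∃[ t ] (V W₁ (set (x ∘ (_↑ˡ n)) e₁ t) × V W₂ (set (x ∘ (m ↑ʳ_)) e₂ t))
  ; V? = λ x → x (e₁ ↑ˡ n) ≟F 𝟘 ×-dec x (m ↑ʳ e₂) ≟F 𝟘 ×-dec
               anyF? λ t → V? W₁ (set (x ∘ (_↑ˡ n)) e₁ t) ×-dec V? W₂ (set (x ∘ (m ↑ʳ_)) e₂ t)
  ; ext = λ e (p , q , t , r , s) → trans (sym (e _)) p , trans (sym (e _)) q , t ,
      ext W₁ (set-cong t λ i _ → e (i ↑ˡ n)) r , ext W₂ (set-cong t λ j _ → e (m ↑ʳ j)) s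
  ; nil = refl , refl , 𝟘 , ext W₁ (sym ∘ set-id refl) (nil W₁) , ext W₂ (sym ∘ set-id refl) (nil W₂)
  ; comb = λ {x} {y} c (p , q , t , r , s) (p' , q' , t' , r' , s') →
      trans (cong₂ (λ a b → a ⊕ c ⊗ b) p p') (⊗-zeroʳ c) , trans (cong₂ (λ a b → a ⊕ c ⊗ b) q q') (⊗-zeroʳ c) ,
      t ⊕ c ⊗ t' , ext W₁ (set-comb (x ∘ (_↑ˡ n)) (y ∘ (_↑ˡ n)) e₁ c t t') (comb W₁ c r r')
                 , ext W₂ (set-comb (x ∘ (m ↑ʳ_)) (y ∘ (m ↑ʳ_)) e₂ c t t') (comb W₂ c s s') }
  where
  set-comb : ∀ {k} (x y : Fin k → F) e c t t' →
    (λ i → set x e t i ⊕ c ⊗ set y e t' i) ≗ set (λ i → x i ⊕ c ⊗ y i) e (t ⊕ c ⊗ t')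
  set-comb x y e c t t' i with does (i ≟ e)
  ... | true = refl
  ... | false = refl

module _ {M₁ M₂ : Matroid} {W₁ : Space (size M₁)} {W₂ : Space (size M₂)}
  (rep₁ : ∀ X → Circuit M₁ X ⇔ MinDep W₁ X) (rep₂ : ∀ X → Circuit M₂ X ⇔ MinDep W₂ X)
  {e₁ : Fin (size M₁)} {e₂ : Fin (size M₂)} (no-loop₁ : ¬ Dep W₁ ⁅ e₁ ⁆) (no-loop₂ : ¬ Dep W₂ ⁅ e₂ ⁆) where
  private
    m = size M₁
    n = size M₂
    N = twoSum M₁ e₁ M₂ e₂
    G = glue W₁ e₁ W₂ e₂

    to₁ : ∀ {X} → Circuit M₁ X → MinDep W₁ X
    to₁ {X} = Equivalence.to (rep₁ X)
    to₂ : ∀ {X} → Circuit M₂ X → MinDep W₂ X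
    to₂ {X} = Equivalence.to (rep₂ X)
    from₁ : ∀ {X} → MinDep W₁ X → Circuit M₁ X
    from₁ {X} = Equivalence.from (rep₁ X)
    from₂ : ∀ {X} → MinDep W₂ X → Circuit M₂ X
    from₂ {X} = Equivalence.from (rep₂ X)

  private
    unit-vec : ∀ {k} (W : Space k) {e C} → MinDep W C → e ∈ C →
      ∃[ x ] (V W (set x e 𝟙) × x e ≡ 𝟘 × (∀ {i} → x i ≢ 𝟘 → i ∈ C - e) × (∀ {i} → i ∈ C - e → x i ≢ 𝟘))
    unit-vec W {e} {C} m eC = let x , p , s , nz = MinDep-vec W m ; c = x e ; y = set (λ i → c ⊗ x i) e 𝟘 in
      y , ext W (λ i → sym (lem x (nz eC) i)) (scale W c p) , set-same (λ i → c ⊗ x i) e 𝟘 ,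
      (λ {i} q → case i ≟ e of λ
        { (yes refl) → contradiction (set-same (λ i → c ⊗ x i) e 𝟘) q
        ; (no r) → x∈p∧x≢y⇒x∈p-y (s (⊗-nonzeroʳ {c} λ t → q (trans (set-other (λ i → c ⊗ x i) 𝟘 r) t))) r }) ,
      λ q t → let i∈ , i≢ = ∈-⁻ {p = C} q in
        ⊗-nonzero (nz eC) (nz i∈) (trans (sym (set-other (λ i → c ⊗ x i) 𝟘 i≢)) t)
      where
      lem : ∀ x → x e ≢ 𝟘 → ∀ i → set (set (λ i → x e ⊗ x i) e 𝟘) e 𝟙 i ≡ x e ⊗ x i
      lem x p i with i ≟ e
      ... | yes refl = sym (unit² p)
      ... | no q = refl

    circuit⇒Dep : ∀ {X} → Circuit N X → Dep G X
    circuit⇒Dep (inj₁ (C , c , e∉ , refl)) =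
      let x , p , s , nz = MinDep-vec W₁ (to₁ c) ; i , iC = MinDep-nonempty W₁ (to₁ c)
          xe = ∉-Supported {x = x} s e∉ in
      x ⧺ (λ _ → 𝟘) ,
      (trans (⧺-ˡ {m} {n} x (λ _ → 𝟘) e₁) xe , ⧺-ʳ {m} {n} x (λ _ → 𝟘) e₂ , 𝟘 ,
        ext W₁ (λ i → sym (trans (set-cong 𝟘 (λ i _ → ⧺-ˡ {m} {n} x (λ _ → 𝟘) i) i) (set-id {x = x} xe i))) p ,
        ext W₂ (λ i → sym (trans (set-cong 𝟘 (λ i _ → ⧺-ʳ {m} {n} x (λ _ → 𝟘) i) i) (set-id {x = λ _ → 𝟘} refl i))) (nil W₂)) ,
      (λ {k} q → case side {m} {n} k of λ
        { (left i) → ++-∈ˡ (s λ t → q (trans (⧺-ˡ {m} {n} x (λ _ → 𝟘) i) t))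
        ; (right j) → contradiction (⧺-ʳ {m} {n} x (λ _ → 𝟘) j) q }) ,
      i ↑ˡ n , λ t → nz iC (trans (sym (⧺-ˡ {m} {n} x (λ _ → 𝟘) i)) t)
    circuit⇒Dep (inj₂ (inj₁ (C , c , e∉ , refl))) =
      let x , p , s , nz = MinDep-vec W₂ (to₂ c) ; i , iC = MinDep-nonempty W₂ (to₂ c)
          xe = ∉-Supported {x = x} s e∉ in
      (λ _ → 𝟘) ⧺ x ,
      (⧺-ˡ {m} {n} (λ _ → 𝟘) x e₁ , trans (⧺-ʳ {m} {n} (λ _ → 𝟘) x e₂) xe , 𝟘 ,
        ext W₁ (λ i → sym (trans (set-cong 𝟘 (λ i _ → ⧺-ˡ {m} {n} (λ _ → 𝟘) x i) i) (set-id {x = λ _ → 𝟘} refl i))) (nil W₁) ,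
        ext W₂ (λ i → sym (trans (set-cong 𝟘 (λ i _ → ⧺-ʳ {m} {n} (λ _ → 𝟘) x i) i) (set-id {x = x} xe i))) p) ,
      (λ {k} q → case side {m} {n} k of λ
        { (left i) → contradiction (⧺-ˡ {m} {n} (λ _ → 𝟘) x i) q
        ; (right j) → ++-∈ʳ (s λ t → q (trans (⧺-ʳ {m} {n} (λ _ → 𝟘) x j) t)) }) ,
      m ↑ʳ i , λ t → nz iC (trans (sym (⧺-ʳ {m} {n} (λ _ → 𝟘) x i)) t)
    circuit⇒Dep (inj₂ (inj₂ (C₁ , C₂ , c₁ , e₁∈ , c₂ , e₂∈ , refl))) =
      let x , p , xe , s , nz = unit-vec W₁ (to₁ c₁) e₁∈
          y , p' , ye , s' , nz' = unit-vec W₂ (to₂ c₂) e₂∈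
          i , iC , i≢ = MinDep-other W₁ no-loop₁ (to₁ c₁) in
      x ⧺ y ,
      (trans (⧺-ˡ {m} {n} x y e₁) xe , trans (⧺-ʳ {m} {n} x y e₂) ye , 𝟙 ,
        ext W₁ (λ i → sym (set-cong 𝟙 (λ i _ → ⧺-ˡ {m} {n} x y i) i)) p ,
        ext W₂ (λ i → sym (set-cong 𝟙 (λ i _ → ⧺-ʳ {m} {n} x y i) i)) p') ,
      (λ {k} q → case side {m} {n} k of λ
        { (left i) → ++-∈ˡ {Y = C₂ - e₂} (s λ t → q (trans (⧺-ˡ {m} {n} x y i) t))
        ; (right j) → ++-∈ʳ {X = C₁ - e₁} (s' λ t → q (trans (⧺-ʳ {m} {n} x y j) t)) }) ,
      i ↑ˡ n , λ t → nz (x∈p∧x≢y⇒x∈p-y iC i≢) (trans (sym (⧺-ˡ {m} {n} x y i)) t)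

    Dep⇒circuit : ∀ {X} → Dep G X → ∃[ Y ] (Y ⊆ X × Circuit N Y)
    Dep⇒circuit {X} (x , (x₁ , x₂ , t , p , q) , s , k , xk) with t ≟F 𝟘
    -- A nonzero shared value yields a circuit through the basepoint on each side. If it is zero,
    -- the side holding the nonzero coordinate `k` supplies a circuit that avoids its basepoint.
    ... | no t≢ = let C₁ , s₁ , e₁∈ , m₁ = DepAt⇒MinDep W₁ {e₁} {lhs X ∪ ⁅ e₁ ⁆} (_ , p , sup₁ , λ r → t≢ (trans (sym (set-same (x ∘ (_↑ˡ n)) e₁ t)) r))
                      C₂ , s₂ , e₂∈ , m₂ = DepAt⇒MinDep W₂ {e₂} {rhs X ∪ ⁅ e₂ ⁆} (_ , q , sup₂ , λ r → t≢ (trans (sym (set-same (x ∘ (m ↑ʳ_)) e₂ t)) r)) in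
        (C₁ - e₁) ++ (C₂ - e₂) ,
        ++-⊆ (λ r → let a , b = ∈-⁻ {p = C₁} r in ∈lhs⁻ {X = X} ([ id , (λ c → contradiction (x∈⁅y⁆⇒x≡y e₁ c) b) ]′ (x∈p∪q⁻ (lhs X) ⁅ e₁ ⁆ (s₁ a))))
             (λ r → let a , b = ∈-⁻ {p = C₂} r in ∈rhs⁻ {X = X} ([ id , (λ c → contradiction (x∈⁅y⁆⇒x≡y e₂ c) b) ]′ (x∈p∪q⁻ (rhs X) ⁅ e₂ ⁆ (s₂ a)))) ,
        inj₂ (inj₂ (C₁ , C₂ , from₁ m₁ , e₁∈ , from₂ m₂ , e₂∈ , refl))
      where
      sup₁ : Supported (set (x ∘ (_↑ˡ n)) e₁ t) (lhs X ∪ ⁅ e₁ ⁆)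
      sup₁ {i} r with i ≟ e₁
      ... | yes refl = x∈p∪q⁺ {p = lhs X} (inj₂ (x∈⁅x⁆ e₁))
      ... | no _ = x∈p∪q⁺ (inj₁ (∈lhs⁺ {X = X} (s r)))
      sup₂ : Supported (set (x ∘ (m ↑ʳ_)) e₂ t) (rhs X ∪ ⁅ e₂ ⁆)
      sup₂ {i} r with i ≟ e₂
      ... | yes refl = x∈p∪q⁺ {p = rhs X} (inj₂ (x∈⁅x⁆ e₂))
      ... | no _ = x∈p∪q⁺ (inj₁ (∈rhs⁺ {X = X} (s r)))
    ... | yes refl = case side {m} {n} k of λ
        { (left i) → let C , sC , _ , mC = DepAt⇒MinDep W₁ {i} {lhs X - e₁} (_ , ext W₁ (set-id {x = x ∘ (_↑ˡ n)} x₁) p ,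
                           (λ r → x∈p∧x≢y⇒x∈p-y (∈lhs⁺ {X = X} (s r)) λ { refl → r x₁ }) , xk) in
            C ++ ∅ , (λ {k} → ++-⊆ {X = C} {∅} {X} (λ r → ∈lhs⁻ {X = X} (proj₁ (∈-⁻ {p = lhs X} (sC r)))) (λ r → ⊥-elim (∉⊥ r)) {k}) ,
            inj₁ (C , from₁ mC , (λ r → proj₂ (∈-⁻ {p = lhs X} (sC r)) refl) , refl)
        ; (right j) → let C , sC , _ , mC = DepAt⇒MinDep W₂ {j} {rhs X - e₂} (_ , ext W₂ (set-id {x = x ∘ (m ↑ʳ_)} x₂) q ,
                           (λ r → x∈p∧x≢y⇒x∈p-y (∈rhs⁺ {X = X} (s r)) λ { refl → r x₂ }) , xk) in
            ∅ ++ C , (λ {k} → ++-⊆ {X = ∅} {C} {X} (λ r → ⊥-elim (∉⊥ r)) (λ r → ∈rhs⁻ {X = X} (proj₁ (∈-⁻ {p = rhs X} (sC r)))) {k}) ,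
            inj₂ (inj₁ (C , from₂ mC , (λ r → proj₂ (∈-⁻ {p = rhs X} (sC r)) refl) , refl)) }

    ⊆-min : ∀ {k} (W : Space k) {X Y} → MinDep W X → MinDep W Y → X ⊆ Y → X ≡ Y
    ⊆-min W mX mY s = proj₂ mY _ s (proj₁ mX)

    unremove : ∀ {k} {X Y : Subset k} {e} → e ∈ Y → X - e ⊆ Y - e → X ⊆ Y
    unremove {X = X} {Y} {e} p s {i} q with i ≟ e
    ... | yes refl = p
    ... | no r = proj₁ (∈-⁻ {p = Y} (s (x∈p∧x≢y⇒x∈p-y q r)))

    anti : ∀ {X Y} → Circuit N X → Circuit N Y → X ⊆ Y → X ≡ Y
    anti (inj₁ (C , c , _ , refl)) (inj₁ (D , d , _ , refl)) s =
      cong (_++ ∅) (⊆-min W₁ (to₁ c) (to₁ d) λ r → ++-∈ˡ⁻ {Y = ∅} (s (++-∈ˡ r)))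
    anti (inj₁ (C , c , _ , refl)) (inj₂ (inj₁ (D , d , _ , refl))) s =
      let i , r = MinDep-nonempty W₁ (to₁ c) in ⊥-elim (∉⊥ (++-∈ˡ⁻ {X = ∅} {D} (s (++-∈ˡ r))))
    anti (inj₁ (C , c , e∉ , refl)) (inj₂ (inj₂ (D , D' , d , e∈ , _ , _ , refl))) s =
      contradiction (subst (e₁ ∈_) (sym (⊆-min W₁ (to₁ c) (to₁ d) λ r → proj₁ (∈-⁻ {p = D} (++-∈ˡ⁻ {Y = D' - e₂} (s (++-∈ˡ r)))))) e∈) e∉
    anti (inj₂ (inj₁ (C , c , _ , refl))) (inj₁ (D , d , _ , refl)) s =
      let i , r = MinDep-nonempty W₂ (to₂ c) in ⊥-elim (∉⊥ (++-∈ʳ⁻ {X = D} {∅} (s (++-∈ʳ {X = ∅} r))))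
    anti (inj₂ (inj₁ (C , c , _ , refl))) (inj₂ (inj₁ (D , d , _ , refl))) s =
      cong (∅ ++_) (⊆-min W₂ (to₂ c) (to₂ d) λ r → ++-∈ʳ⁻ {X = ∅} (s (++-∈ʳ {X = ∅} r)))
    anti (inj₂ (inj₁ (C , c , e∉ , refl))) (inj₂ (inj₂ (D' , D , _ , _ , d , e∈ , refl))) s =
      contradiction (subst (e₂ ∈_) (sym (⊆-min W₂ (to₂ c) (to₂ d) λ r → proj₁ (∈-⁻ {p = D} (++-∈ʳ⁻ {X = D' - e₁} (s (++-∈ʳ {X = ∅} r)))))) e∈) e∉
    anti (inj₂ (inj₂ (C , C' , c , _ , c' , _ , refl))) (inj₁ (D , d , _ , refl)) s =
      let j , r , t = MinDep-other W₂ no-loop₂ (to₂ c') in ⊥-elim (∉⊥ (++-∈ʳ⁻ {X = D} {∅} (s (++-∈ʳ {X = C - e₁} (x∈p∧x≢y⇒x∈p-y r t)))))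
    anti (inj₂ (inj₂ (C , C' , c , _ , c' , _ , refl))) (inj₂ (inj₁ (D , d , _ , refl))) s =
      let j , r , t = MinDep-other W₁ no-loop₁ (to₁ c) in ⊥-elim (∉⊥ (++-∈ˡ⁻ {X = ∅} {D} (s (++-∈ˡ {Y = C' - e₂} (x∈p∧x≢y⇒x∈p-y r t)))))
    anti (inj₂ (inj₂ (C , C' , c , _ , c' , _ , refl))) (inj₂ (inj₂ (D , D' , d , e∈ , d' , e∈' , refl))) s =
      cong₂ (λ A B → (A - e₁) ++ (B - e₂))
        (⊆-min W₁ (to₁ c) (to₁ d) (unremove e∈ λ r → ++-∈ˡ⁻ {Y = D' - e₂} (s (++-∈ˡ r))))
        (⊆-min W₂ (to₂ c') (to₂ d') (unremove e∈' λ r → ++-∈ʳ⁻ {X = D - e₁} (s (++-∈ʳ {X = C - e₁} r))))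

  twoSum-circuits : ∀ X → Circuit N X ⇔ MinDep G X
  twoSum-circuits = Minimal-antichain circuit⇒Dep Dep⇒circuit anti

-- Minors as spaces

minorSpace : ∀ {n} → Space n → Subset n → Subset n → Space n
minorSpace W C D = record
  { V = λ x → ∃[ w ] (V W w × Q x w)
  ; V? = λ x → anyFun? (λ e (p , q) → ext W e p , λ i → Q₁-ext i (e i) (q i)) (λ w → V? W w ×-dec all? λ i → Q? i (x i) (w i))
  ; ext = λ e (w , p , q) → w , p , λ i → subst (λ a → Q₁ i a (w i)) (e i) (q i)
  ; nil = (λ _ → 𝟘) , nil W , λ i → (λ _ → refl) , (λ _ → refl) , (λ _ → refl)
  ; comb = λ c (w , p , q) (w' , p' , q') → _ , comb W c p p' , λ i →
      (λ r → trans (cong₂ (λ a b → a ⊕ c ⊗ b) (proj₁ (q i) r) (proj₁ (q' i) r)) (⊗-zeroʳ c)) ,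
      (λ r → cong₂ (λ a b → a ⊕ c ⊗ b) (proj₁ (proj₂ (q i)) r) (proj₁ (proj₂ (q' i)) r)) ,
      (λ r → trans (cong₂ (λ a b → a ⊕ c ⊗ b) (proj₂ (proj₂ (q i)) r) (proj₂ (proj₂ (q' i)) r)) (⊗-zeroʳ c)) }
  where
  Q₁ : Fin _ → F → F → Set
  Q₁ i a b = (i ∈ D → b ≡ 𝟘) × (i ∉ C → a ≡ b) × (i ∈ C → a ≡ 𝟘)
  Q : (Fin _ → F) → (Fin _ → F) → Set
  Q x w = ∀ i → Q₁ i (x i) (w i)
  Q? : ∀ i a b → Dec (Q₁ i a b)
  Q? i a b = (i ∈? D →-dec b ≟F 𝟘) ×-dec (¬? (i ∈? C) →-dec a ≟F b) ×-dec (i ∈? C →-dec a ≟F 𝟘)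
  Q₁-ext : ∀ i {a b c} → b ≡ c → Q₁ i a b → Q₁ i a c
  Q₁-ext i refl q = q

module _ {M : Matroid} {W : Space (size M)} (rep : ∀ X → Circuit M X ⇔ MinDep W X) (C D : Subset (size M)) where
  private
    U = minorSpace W C D
    Form : Subset (size M) → Set
    Form X = Nonempty X × MinorForm M C D X

    form⇒Dep : ∀ {X} → Form X → Dep U X
    form⇒Dep ((i , iX) , K , c , K∩D , refl) = let w , p , s , nz = MinDep-vec W (Equivalence.to (rep K) c) ; a , b = ∈─⁻ K C iX in
      (λ j → if does (j ∈? C) then 𝟘 else w j) , (w , p , λ j → (λ r → ∉-Supported {x = w} s λ q → ∩-∅ K∩D q r) ,
        (λ r → out {w} r) , (λ r → in' {w} r)) ,
      (λ {j} q → case j ∈? C of λ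
        { (yes r) → contradiction (in' {w} r) q
        ; (no r) → x∈p∧x∉q⇒x∈p─q (s λ t → q (trans (out {w} r) t)) r }) ,
      i , λ t → nz a (trans (sym (out {w} b)) t)
      where
      out : ∀ {w : Fin (size M) → F} {j} → j ∉ C → (if does (j ∈? C) then 𝟘 else w j) ≡ w j
      out {w} {j} r = cong (if_then 𝟘 else w j) (dec-false (j ∈? C) r)
      in' : ∀ {w : Fin (size M) → F} {j} → j ∈ C → (if does (j ∈? C) then 𝟘 else w j) ≡ 𝟘
      in' {w} {j} r = cong (if_then 𝟘 else w j) (dec-true (j ∈? C) r)

    Dep⇒form : ∀ {X} → Dep U X → ∃[ Y ] (Y ⊆ X × Form Y)
    Dep⇒form {X} (x , (w , p , q) , s , i , xi) =
      let K , sK , iK , mK = DepAt⇒MinDep W {i} {supp w} (w , p , ∈sel⁺ (λ i → ¬? (w i ≟F 𝟘)) , wi) in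
      K ─ C ,
      (λ {j} r → let a , b = ∈─⁻ K C r in s λ t → nzw (sK a) (trans (sym (proj₁ (proj₂ (q j)) b)) t)) ,
      (i , x∈p∧x∉q⇒x∈p─q iK iC) , K , Equivalence.from (rep K) mK ,
      ∅-∩ (λ {j} r t → nzw (sK r) (proj₁ (q j) t)) , refl
      where
      nzw : ∀ {j} → j ∈ supp w → w j ≢ 𝟘
      nzw = ∈sel⁻ (λ i → ¬? (w i ≟F 𝟘))
      iC : i ∉ C
      iC r = xi (proj₂ (proj₂ (q i)) r)
      wi : w i ≢ 𝟘
      wi t = xi (trans (proj₁ (proj₂ (q i)) iC) t)

  minor-circuits : ∀ X → Circuit (minor M C D) X ⇔ MinDep U X
  minor-circuits X = mk⇔ to from
    where
    to : Circuit (minor M C D) X → MinDep U X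
    to (a , b , h) = Equivalence.to (Minimal-unique form⇒Dep Dep⇒form X) ((a , b) , λ Z s (c , d) → h Z c s d)
    from : MinDep U X → Circuit (minor M C D) X
    from m = let (a , b) , h = Equivalence.from (Minimal-unique form⇒Dep Dep⇒form X) m in
      a , b , λ Y c s d → h Y s (c , d)

-- Contracting and gluing matrices

TwoEnded : ∀ {v n} → Matrix v n → Set
TwoEnded A = ∀ e → ∃[ a ] ∃[ b ] (∀ w → w ≢ a → w ≢ b → A w e ≡ 𝟘)

incidence-TwoEnded : ∀ {v n} (g : Graph v n) → TwoEnded (incidence g)
incidence-TwoEnded g e = proj₁ (g e) , proj₂ (g e) , λ w p q → cong₂ (λ a b → a ⊕ 𝟚 ⊗ b) (δ-≢ (p ∘ sym)) (δ-≢ (q ∘ sym))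

-- Two nonzero entries make a link. A column with fewer becomes a loop, unbalanced if its entry is
-- nonzero and balanced if the column is zero.
TwoEnded⇒carried : ∀ {v n} {A : Matrix v n} → TwoEnded A → ∃[ g ] Carried g A
TwoEnded⇒carried {v} {n} {A} te = (λ e → proj₁ (ends e) , proj₁ (proj₂ (ends e))) , λ e w → proj₂ (proj₂ (ends e)) w
  where
  Ends : Fin n → Fin v → Fin v → Set
  Ends e p q = ∀ w → (pt p w + pt q w ≡ 0 → A w e ≡ 𝟘) × (pt p w + pt q w ≡ 1 → A w e ≢ 𝟘)
  loop : ∀ {e} b → (∀ w → w ≢ b → A w e ≡ 𝟘) → Ends e b b
  loop b h w with b ≟ w
  ... | yes refl = (λ ()) , (λ ())
  ... | no p = (λ _ → h w (p ∘ sym)) , (λ ())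
  ends : ∀ e → ∃[ p ] ∃[ q ] Ends e p q
  ends e with te e
  ... | a , b , h with A a e ≟F 𝟘 | A b e ≟F 𝟘
  ...   | yes p | _ = b , b , loop b λ w q → case w ≟ a of λ { (yes refl) → p ; (no r) → h w r q }
  ...   | no _ | yes p = a , a , loop a λ w q → case w ≟ b of λ { (yes refl) → p ; (no r) → h w q r }
  ...   | no p | no q = a , b , link
    where
    link : Ends e a b
    link w with a ≟ w | b ≟ w
    ... | yes refl | yes refl = (λ ()) , (λ ())
    ... | yes refl | no _ = (λ ()) , (λ _ → p)
    ... | no _ | yes refl = (λ ()) , (λ _ → q)
    ... | no r | no s = (λ _ → h w (r ∘ sym) (s ∘ sym)) , (λ ())

∙-zero-col : ∀ {n} (z : Fin n → F) {f x y} → z f ≡ 𝟘 → (∀ i → i ≢ f → x i ≡ y i) → z ∙ x ≡ z ∙ y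
∙-zero-col z {f} {x} {y} p h = FS.sum-cong-≗ λ i → case i ≟ f of λ
  { (yes refl) → trans (cong (_⊗ x i) p) (sym (cong (_⊗ y i) p))
  ; (no q) → cong (z i ⊗_) (h i q) }

-- Pivoting at row `u` empties this row and moves its entries to the other end of `f`, if there is
-- one; this is the identification of the two ends. If column `f` is zero, its coordinate is already
-- unconstrained and the matrix can stay.
contract : ∀ {v n} {A : Matrix v n} → TwoEnded A → ∀ f → Σ (Matrix v n) λ A' → TwoEnded A' ×
  (∀ x → Ker A' x ⇔ (∃[ w ] (Ker A w × (∀ i → i ≢ f → w i ≡ x i))))
contract {v} {n} {A} te f with any? (λ u → ¬? (A u f ≟F 𝟘))
... | no z = A , te , λ x → mk⇔ (λ k → x , k , λ _ _ → refl)
        (λ (w , k , h) r → trans (sym (∙-zero-col (A r) (decidable-stable (A r f ≟F 𝟘) λ p → z (r , p)) h)) (k r))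
... | yes (u , uf) = A' , te' , λ x → mk⇔ (to x) (from x)
  where
  A' : Matrix v n
  A' w i = A w i ⊕ 𝟚 ⊗ (A w f ⊗ A u f) ⊗ A u i
  cancel' : ∀ a b → b ⊗ b ≡ 𝟙 → a ⊕ 𝟚 ⊗ (b ⊗ b) ⊗ a ≡ 𝟘
  cancel' a b p = trans (cong (λ c → a ⊕ 𝟚 ⊗ c ⊗ a) p) (lem a)
    where
    lem : ∀ a → a ⊕ 𝟚 ⊗ 𝟙 ⊗ a ≡ 𝟘
    lem = by₁
  A'f : ∀ w → A' w f ≡ 𝟘
  A'f w = cancel (A w f) (A u f) (unit² uf)
  rows : ∀ w x → A' w ∙ x ≡ A w ∙ x ⊕ 𝟚 ⊗ (A w f ⊗ A u f) ⊗ (A u ∙ x)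
  rows w x = ∙-combˡ (A w) (𝟚 ⊗ (A w f ⊗ A u f)) (A u) x
  to : ∀ x → Ker A' x → ∃[ w ] (Ker A w × (∀ i → i ≢ f → w i ≡ x i))
  to x k = y , ker , λ i p → trans (cong (λ a → x i ⊕ s ⊗ a) (δ-≢ (p ∘ sym))) (trans (cong (x i ⊕_) (⊗-zeroʳ s)) (⊕-identityʳ _))
    where
    s = 𝟚 ⊗ (A u ∙ x ⊗ A u f)
    y = λ i → x i ⊕ s ⊗ δ f i
    uy : A u ∙ y ≡ 𝟘
    uy = trans (∙-combʳ (A u) x s (δ f)) (trans (cong (λ a → A u ∙ x ⊕ s ⊗ a) (∙-δ (A u) f)) (cancel (A u ∙ x) (A u f) (unit² uf)))
    ker : Ker A y
    ker w = trans (sym (trans (rows w y) (trans (cong (λ a → A w ∙ y ⊕ 𝟚 ⊗ (A w f ⊗ A u f) ⊗ a) uy)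
              (trans (cong (A w ∙ y ⊕_) (⊗-zeroʳ (𝟚 ⊗ (A w f ⊗ A u f)))) (⊕-identityʳ _)))))
            (trans (∙-combʳ (A' w) x s (δ f)) (trans (cong₂ (λ a b → a ⊕ s ⊗ b) (k w) (trans (∙-δ (A' w) f) (A'f w))) (⊗-zeroʳ s)))
  from : ∀ x → ∃[ w ] (Ker A w × (∀ i → i ≢ f → w i ≡ x i)) → Ker A' x
  from x (y , k , h) w = trans (sym (∙-zero-col (A' w) (A'f w) h)) (trans (rows w y)
    (trans (cong₂ (λ a b → a ⊕ 𝟚 ⊗ (A w f ⊗ A u f) ⊗ b) (k w) (k u)) (⊗-zeroʳ (𝟚 ⊗ (A w f ⊗ A u f)))))
  opposite : ∀ {e} → A u e ≢ 𝟘 → ∃[ b ] (∀ w → w ≢ u → w ≢ b → A w e ≡ 𝟘)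
  opposite {e} p with te e
  ... | a , b , h with u ≟ a | u ≟ b
  ...   | yes refl | _ = b , h
  ...   | no _ | yes refl = a , λ w q r → h w r q
  ...   | no q | no r = contradiction (h u q r) p
  te' : TwoEnded A'
  te' e with A u e ≟F 𝟘
  ... | yes p = let a , b , h = te e in a , b , λ w q r →
          trans (cong₂ (λ c d → c ⊕ 𝟚 ⊗ (A w f ⊗ A u f) ⊗ d) (h w q r) p) (⊗-zeroʳ (𝟚 ⊗ (A w f ⊗ A u f)))
  ... | no p = let a , h = opposite p ; b , h' = opposite uf in a , b , λ w q r → case w ≟ u of λ
          { (yes refl) → cancel' (A u e) (A u f) (unit² uf)
          ; (no t) → cong₂ (λ c d → c ⊕ 𝟚 ⊗ (d ⊗ A u f) ⊗ A u e) (h w t q) (h' w t r) }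

contractAll : ∀ {v n} {A : Matrix v n} → TwoEnded A → ∀ C → Σ (Matrix v n) λ A' → TwoEnded A' ×
  (∀ x → Ker A' x ⇔ (∃[ w ] (Ker A w × (∀ i → i ∉ C → w i ≡ x i))))
contractAll {v} {n} {A} te C = go ∣ C ∣ C refl
  where
  go : ∀ k C → ∣ C ∣ ≡ k → Σ (Matrix v n) λ A' → TwoEnded A' ×
    (∀ x → Ker A' x ⇔ (∃[ w ] (Ker A w × (∀ i → i ∉ C → w i ≡ x i))))
  go zero C p = A , te , λ x → mk⇔ (λ k → x , k , λ _ _ → refl)
    (λ (w , k , h) → ext (KerS A) (λ i → h i λ q → contradiction (subst (1 ≤_) p (≤-trans (s≤s z≤n) (≤-reflexive (sym (∣∣-remove q))))) λ ()) k)
  go (suc k) C p with 0<∣∣⇒Nonempty {X = C} (subst (0 <_) (sym p) (s≤s z≤n))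
  ... | f , fC with go k (C - f) (suc-injective (trans (sym (∣∣-remove fC)) p))
  ...   | A₁ , te₁ , eq₁ with contract te₁ f
  ...     | A₂ , te₂ , eq₂ = A₂ , te₂ , λ x → mk⇔
            (λ k → let w₁ , k₁ , h₁ = Equivalence.to (eq₂ x) k ; w , k' , h = Equivalence.to (eq₁ w₁) k₁ in
               w , k' , λ i q → trans (h i (λ r → q (proj₁ (∈-⁻ r)))) (h₁ i λ { refl → q fC }))
            (λ (w , k , h) → Equivalence.from (eq₂ x) (set x f (w f) ,
               Equivalence.from (eq₁ _) (w , k , λ i q → case i ≟ f of λ
                 { (yes refl) → sym (set-same x f (w f))
                 ; (no r) → trans (h i (λ s → q (x∈p∧x≢y⇒x∈p-y s r))) (sym (set-other x (w f) r)) }) ,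
               λ i q → set-other x (w f) q))

-- A proper minor deletes or contracts at least one element. Further deletions only restrict
-- supports and further contractions are pivots, so one element at a time is enough to reach every
-- proper minor.
SingleMinors : ∀ {n} → Space n → Subset n → Fin n → Set
SingleMinors {n} W E f =
  (∃[ v ] Σ (Matrix v n) λ A → TwoEnded A × (∀ {x} → Supported x E → Ker A x ⇔ V W (set x f 𝟘))) ×
  (∃[ v ] Σ (Matrix v n) λ A → TwoEnded A × (∀ {x} → Supported x E → Ker A x ⇔ (∃[ s ] V W (set x f s))))

module _ {M : Matroid} {W : Space (size M)} (rep : ∀ X → Circuit M X ⇔ MinDep W X)
  (sup : ∀ {x} → V W x → Supported x (ground M)) (single : ∀ {f} → f ∈ ground M → SingleMinors W (ground M) f) where

  private
    E = ground M

    module _ (C D : Subset (size M)) where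
      E' = E ─ (C ∪ D)
      U = minorSpace W C D

      U-sup : ∀ {x} → V U x → Supported x E'
      U-sup (w , p , q) {i} xi = x∈p∧x∉q⇒x∈p─q (sup p λ t → xi (trans (proj₁ (proj₂ (q i)) iC) t))
          λ r → [ iC , (λ t → xi (trans (proj₁ (proj₂ (q i)) iC) (proj₁ (q i) t))) ]′ (x∈p∪q⁻ C D r)
        where
        iC : i ∉ C
        iC r = xi (proj₂ (proj₂ (q i)) r)

      finish : ∀ {v} {A : Matrix v (size M)} → TwoEnded A →
        (∀ {x} → Supported x E' → V U x ⇔ Ker A x) → IsFrame (minor M C D)
      finish {A = A} te eq = let g , car = TwoEnded⇒carried te in carried⇒IsFrame (minor M C D) g car rep'
        where
        dep : ∀ {X} → X ⊆ E' → Dep U X → Dep (KerS A) X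
        dep s (x , p , q , r) = x , Equivalence.to (eq {x} λ t → s (q t)) p , (λ {i} → q {i}) , r
        dep' : ∀ {X} → X ⊆ E' → Dep (KerS A) X → Dep U X
        dep' s (x , p , q , r) = x , Equivalence.from (eq {x} λ t → s (q t)) p , (λ {i} → q {i}) , r
        rep' : ∀ X → Circuit (minor M C D) X ⇔ (X ⊆ E' × MinDep (KerS A) X)
        rep' X = mk⇔ to from
          where
          to : Circuit (minor M C D) X → X ⊆ E' × MinDep (KerS A) X
          to c = (λ {i} → s {i}) , dep s (proj₁ m) , λ Z t d → proj₂ m Z t (dep' (λ r → s (t r)) d)
            where
            m : MinDep U X
            m = Equivalence.to (minor-circuits {M} {W} rep C D X) c
            s : X ⊆ E'
            s = MinDep-Supported U U-sup m
          from : X ⊆ E' × MinDep (KerS A) X → Circuit (minor M C D) X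
          from (s , m) = Equivalence.from (minor-circuits {M} {W} rep C D X)
            (dep' s (proj₁ m) , λ Z t d → proj₂ m Z t (dep (λ r → s (t r)) d))

  minors-IsFrame : ∀ C D → IsProperMinorPair M C D → IsFrame (minor M C D)
  minors-IsFrame C D (C⊆E , D⊆E , C∩D , f , fCD) with x∈p∪q⁻ C D fCD
  ... | inj₁ fC with proj₂ (single (C⊆E fC))
  ...   | _ , A , te , eq with contractAll te C
  ...     | A' , te' , eq' = finish C D te' (λ {x} s → mk⇔ (to s) (from s))
    where
    off-C : ∀ {x w} → Supported x (E ─ (C ∪ D)) → (∀ i → i ∉ C → w i ≡ x i) → Supported w E
    off-C {x} s h {i} p = case i ∈? C of λ
      { (yes q) → C⊆E q ; (no q) → proj₁ (∈─⁻ E (C ∪ D) (s λ t → p (trans (h i q) t))) }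
    to : ∀ {x} → Supported x (E ─ (C ∪ D)) → V (minorSpace W C D) x → Ker A' x
    to {x} s (w , p , q) = Equivalence.from (eq' x) (w ,
      Equivalence.from (eq {w} (sup p)) (w f , ext W (λ i → sym (set-id {x = w} refl i)) p) ,
      λ i r → sym (proj₁ (proj₂ (q i)) r))
    from : ∀ {x} → Supported x (E ─ (C ∪ D)) → Ker A' x → V (minorSpace W C D) x
    from {x} s k = let w , k' , h = Equivalence.to (eq' x) k ; t , p = Equivalence.to (eq {w} (off-C {x} s h)) k' in
      set w f t , p , λ i →
        (λ iD → let iC = λ iC → ∩-∅ C∩D iC iD in
           trans (set-other w t λ { refl → iC fC }) (trans (h i iC)
             (∉-Supported {x = x} s λ r → proj₂ (∈─⁻ E (C ∪ D) r) (x∈p∪q⁺ {p = C} (inj₂ iD))))) ,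
        (λ iC → sym (trans (set-other w t λ { refl → iC fC }) (h i iC))) ,
        (λ iC → ∉-Supported {x = x} s λ r → proj₂ (∈─⁻ E (C ∪ D) r) (x∈p∪q⁺ (inj₁ iC)))
  minors-IsFrame C D (C⊆E , D⊆E , C∩D , f , fCD) | inj₂ fD with proj₁ (single (D⊆E fD))
  ...   | _ , A , te , eq with contractAll te C
  ...     | A' , te' , eq' = finish C D te' (λ {x} s → mk⇔ (to s) (from s))
    where
    fC : f ∉ C
    fC q = ∩-∅ C∩D q fD
    off-C : ∀ {x w} → Supported x (E ─ (C ∪ D)) → (∀ i → i ∉ C → w i ≡ x i) → Supported w E
    off-C {x} s h {i} p = case i ∈? C of λ
      { (yes q) → C⊆E q ; (no q) → proj₁ (∈─⁻ E (C ∪ D) (s λ t → p (trans (h i q) t))) }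
    to : ∀ {x} → Supported x (E ─ (C ∪ D)) → V (minorSpace W C D) x → Ker A' x
    to {x} s (w , p , q) = Equivalence.from (eq' x) (w ,
      Equivalence.from (eq {w} (sup p)) (ext W (λ i → sym (set-id {x = w} (proj₁ (q f) fD) i)) p) ,
      λ i r → sym (proj₁ (proj₂ (q i)) r))
    from : ∀ {x} → Supported x (E ─ (C ∪ D)) → Ker A' x → V (minorSpace W C D) x
    from {x} s k = let w , k' , h = Equivalence.to (eq' x) k ; p = Equivalence.to (eq {w} (off-C {x} s h)) k' in
      set w f 𝟘 , p , λ i →
        (λ iD → zeroD {w} h i iD) ,
        (λ iC → case i ≟ f of λ
          { (yes refl) → trans (x0 fD) (sym (set-same w f 𝟘))
          ; (no r) → sym (trans (set-other w 𝟘 r) (h i iC)) }) ,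
        (λ iC → ∉-Supported {x = x} s λ r → proj₂ (∈─⁻ E (C ∪ D) r) (x∈p∪q⁺ (inj₁ iC)))
      where
      x0 : ∀ {i} → i ∈ D → x i ≡ 𝟘
      x0 iD = ∉-Supported {x = x} s λ r → proj₂ (∈─⁻ E (C ∪ D) r) (x∈p∪q⁺ {p = C} (inj₂ iD))
      zeroD : ∀ {w} → (∀ i → i ∉ C → w i ≡ x i) → ∀ i → i ∈ D → set w f 𝟘 i ≡ 𝟘
      zeroD {w} h i iD = case i ≟ f of λ
        { (yes refl) → set-same w f 𝟘
        ; (no r) → trans (set-other w 𝟘 r) (trans (h i λ q → ∩-∅ C∩D q iD) (x0 iD)) }

-- Gluing a graph onto a two-ended matrix

∙-set : ∀ {n} (z x : Fin n → F) {e} t → x e ≡ 𝟘 → z ∙ set x e t ≡ z ∙ x ⊕ t ⊗ z e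
∙-set z x {e} t p = trans (∙-congʳ z eq) (trans (∙-combʳ z x t (δ e)) (cong (λ a → z ∙ x ⊕ t ⊗ a) (∙-δ z e)))
  where
  eq : set x e t ≗ λ i → x i ⊕ t ⊗ δ e i
  eq i with i ≟ e
  ... | yes refl = sym (trans (cong₂ (λ a b → a ⊕ t ⊗ b) p (δ-refl i)) (lem t))
    where
    lem : ∀ t → t ⊗ 𝟙 ≡ t
    lem = by₁
  ... | no q = sym (trans (cong (λ a → x i ⊕ t ⊗ a) (δ-≢ (q ∘ sym))) (trans (cong (x i ⊕_) (⊗-zeroʳ t)) (⊕-identityʳ _)))

sum-⧺ : ∀ {m n} (f : Fin (m + n) → F) → FS.sum f ≡ FS.sum (λ i → f (i ↑ˡ n)) ⊕ FS.sum (λ j → f (m ↑ʳ j))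
sum-⧺ {zero} f = refl
sum-⧺ {suc m} {n} f = trans (cong (f zero ⊕_) (sum-⧺ {m} {n} (f ∘ suc))) (lem (f zero) _ _)
  where
  lem : ∀ a b c → a ⊕ (b ⊕ c) ≡ a ⊕ b ⊕ c
  lem = by₃

∙-⧺ : ∀ {m n} (p : Fin m → F) (q : Fin n → F) x → (p ⧺ q) ∙ x ≡ p ∙ (x ∘ (_↑ˡ n)) ⊕ q ∙ (x ∘ (m ↑ʳ_))
∙-⧺ {m} {n} p q x = trans (sum-⧺ {m} {n} _) (cong₂ _⊕_
  (FS.sum-cong-≗ λ i → cong (_⊗ x (i ↑ˡ n)) (⧺-ˡ p q i)) (FS.sum-cong-≗ λ j → cong (_⊗ x (m ↑ʳ j)) (⧺-ʳ p q j)))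

sum-pair : ∀ {n} {f : Fin n → F} {u v} → u ≢ v → (∀ i → i ≢ u → i ≢ v → f i ≡ 𝟘) → FS.sum f ≡ f u ⊕ f v
sum-pair {n} {f} {u} {v} d h = begin
  FS.sum f ≡⟨ FS.sum-cong-≗ split ⟩
  FS.sum (λ i → f u ⊗ δ u i ⊕ f v ⊗ δ v i) ≡⟨ FS.∑-distrib-+ (λ i → f u ⊗ δ u i) (λ i → f v ⊗ δ v i) ⟩
  _ ≡⟨ cong₂ _⊕_ (pick u) (pick v) ⟩
  f u ⊕ f v ∎
  where
  open ≡-Reasoning
  ⊗1 : ∀ a → a ⊗ 𝟙 ≡ a
  ⊗1 = by₁
  pick : ∀ w → FS.sum (λ i → f w ⊗ δ w i) ≡ f w
  pick w = trans (sum-single w λ j p → trans (cong (f w ⊗_) (δ-≢ (p ∘ sym))) (⊗-zeroʳ _)) (trans (cong (f w ⊗_) (δ-refl w)) (⊗1 _))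
  split : ∀ i → f i ≡ f u ⊗ δ u i ⊕ f v ⊗ δ v i
  split i with u ≟ i | v ≟ i
  ... | yes refl | yes refl = contradiction refl d
  ... | yes refl | no _ = sym (trans (cong₂ _⊕_ (⊗1 (f u)) (⊗-zeroʳ (f v))) (⊕-identityʳ _))
  ... | no _ | yes refl = sym (cong₂ _⊕_ (⊗-zeroʳ (f u)) (⊗1 (f v)))
  ... | no p | no q = trans (h i (p ∘ sym) (q ∘ sym)) (sym (cong₂ _⊕_ (⊗-zeroʳ (f u)) (⊗-zeroʳ (f v))))

-- Gluing a graph along its edge e₁ = uv to the element e₂ with ends p, q: the value t at the
-- common element equals minus row u and also row v, so u can be identified with p and v with q.
module Glue {v₁ n₁ v₂ n₂} (g : Graph v₁ n₁) {A : Matrix v₂ n₂} (te : TwoEnded A)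
  (e₁ : Fin n₁) (e₂ : Fin n₂) (u≢v : proj₁ (g e₁) ≢ proj₂ (g e₁)) where
  private
    I = incidence g
    u = proj₁ (g e₁)
    v = proj₂ (g e₁)
    p = proj₁ (te e₂)
    q = proj₁ (proj₂ (te e₂))
    hA = proj₂ (proj₂ (te e₂))

    pole? : ∀ i → Dec (i ≡ u ⊎ i ≡ v)
    pole? i = i ≟ u ⊎-dec i ≟ v

  P₁ : Matrix v₁ n₁
  P₁ i e = if does (pole? i) then 𝟘 else I i e
  P₂ : Matrix v₂ n₁
  P₂ w e = A w e₂ ⊗ (if does (w ≟ p) then 𝟚 ⊗ I u e else I v e)

  P : Matrix (v₁ + v₂) n₁
  P R e = [ (λ i → P₁ i e) , (λ w → P₂ w e) ]′ (splitAt v₁ R)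
  Q : Matrix (v₁ + v₂) n₂
  Q R e = [ (λ i → 𝟘) , (λ w → A w e) ]′ (splitAt v₁ R)

  P-ˡ : ∀ i e → P (i ↑ˡ v₂) e ≡ P₁ i e
  P-ˡ i e = cong [ (λ i → P₁ i e) , (λ w → P₂ w e) ]′ (splitAt-↑ˡ v₁ i v₂)
  P-ʳ : ∀ w e → P (v₁ ↑ʳ w) e ≡ P₂ w e
  P-ʳ w e = cong [ (λ i → P₁ i e) , (λ w → P₂ w e) ]′ (splitAt-↑ʳ v₁ v₂ w)
  Q-ˡ : ∀ i e → Q (i ↑ˡ v₂) e ≡ 𝟘
  Q-ˡ i e = cong [ (λ i → 𝟘) , (λ w → A w e) ]′ (splitAt-↑ˡ v₁ i v₂)
  Q-ʳ : ∀ w e → Q (v₁ ↑ʳ w) e ≡ A w e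
  Q-ʳ w e = cong [ (λ i → 𝟘) , (λ w → A w e) ]′ (splitAt-↑ʳ v₁ v₂ w)

  Q-TwoEnded : TwoEnded Q
  Q-TwoEnded e = let a , b , h = te e in v₁ ↑ʳ a , v₁ ↑ʳ b , λ R r s → case side {v₁} {v₂} R of λ
    { (left i) → Q-ˡ i e
    ; (right w) → trans (Q-ʳ w e) (h w (λ { refl → r refl }) (λ { refl → s refl })) }

  private
    -- The place of each vertex of `g` after gluing: the poles `u` and `v` move to the ends of `e₂`,
    -- and the rows they leave behind are zero.
    κ : Fin v₁ → Fin (v₁ + v₂)
    κ i = if does (i ≟ u) then v₁ ↑ʳ p else if does (i ≟ v) then v₁ ↑ʳ q else i ↑ˡ v₂
    κu : κ u ≡ v₁ ↑ʳ p
    κu = cong (if_then v₁ ↑ʳ p else (if does (u ≟ v) then v₁ ↑ʳ q else u ↑ˡ v₂)) (dec-true (u ≟ u) refl)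
    κv : κ v ≡ v₁ ↑ʳ q
    κv = trans (cong (if_then v₁ ↑ʳ p else (if does (v ≟ v) then v₁ ↑ʳ q else v ↑ˡ v₂)) (dec-false (v ≟ u) (u≢v ∘ sym)))
               (cong (if_then v₁ ↑ʳ q else v ↑ˡ v₂) (dec-true (v ≟ v) refl))
    κ-other : ∀ {i} → i ≢ u → i ≢ v → κ i ≡ i ↑ˡ v₂
    κ-other {i} r s = trans (cong (if_then v₁ ↑ʳ p else (if does (i ≟ v) then v₁ ↑ʳ q else i ↑ˡ v₂)) (dec-false (i ≟ u) r))
               (cong (if_then v₁ ↑ʳ q else i ↑ˡ v₂) (dec-false (i ≟ v) s))

  P-TwoEnded : TwoEnded P
  P-TwoEnded e = κ a , κ b , λ R r s → case side {v₁} {v₂} R of λ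
    { (left i) → trans (P-ˡ i e) (zeroˡ i r s)
    ; (right w) → trans (P-ʳ w e) (zeroʳ w r s) }
    where
    a = proj₁ (g e)
    b = proj₂ (g e)
    away : ∀ {i R} → κ i ≡ R → R ≢ κ a → R ≢ κ b → I i e ≡ 𝟘
    away {i} refl r s = proj₂ (proj₂ (incidence-TwoEnded g e)) i (r ∘ cong κ) (s ∘ cong κ)
    zeroˡ : ∀ i → i ↑ˡ v₂ ≢ κ a → i ↑ˡ v₂ ≢ κ b → P₁ i e ≡ 𝟘
    zeroˡ i r s = go (pole? i)
      where
      go : Dec (i ≡ u ⊎ i ≡ v) → P₁ i e ≡ 𝟘
      go (yes t) = cong (if_then 𝟘 else I i e) (dec-true (pole? i) t)
      go (no t) = trans (cong (if_then 𝟘 else I i e) (dec-false (pole? i) t)) (away (κ-other (t ∘ inj₁) (t ∘ inj₂)) r s)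
    zeroʳ : ∀ w → v₁ ↑ʳ w ≢ κ a → v₁ ↑ʳ w ≢ κ b → P₂ w e ≡ 𝟘
    zeroʳ w r s with w ≟ p | w ≟ q
    ... | yes refl | _ = trans (cong (λ c → A w e₂ ⊗ (𝟚 ⊗ c)) (away κu r s)) (⊗-zeroʳ (A w e₂))
    ... | no _ | yes refl = trans (cong (A w e₂ ⊗_) (away κv r s)) (⊗-zeroʳ (A w e₂))
    ... | no c | no d = cong (_⊗ I v e) (hA w c d)

  private
    Iu : I u e₁ ≡ 𝟙
    Iu = cong₂ (λ a b → a ⊕ 𝟚 ⊗ b) (δ-refl u) (δ-≢ (u≢v ∘ sym))
    Iv : I v e₁ ≡ 𝟚
    Iv = cong₂ (λ a b → a ⊕ 𝟚 ⊗ b) (δ-≢ u≢v) (δ-refl v)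
    I0 : ∀ {i} → i ≢ u → i ≢ v → I i e₁ ≡ 𝟘
    I0 {i} r s = proj₂ (proj₂ (incidence-TwoEnded g e₁)) i r s

    P₂∙ : ∀ w x {t} → 𝟚 ⊗ (I u ∙ x) ≡ t → I v ∙ x ≡ t → P₂ w ∙ x ≡ A w e₂ ⊗ t
    P₂∙ w x {t} r s with w ≟ p
    ... | yes _ = trans (FS.sum-cong-≗ λ e → lem (A w e₂) (I u e) (x e))
                    (trans (sym (FS.*-distribˡ-sum (A w e₂ ⊗ 𝟚) (λ e → I u e ⊗ x e))) (trans (lem' (A w e₂) (I u ∙ x)) (cong (A w e₂ ⊗_) r)))
      where
      lem : ∀ a b c → a ⊗ (𝟚 ⊗ b) ⊗ c ≡ a ⊗ 𝟚 ⊗ (b ⊗ c)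
      lem = by₃
      lem' : ∀ a b → a ⊗ 𝟚 ⊗ b ≡ a ⊗ (𝟚 ⊗ b)
      lem' = by₂
    ... | no _ = trans (FS.sum-cong-≗ λ e → lem (A w e₂) (I v e) (x e))
                    (trans (sym (FS.*-distribˡ-sum (A w e₂) (λ e → I v e ⊗ x e))) (cong (A w e₂ ⊗_) s))
      where
      lem : ∀ a b c → a ⊗ b ⊗ c ≡ a ⊗ (b ⊗ c)
      lem = by₃

  glue-kernel : ∀ {x y} → x e₁ ≡ 𝟘 → y e₂ ≡ 𝟘 →
    (∀ R → P R ∙ x ⊕ Q R ∙ y ≡ 𝟘) ⇔ (∃[ t ] (Ker I (set x e₁ t) × Ker A (set y e₂ t)))
  glue-kernel {x} {y} xe ye = mk⇔ to from
    where
    rowˡ : ∀ i → P (i ↑ˡ v₂) ∙ x ⊕ Q (i ↑ˡ v₂) ∙ y ≡ P₁ i ∙ x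
    rowˡ i = trans (cong₂ _⊕_ (∙-congˡ x (P-ˡ i)) (trans (∙-congˡ y (Q-ˡ i)) (sum-zero {f = λ e → 𝟘 ⊗ y e} λ _ → refl))) (⊕-identityʳ _)
    rowʳ : ∀ w → P (v₁ ↑ʳ w) ∙ x ⊕ Q (v₁ ↑ʳ w) ∙ y ≡ P₂ w ∙ x ⊕ A w ∙ y
    rowʳ w = cong₂ _⊕_ (∙-congˡ x (P-ʳ w)) (∙-congˡ y (Q-ʳ w))
    P₁∙ : ∀ {i} → i ≢ u → i ≢ v → P₁ i ∙ x ≡ I i ∙ x
    P₁∙ {i} r s = cong (λ b → (λ e → if b then 𝟘 else I i e) ∙ x) (dec-false (pole? i) [ r , s ]′)
    to : (∀ R → P R ∙ x ⊕ Q R ∙ y ≡ 𝟘) → ∃[ t ] (Ker I (set x e₁ t) × Ker A (set y e₂ t))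
    to h = t , k₁ , k₂
      where
      t = I v ∙ x
      others : ∀ i → i ≢ u → i ≢ v → I i ∙ x ≡ 𝟘
      others i r s = trans (sym (P₁∙ r s)) (trans (sym (rowˡ i)) (h (i ↑ˡ v₂)))
      -- The rows of an incidence matrix add up to zero, and all rows away from the poles vanish on
      -- `x`, so the two polar rows have opposite values.
      total : I u ∙ x ⊕ t ≡ 𝟘
      total = trans (sym (sum-pair {f = λ i → ones {v₁} i ⊗ (I i ∙ x)} u≢v others))
                (trans (sym (∙-interchange I ones x)) (sum-zero λ e → cong (_⊗ x e) (incidence-col g e)))
      dbl : 𝟚 ⊗ (I u ∙ x) ≡ t
      dbl = lem (I u ∙ x) t total
        where
        lem : ∀ a b → a ⊕ b ≡ 𝟘 → 𝟚 ⊗ a ≡ b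
        lem 𝟘 𝟘 p = refl
        lem 𝟙 𝟚 p = refl
        lem 𝟚 𝟙 p = refl
      k₁ : Ker I (set x e₁ t)
      k₁ i with i ≟ u | i ≟ v
      ... | yes refl | _ = trans (∙-set (I u) x t xe) (trans (cong (λ c → I u ∙ x ⊕ t ⊗ c) Iu) (trans (cong (I u ∙ x ⊕_) (⊗1 t)) total))
        where
        ⊗1 : ∀ a → a ⊗ 𝟙 ≡ a
        ⊗1 = by₁
      ... | no _ | yes refl = trans (∙-set (I v) x t xe) (trans (cong (λ c → t ⊕ t ⊗ c) Iv) (lem t))
        where
        lem : ∀ a → a ⊕ a ⊗ 𝟚 ≡ 𝟘
        lem = by₁
      ... | no r | no s = trans (∙-set (I i) x t xe) (trans (cong₂ (λ a c → a ⊕ t ⊗ c) (others i r s) (I0 r s)) (⊗-zeroʳ t))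
      k₂ : Ker A (set y e₂ t)
      k₂ w = trans (∙-set (A w) y t ye) (trans (lem (A w ∙ y) t (A w e₂)) (trans (cong (_⊕ A w ∙ y) (sym (P₂∙ w x dbl refl))) (trans (sym (rowʳ w)) (h (v₁ ↑ʳ w)))))
        where
        lem : ∀ a t c → a ⊕ t ⊗ c ≡ c ⊗ t ⊕ a
        lem = by₃
    from : ∃[ t ] (Ker I (set x e₁ t) × Ker A (set y e₂ t)) → ∀ R → P R ∙ x ⊕ Q R ∙ y ≡ 𝟘
    from (t , k₁ , k₂) R with side {v₁} {v₂} R
    ... | left i = trans (rowˡ i) (go (pole? i))
      where
      go : Dec (i ≡ u ⊎ i ≡ v) → P₁ i ∙ x ≡ 𝟘
      go (yes r) = trans (cong (λ b → (λ e → if b then 𝟘 else I i e) ∙ x) (dec-true (pole? i) r)) (sum-zero {f = λ e → 𝟘 ⊗ x e} λ _ → refl)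
      go (no r) = trans (P₁∙ (r ∘ inj₁) (r ∘ inj₂)) (trans (sym (trans (cong (λ c → I i ∙ x ⊕ t ⊗ c) (I0 (r ∘ inj₁) (r ∘ inj₂)))
                    (trans (cong (I i ∙ x ⊕_) (⊗-zeroʳ t)) (⊕-identityʳ _)))) (trans (sym (∙-set (I i) x t xe)) (k₁ i)))
    ... | right w = trans (rowʳ w) (trans (cong (_⊕ A w ∙ y) (P₂∙ w x du dv)) (trans (lem (A w ∙ y) t (A w e₂)) (trans (sym (∙-set (A w) y t ye)) (k₂ w))))
      where
      lem : ∀ a t c → c ⊗ t ⊕ a ≡ a ⊕ t ⊗ c
      lem = by₃
      dv : I v ∙ x ≡ t
      dv = lem₁ (I v ∙ x) t (trans (sym (trans (∙-set (I v) x t xe) (cong (λ c → I v ∙ x ⊕ t ⊗ c) Iv))) (k₁ v))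
        where
        lem₁ : ∀ a t → a ⊕ t ⊗ 𝟚 ≡ 𝟘 → a ≡ t
        lem₁ 𝟘 𝟘 p = refl
        lem₁ 𝟙 𝟙 p = refl
        lem₁ 𝟚 𝟚 p = refl
      du : 𝟚 ⊗ (I u ∙ x) ≡ t
      du = lem₁ (I u ∙ x) t (trans (sym (trans (∙-set (I u) x t xe) (cong (λ c → I u ∙ x ⊕ t ⊗ c) Iu))) (k₁ u))
        where
        lem₁ : ∀ a t → a ⊕ t ⊗ 𝟙 ≡ 𝟘 → 𝟚 ⊗ a ≡ t
        lem₁ 𝟘 𝟘 p = refl
        lem₁ 𝟙 𝟚 p = refl
        lem₁ 𝟚 𝟙 p = refl

FrameRep : ∀ {n} → Space n → Set
FrameRep {n} W = ∃[ v ] Σ (Matrix v n) λ A → TwoEnded A × (∀ x → Ker A x ⇔ V W x)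

-- The right-hand sides do not depend on `x f`, so `f` remains in the graph as a loop. The basepoint
-- `e` must be a link because `Glue` identifies its two ends with those of another element.
GraphicDeletion GraphicContraction : ∀ {n} → Space n → Fin n → Fin n → Set
GraphicDeletion {n} W e f = ∃[ v ] Σ (Graph v n) λ g → proj₁ (g e) ≢ proj₂ (g e) ×
  (∀ x → Ker (incidence g) x ⇔ V W (set x f 𝟘))
GraphicContraction {n} W e f = ∃[ v ] Σ (Graph v n) λ g → proj₁ (g e) ≢ proj₂ (g e) ×
  (∀ x → Ker (incidence g) x ⇔ (∃[ s ] V W (set x f s)))

set-comm : ∀ {n} (x : Fin n → F) {e f} s t → f ≢ e → set (set x f s) e t ≗ set (set x e t) f s
set-comm x {e} {f} s t p i with i ≟ e | i ≟ f
... | yes refl | yes refl = contradiction refl p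
... | yes _ | no _ = refl
... | no _ | yes _ = refl
... | no _ | no _ = refl

module _ {m n : ℕ} {W₁ : Space m} {e₁ : Fin m} {W₂ : Space n} {e₂ : Fin n} where
  private
    G = glue W₁ e₁ W₂ e₂
    E = (⊤ - e₁) ++ (⊤ - e₂)

    at₁ : ∀ {x} → Supported x E → x (e₁ ↑ˡ n) ≡ 𝟘
    at₁ {x} s = ∉-Supported {x = x} s λ r → proj₂ (∈-⁻ {p = ⊤} (++-∈ˡ⁻ {X = ⊤ - e₁} {⊤ - e₂} r)) refl
    at₂ : ∀ {x} → Supported x E → x (m ↑ʳ e₂) ≡ 𝟘
    at₂ {x} s = ∉-Supported {x = x} s λ r → proj₂ (∈-⁻ {p = ⊤} (++-∈ʳ⁻ {X = ⊤ - e₁} {⊤ - e₂} r)) refl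

    setˡˡ : ∀ (x : Fin (m + n) → F) f s → (λ i → set x (f ↑ˡ n) s (i ↑ˡ n)) ≗ set (x ∘ (_↑ˡ n)) f s
    setˡˡ x f s i with i ≟ f
    ... | yes refl = set-same x (f ↑ˡ n) s
    ... | no p = set-other x s λ q → p (↑ˡ-injective n i f q)
    setˡʳ : ∀ (x : Fin (m + n) → F) f s → (λ j → set x (f ↑ˡ n) s (m ↑ʳ j)) ≗ (x ∘ (m ↑ʳ_))
    setˡʳ x f s j = set-other x s λ q → apart (trans (sym (splitAt-↑ʳ m n j)) (trans (cong (splitAt m) q) (splitAt-↑ˡ m f n)))
      where
      apart : inj₂ j ≢ inj₁ f
      apart ()
    setʳʳ : ∀ (x : Fin (m + n) → F) f s → (λ j → set x (m ↑ʳ f) s (m ↑ʳ j)) ≗ set (x ∘ (m ↑ʳ_)) f s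
    setʳʳ x f s j with j ≟ f
    ... | yes refl = set-same x (m ↑ʳ f) s
    ... | no p = set-other x s λ q → p (↑ʳ-injective m j f q)
    setʳˡ : ∀ (x : Fin (m + n) → F) f s → (λ i → set x (m ↑ʳ f) s (i ↑ˡ n)) ≗ (x ∘ (_↑ˡ n))
    setʳˡ x f s i = set-other x s λ q → apart (trans (sym (splitAt-↑ˡ m i n)) (trans (cong (splitAt m) q) (splitAt-↑ʳ m n f)))
      where
      apart : inj₁ i ≢ inj₂ f
      apart ()

  glue-setˡ : ∀ {x} → Supported x E → ∀ {f} → f ≢ e₁ → ∀ s → V G (set x (f ↑ˡ n) s) ⇔
    (∃[ t ] (V W₁ (set (set (x ∘ (_↑ˡ n)) e₁ t) f s) × V W₂ (set (x ∘ (m ↑ʳ_)) e₂ t)))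
  glue-setˡ {x} sx {f} f≢ s = mk⇔
    (λ (_ , _ , t , p , q) → t ,
      ext W₁ (λ i → trans (set-cong t (λ i _ → setˡˡ x f s i) i) (set-comm (x ∘ (_↑ˡ n)) s t f≢ i)) p ,
      ext W₂ (set-cong t λ j _ → setˡʳ x f s j) q)
    (λ (t , p , q) → trans (setˡˡ x f s e₁) (trans (set-other (x ∘ (_↑ˡ n)) s (f≢ ∘ sym)) (at₁ sx)) ,
      trans (setˡʳ x f s e₂) (at₂ sx) , t ,
      ext W₁ (λ i → sym (trans (set-cong t (λ i _ → setˡˡ x f s i) i) (set-comm (x ∘ (_↑ˡ n)) s t f≢ i))) p ,
      ext W₂ (λ j → sym (set-cong t (λ j _ → setˡʳ x f s j) j)) q)

  glue-setʳ : ∀ {x} → Supported x E → ∀ {f} → f ≢ e₂ → ∀ s → V G (set x (m ↑ʳ f) s) ⇔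
    (∃[ t ] (V W₁ (set (x ∘ (_↑ˡ n)) e₁ t) × V W₂ (set (set (x ∘ (m ↑ʳ_)) e₂ t) f s)))
  glue-setʳ {x} sx {f} f≢ s = mk⇔
    (λ (_ , _ , t , p , q) → t ,
      ext W₁ (set-cong t λ i _ → setʳˡ x f s i) p ,
      ext W₂ (λ j → trans (set-cong t (λ j _ → setʳʳ x f s j) j) (set-comm (x ∘ (m ↑ʳ_)) s t f≢ j)) q)
    (λ (t , p , q) → trans (setʳˡ x f s e₁) (at₁ sx) ,
      trans (setʳʳ x f s e₂) (trans (set-other (x ∘ (m ↑ʳ_)) s (f≢ ∘ sym)) (at₂ sx)) , t ,
      ext W₁ (λ i → sym (set-cong t (λ i _ → setʳˡ x f s i) i)) p ,
      ext W₂ (λ j → sym (trans (set-cong t (λ j _ → setʳʳ x f s j) j) (set-comm (x ∘ (m ↑ʳ_)) s t f≢ j))) q)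

  private
    module Left {v₁ v₂} (g : Graph v₁ m) {A : Matrix v₂ n} (te : TwoEnded A) (u≢v : proj₁ (g e₁) ≢ proj₂ (g e₁)) where
      module K = Glue g te e₁ e₂ u≢v
      B : Matrix (v₁ + v₂) (m + n)
      B R = K.P R ⧺ K.Q R
      teB : TwoEnded B
      teB k = case side {m} {n} k of λ
        { (left i) → let a , b , h = K.P-TwoEnded i in a , b , λ R p q → trans (⧺-ˡ (K.P R) (K.Q R) i) (h R p q)
        ; (right j) → let a , b , h = K.Q-TwoEnded j in a , b , λ R p q → trans (⧺-ʳ (K.P R) (K.Q R) j) (h R p q) }
      ker : ∀ {x} → Supported x E → Ker B x ⇔
        (∃[ t ] (Ker (incidence g) (set (x ∘ (_↑ˡ n)) e₁ t) × Ker A (set (x ∘ (m ↑ʳ_)) e₂ t)))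
      ker {x} s = mk⇔
        (λ k → Equivalence.to (K.glue-kernel {x ∘ (_↑ˡ n)} {x ∘ (m ↑ʳ_)} (at₁ s) (at₂ s)) λ R → trans (sym (∙-⧺ (K.P R) (K.Q R) x)) (k R))
        (λ h R → trans (∙-⧺ (K.P R) (K.Q R) x) (Equivalence.from (K.glue-kernel {x ∘ (_↑ˡ n)} {x ∘ (m ↑ʳ_)} (at₁ s) (at₂ s)) h R))

    module Right {v₁ v₂} (g : Graph v₂ n) {A : Matrix v₁ m} (te : TwoEnded A) (u≢v : proj₁ (g e₂) ≢ proj₂ (g e₂)) where
      module K = Glue g te e₂ e₁ u≢v
      B : Matrix (v₂ + v₁) (m + n)
      B R = K.Q R ⧺ K.P R
      teB : TwoEnded B
      teB k = case side {m} {n} k of λ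
        { (left i) → let a , b , h = K.Q-TwoEnded i in a , b , λ R p q → trans (⧺-ˡ (K.Q R) (K.P R) i) (h R p q)
        ; (right j) → let a , b , h = K.P-TwoEnded j in a , b , λ R p q → trans (⧺-ʳ (K.Q R) (K.P R) j) (h R p q) }
      ⊕-comm : ∀ a b → a ⊕ b ≡ b ⊕ a
      ⊕-comm = by₂
      ker : ∀ {x} → Supported x E → Ker B x ⇔
        (∃[ t ] (Ker A (set (x ∘ (_↑ˡ n)) e₁ t) × Ker (incidence g) (set (x ∘ (m ↑ʳ_)) e₂ t)))
      ker {x} s = mk⇔
        (λ k → let t , p , q = Equivalence.to (K.glue-kernel {x ∘ (m ↑ʳ_)} {x ∘ (_↑ˡ n)} (at₂ s) (at₁ s))
                                 λ R → trans (⊕-comm (K.P R ∙ (x ∘ (m ↑ʳ_))) _) (trans (sym (∙-⧺ (K.Q R) (K.P R) x)) (k R)) in t , q , p)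
        (λ (t , q , p) R → trans (∙-⧺ (K.Q R) (K.P R) x) (trans (⊕-comm (K.Q R ∙ (x ∘ (_↑ˡ n))) _)
           (Equivalence.from (K.glue-kernel {x ∘ (m ↑ʳ_)} {x ∘ (_↑ˡ n)} (at₂ s) (at₁ s)) (t , p , q) R)))

  single-left : FrameRep W₂ → ∀ {f} → f ≢ e₁ → GraphicDeletion W₁ e₁ f → GraphicContraction W₁ e₁ f → SingleMinors G E (f ↑ˡ n)
  single-left (_ , A , te , rep) {f} f≢ (_ , g , l , eq) (_ , g' , l' , eq') =
    (_ , L.B , L.teB , λ {x} s → mk⇔
      (λ k → let t , p , q = Equivalence.to (L.ker s) k in
         Equivalence.from (glue-setˡ s f≢ 𝟘) (t , Equivalence.to (eq _) p , Equivalence.to (rep _) q))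
      (λ k → let t , p , q = Equivalence.to (glue-setˡ s f≢ 𝟘) k in
         Equivalence.from (L.ker s) (t , Equivalence.from (eq _) p , Equivalence.from (rep _) q))) ,
    (_ , L'.B , L'.teB , λ {x} s → mk⇔
      (λ k → let t , p , q = Equivalence.to (L'.ker s) k ; r , p' = Equivalence.to (eq' _) p in
         r , Equivalence.from (glue-setˡ s f≢ r) (t , p' , Equivalence.to (rep _) q))
      (λ (r , k) → let t , p , q = Equivalence.to (glue-setˡ s f≢ r) k in
         Equivalence.from (L'.ker s) (t , Equivalence.from (eq' _) (r , p) , Equivalence.from (rep _) q)))
    where
    module L = Left g te l
    module L' = Left g' te l'

  single-right : FrameRep W₁ → ∀ {f} → f ≢ e₂ → GraphicDeletion W₂ e₂ f → GraphicContraction W₂ e₂ f → SingleMinors G E (m ↑ʳ f)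
  single-right (_ , A , te , rep) {f} f≢ (_ , g , l , eq) (_ , g' , l' , eq') =
    (_ , L.B , L.teB , λ {x} s → mk⇔
      (λ k → let t , p , q = Equivalence.to (L.ker s) k in
         Equivalence.from (glue-setʳ s f≢ 𝟘) (t , Equivalence.to (rep _) p , Equivalence.to (eq _) q))
      (λ k → let t , p , q = Equivalence.to (glue-setʳ s f≢ 𝟘) k in
         Equivalence.from (L.ker s) (t , Equivalence.from (rep _) p , Equivalence.from (eq _) q))) ,
    (_ , L'.B , L'.teB , λ {x} s → mk⇔
      (λ k → let t , p , q = Equivalence.to (L'.ker s) k ; r , q' = Equivalence.to (eq' _) q in
         r , Equivalence.from (glue-setʳ s f≢ r) (t , Equivalence.to (rep _) p , q'))
      (λ (r , k) → let t , p , q = Equivalence.to (glue-setʳ s f≢ r) k in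
         Equivalence.from (L'.ker s) (t , Equivalence.from (rep _) p , Equivalence.from (eq' _) (r , q))))
    where
    module L = Right g te l
    module L' = Right g' te l'

  glue-Supported : ∀ {x} → V G x → Supported x E
  glue-Supported {x} (p , q , _) {k} r = go (side k) r
    where
    go : ∀ {k} → Side {m} {n} k → x k ≢ 𝟘 → k ∈ E
    go (left i) r = ++-∈ˡ {X = ⊤ - e₁} {⊤ - e₂} (x∈p∧x≢y⇒x∈p-y ∈⊤ λ { refl → r p })
    go (right j) r = ++-∈ʳ {X = ⊤ - e₁} {⊤ - e₂} (x∈p∧x≢y⇒x∈p-y ∈⊤ λ { refl → r q })

-- A factorisation δ = Aᵀ L + R A' of the identity shows Ker A' ⊆ Im A.
resolve : ∀ {v v' n} (a : Fin v → F) (L : Matrix v n) (b : Fin v' → F) (A' : Matrix v' n) {x} i →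
  (∀ j → x j ≡ 𝟘 ⊎ a ∙ (λ w → L w j) ⊕ b ∙ (λ r → A' r j) ≡ δ i j) → Ker A' x → (λ w → L w ∙ x) ∙ a ≡ x i
resolve a L b A' {x} i h k = begin
  (λ w → L w ∙ x) ∙ a ≡⟨ ∙-comm (λ w → L w ∙ x) a ⟩
  a ∙ (λ w → L w ∙ x) ≡⟨ ⊕-identityʳ _ ⟨
  a ∙ (λ w → L w ∙ x) ⊕ 𝟘 ≡⟨ cong (a ∙ (λ w → L w ∙ x) ⊕_) (sum-zero λ r → trans (cong (b r ⊗_) (k r)) (⊗-zeroʳ (b r))) ⟨
  a ∙ (λ w → L w ∙ x) ⊕ b ∙ (λ r → A' r ∙ x) ≡⟨ cong₂ _⊕_ (∙-interchange L a x) (∙-interchange A' b x) ⟨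
  (λ j → a ∙ (λ w → L w j)) ∙ x ⊕ (λ j → b ∙ (λ r → A' r j)) ∙ x
    ≡⟨ FS.∑-distrib-+ (λ j → a ∙ (λ w → L w j) ⊗ x j) (λ j → b ∙ (λ r → A' r j) ⊗ x j) ⟨
  FS.sum (λ j → a ∙ (λ w → L w j) ⊗ x j ⊕ b ∙ (λ r → A' r j) ⊗ x j) ≡⟨ FS.sum-cong-≗ term ⟩
  δ i ∙ x ≡⟨ trans (∙-comm (δ i) x) (∙-δ x i) ⟩
  x i ∎
  where
  open ≡-Reasoning
  lem : ∀ a b c → a ⊗ c ⊕ b ⊗ c ≡ (a ⊕ b) ⊗ c
  lem = by₃
  term : ∀ j → a ∙ (λ w → L w j) ⊗ x j ⊕ b ∙ (λ r → A' r j) ⊗ x j ≡ δ i j ⊗ x j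
  term j with h j
  ... | inj₂ p = trans (lem (a ∙ (λ w → L w j)) (b ∙ (λ r → A' r j)) (x j)) (cong (_⊗ x j) p)
  ... | inj₁ p = trans (cong (λ c → a ∙ (λ w → L w j) ⊗ c ⊕ b ∙ (λ r → A' r j) ⊗ c) p)
      (trans (cong₂ _⊕_ (⊗-zeroʳ (a ∙ (λ w → L w j))) (⊗-zeroʳ (b ∙ (λ r → A' r j)))) (sym (trans (cong (δ i j ⊗_) p) (⊗-zeroʳ (δ i j)))))

-- Certificates for equality of subspaces

Im-orthogonal : ∀ {v n} {A : Matrix v n} {z : Fin n → F} → (∀ w → z ∙ A w ≡ 𝟘) → ∀ {x} → Im A x → z ∙ x ≡ 𝟘
Im-orthogonal {A = A} {z} h {x} im = trans (∙-comm z x) (Im⊥Ker {A = A} {x = z} im (λ w → trans (∙-comm (A w) z) (h w)))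

module _ {v n : ℕ} (A : Matrix v n) where

  -- Orthogonality of the rows places `Im A` in `Ker A'` and the factorisation gives the converse,
  -- so equality of the two spaces is decided by inner products of rows and columns instead of a
  -- search through vectors.
  FrameCert : ∀ {v'} → Matrix v' n → Matrix v n → Matrix n v' → Set
  FrameCert A' L R =
    (∀ e → ∃[ a ] ∃[ b ] (∀ w → w ≢ a → w ≢ b → A' w e ≡ 𝟘)) ×
    (∀ r w → A' r ∙ A w ≡ 𝟘) ×
    (∀ i j → (λ w → A w i) ∙ (λ w → L w j) ⊕ R i ∙ (λ r → A' r j) ≡ δ i j)

  FrameCert? : ∀ {v'} (A' : Matrix v' n) L R → Dec (FrameCert A' L R)
  FrameCert? A' L R =
    (all? λ e → any? λ a → any? λ b → all? λ w → ¬? (w ≟ a) →-dec ¬? (w ≟ b) →-dec A' w e ≟F 𝟘) ×-dec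
    (all? λ r → all? λ w → A' r ∙ A w ≟F 𝟘) ×-dec
    (all? λ i → all? λ j → (λ w → A w i) ∙ (λ w → L w j) ⊕ R i ∙ (λ r → A' r j) ≟F δ i j)

  frameCert⇒FrameRep : ∀ {v'} {A' : Matrix v' n} {L R} → FrameCert A' L R → FrameRep (ImS A)
  frameCert⇒FrameRep {A' = A'} {L} {R} (te , orth , ident) = _ , A' , te , λ x → mk⇔
    (λ k → (λ w → L w ∙ x) , λ i → resolve (λ w → A w i) L (R i) A' {x} i (λ j → inj₂ (ident i j)) k)
    (λ im r → Im-orthogonal {A = A} {A' r} (orth r) im)

  -- The column c completes the incidence matrix at the deleted or contracted element f; it is
  -- zero precisely for contractions.
  GraphicCert : ∀ {v'} → Fin n → Graph v' n → (Fin v' → F) → Matrix v n → Matrix n v' → Set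
  GraphicCert f g c L R =
    (∀ r → incidence g r f ≡ 𝟘) ×
    (∀ e → e ≢ f → proj₁ (g e) ≢ proj₂ (g e)) ×
    (∀ r w → set (incidence g r) f (c r) ∙ A w ≡ 𝟘) ×
    (∀ i → i ≢ f → ∀ j → j ≢ f → (λ w → A w i) ∙ (λ w → L w j) ⊕ R i ∙ (λ r → incidence g r j) ≡ δ i j)

  GraphicCert? : ∀ {v'} f (g : Graph v' n) c L R → Dec (GraphicCert f g c L R)
  GraphicCert? f g c L R =
    (all? λ r → incidence g r f ≟F 𝟘) ×-dec
    (all? λ e → ¬? (e ≟ f) →-dec ¬? (proj₁ (g e) ≟ proj₂ (g e))) ×-dec
    (all? λ r → all? λ w → set (incidence g r) f (c r) ∙ A w ≟F 𝟘) ×-dec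
    (all? λ i → ¬? (i ≟ f) →-dec all? λ j → ¬? (j ≟ f) →-dec
      (λ w → A w i) ∙ (λ w → L w j) ⊕ R i ∙ (λ r → incidence g r j) ≟F δ i j)

  module _ {v' f} {g : Graph v' n} {c L R} (cert : GraphicCert f g c L R) where
    private
      I = incidence g
      colf = proj₁ cert
      orth = proj₁ (proj₂ (proj₂ cert))
      ident = proj₂ (proj₂ (proj₂ cert))

      pot : (Fin n → F) → Fin v → F
      pot x w = L w ∙ set x f 𝟘

      pot-spec : ∀ {x} → Ker I x → ∀ i → i ≢ f → pot x ∙ (λ w → A w i) ≡ x i
      pot-spec {x} k i p = trans (resolve (λ w → A w i) L (R i) I {set x f 𝟘} i
        (λ j → case j ≟ f of λ
          { (yes refl) → inj₁ (set-same x f 𝟘)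
          ; (no q) → inj₂ (ident i p j q) })
        (λ r → trans (∙-zero-col (I r) (colf r) (λ j q → set-other x 𝟘 q)) (k r))) (set-other x 𝟘 p)

      row-set : ∀ r y → y f ≡ 𝟘 → set (I r) f (c r) ∙ y ≡ I r ∙ y
      row-set r y p = FS.sum-cong-≗ λ i → case i ≟ f of λ
        { (yes refl) → trans (cong (set (I r) f (c r) i ⊗_) p) (trans (⊗-zeroʳ (set (I r) f (c r) i)) (sym (trans (cong (I r i ⊗_) p) (⊗-zeroʳ (I r i)))))
        ; (no q) → cong (_⊗ y i) (set-other (I r) (c r) q) }

    -- The potential reproduces `x` away from `f`. At `f` the completed row `r`, orthogonal to the
    -- row space and with nonzero coefficient `c r`, forces the value zero.
    graphicDeletion : (∃[ r ] c r ≢ 𝟘) → ∀ {e} → e ≢ f → GraphicDeletion (ImS A) e f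
    graphicDeletion (r , cr) {e} e≢f = v' , g , proj₁ (proj₂ cert) e e≢f , λ x → mk⇔
      (λ k → pot x , λ i → case i ≟ f of λ
        { (yes refl) → trans (potf k) (sym (set-same x f 𝟘))
        ; (no p) → trans (pot-spec k i p) (sym (set-other x 𝟘 p)) })
      (λ im r → trans (∙-zero-col (I r) (colf r) (λ i p → sym (set-other x 𝟘 p)))
         (trans (sym (row-set r (set x f 𝟘) (set-same x f 𝟘))) (Im-orthogonal {A = A} {set (I r) f (c r)} (orth r) im)))
      where
      potf : ∀ {x} → Ker I x → pot x ∙ (λ w → A w f) ≡ 𝟘
      potf {x} k = decidable-stable (wf ≟F 𝟘) λ p → ⊗-nonzero p cr (trans (sym expand) (Im-orthogonal {A = A} {set (I r) f (c r)} (orth r) (pot x , λ _ → refl)))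
        where
        y : Fin n → F
        y i = pot x ∙ (λ w → A w i)
        wf = y f
        expand : set (I r) f (c r) ∙ y ≡ wf ⊗ c r
        expand = trans (FS.sum-cong-≗ {n} λ i → term i) (trans (FS.∑-distrib-+ (λ i → I r i ⊗ x i) (λ i → wf ⊗ c r ⊗ δ f i))
          (cong₂ _⊕_ (k r) (trans (sym (FS.*-distribˡ-sum (wf ⊗ c r) (δ f))) (trans (cong (wf ⊗ c r ⊗_) (sum-δ f)) (⊗1 (wf ⊗ c r))))))
          where
          ⊗1 : ∀ a → a ⊗ 𝟙 ≡ a
          ⊗1 = by₁
          term : ∀ i → set (I r) f (c r) i ⊗ y i ≡ I r i ⊗ x i ⊕ wf ⊗ c r ⊗ δ f i
          term i with i ≟ f
          ... | yes refl = trans (⊗-comm (c r) wf) (sym (cong₂ _⊕_ (cong (_⊗ x f) (colf r)) (trans (cong (wf ⊗ c r ⊗_) (δ-refl f)) (⊗1 (wf ⊗ c r)))))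
          ... | no q = trans (cong (I r i ⊗_) (pot-spec k i q)) (sym (trans (cong (I r i ⊗ x i ⊕_) (trans (cong (wf ⊗ c r ⊗_) (δ-≢ (q ∘ sym))) (⊗-zeroʳ (wf ⊗ c r)))) (⊕-identityʳ _)))

    graphicContraction : (∀ r → c r ≡ 𝟘) → ∀ {e} → e ≢ f → GraphicContraction (ImS A) e f
    graphicContraction c0 {e} e≢f = v' , g , proj₁ (proj₂ cert) e e≢f , λ x → mk⇔
      (λ k → pot x ∙ (λ w → A w f) , pot x , λ i → case i ≟ f of λ
        { (yes refl) → sym (set-same x f _)
        ; (no p) → trans (pot-spec k i p) (sym (set-other x _ p)) })
      (λ (s , im) r → trans (∙-zero-col (I r) (colf r) (λ i p → sym (set-other x s p)))
         (trans (∙-congˡ (set x f s) (λ i → sym (same r i))) (Im-orthogonal {A = A} {set (I r) f (c r)} (orth r) im)))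
      where
      same : ∀ r i → set (I r) f (c r) i ≡ I r i
      same r i with i ≟ f
      ... | yes refl = trans (c0 r) (sym (colf r))
      ... | no _ = refl

-- Minors of the summands

-- Vectors and matrices over 𝔽₃ are written as decimal numerals whose n digits, read from the
-- left, are the entries.
digit : ∀ n → ℕ → Fin n → ℕ
digit (suc n) k zero = (_/_ k (10 ^ n) {{ℕₚ.m^n≢0 10 n}}) % 10
digit (suc n) k (suc i) = digit n k i

residue : ℕ → F
residue 0 = 𝟘
residue 1 = 𝟙
residue _ = 𝟚

row : ∀ n → ℕ → Fin n → F
row n k i = residue (digit n k i)

matrix : ∀ {v} n → Vec ℕ v → Matrix v n
matrix n rows w = row n (lookup rows w)

-- The k-th element joins the vertices given by the k-th digits of the two numerals.
graph : ∀ v n → ℕ → ℕ → Graph (suc v) n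
graph v n tails heads e = digit n tails e mod suc v , digit n heads e mod suc v

-- `potential` and `relation` hold the two factors of the identity: the first recovers coefficients
-- from the values on a basis (for an incidence matrix, vertex potentials along a spanning tree),
-- the second corrects the remaining coordinates by rows of the new graph.
record Certificate (v n : ℕ) : Set where
  constructor cert
  field
    {order}     : ℕ
    tails heads : ℕ
    column      : ℕ
    potential   : Vec ℕ v
    relation    : Vec ℕ n

module _ {v n : ℕ} (A : Matrix v n) where
  open Certificate

  Valid : Fin n → Certificate v n → Set
  Valid f c = GraphicCert A f (graph (order c) n (tails c) (heads c)) (row (suc (order c)) (column c))
                (matrix n (potential c)) (matrix (suc (order c)) (relation c))

  Valid? : ∀ f c → Dec (Valid f c)
  Valid? f c = GraphicCert? A f (graph (order c) n (tails c) (heads c)) (row (suc (order c)) (column c))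
                (matrix n (potential c)) (matrix (suc (order c)) (relation c))

  DelCon : Fin n → Certificate v n × Certificate v n → Set
  DelCon f (d , c) = (Valid f d × ∃[ r ] row (suc (order d)) (column d) r ≢ 𝟘) ×
                     (Valid f c × ∀ r → row (suc (order c)) (column c) r ≡ 𝟘)

  DelCon? : ∀ f cs → Dec (DelCon f cs)
  DelCon? f (d , c) = (Valid? f d ×-dec any? λ r → ¬? (row (suc (order d)) (column d) r ≟F 𝟘)) ×-dec
                      (Valid? f c ×-dec all? λ r → row (suc (order c)) (column c) r ≟F 𝟘)

  certified : ∀ {v'} (A' : Matrix v' n) L R → {True (FrameCert? A A' L R)} → FrameRep (ImS A)
  certified A' L R {t} = frameCert⇒FrameRep A {A' = A'} {L} {R} (toWitness t)

  DelCon⇒Graphic : ∀ {f cs} → DelCon f cs → ∀ {e} → e ≢ f → GraphicDeletion (ImS A) e f × GraphicContraction (ImS A) e f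
  DelCon⇒Graphic {cs = d , c} ((vd , r) , (vc , z)) p =
    graphicDeletion A {R = matrix (suc (order d)) (relation d)} vd r p ,
    graphicContraction A {R = matrix (suc (order c)) (relation c)} vc z p

-- Deleting `f` from M*(H) dualises H/f, and contracting `f` dualises H without `f`. The vertices of
-- each certified graph are thus the faces of a plane graph, 7 and 6 of them for K₅ by Euler's
-- formula. For a deletion, `column` gives the coefficient of `f` in each facial cycle lifted from
-- H/f to H.
certs-K5 : Vec (Certificate 5 10 × Certificate 5 10) 10
certs-K5 =
    ( cert {order = 6} 0124053616 0031524563 1021200
      (0001000000 ∷ 2001000000 ∷ 0201000000 ∷ 0021000000 ∷ 0000000000 ∷ [])
      (0000000 ∷ 0000000 ∷ 0000000 ∷ 0000000 ∷ 1000000 ∷ 0020000 ∷ 0000200 ∷ 2020020 ∷ 0100000 ∷ 0002200 ∷ [])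
    , cert {order = 5} 0012453405 0120345132 000000
      (0001000000 ∷ 0201100000 ∷ 0201000000 ∷ 0021000000 ∷ 0000000000 ∷ [])
      (000000 ∷ 000000 ∷ 000000 ∷ 000000 ∷ 000000 ∷ 020020 ∷ 100100 ∷ 020000 ∷ 100000 ∷ 002000 ∷ []) )
  ∷ ( cert {order = 6} 0031056243 1024561536 2012100
      (0001000000 ∷ 2001000000 ∷ 0201000000 ∷ 0021000000 ∷ 0000000000 ∷ [])
      (0000000 ∷ 0000000 ∷ 0000000 ∷ 0000000 ∷ 1000000 ∷ 1010010 ∷ 0200000 ∷ 0010000 ∷ 0000100 ∷ 0001100 ∷ [])
    , cert {order = 5} 0012340535 1020413452 000000
      (0001000000 ∷ 2001000000 ∷ 2001200000 ∷ 0021000000 ∷ 0000000000 ∷ [])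
      (000000 ∷ 000000 ∷ 000000 ∷ 000000 ∷ 000000 ∷ 020000 ∷ 100000 ∷ 020020 ∷ 100100 ∷ 002000 ∷ []) )
  ∷ ( cert {order = 6} 0301605634 1204561253 2012100
      (0001000000 ∷ 2001000000 ∷ 0201000000 ∷ 0021000000 ∷ 0000000000 ∷ [])
      (0000000 ∷ 0000000 ∷ 0000000 ∷ 0000000 ∷ 0202220 ∷ 1000000 ∷ 0200000 ∷ 0020000 ∷ 0001100 ∷ 0000100 ∷ [])
    , cert {order = 5} 0102340354 1200134525 000000
      (0001000000 ∷ 2001000000 ∷ 0201000000 ∷ 2001020000 ∷ 0000000000 ∷ [])
      (000000 ∷ 000000 ∷ 000000 ∷ 000000 ∷ 020000 ∷ 000000 ∷ 100000 ∷ 010100 ∷ 002000 ∷ 100010 ∷ []) )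
  ∷ ( cert {order = 6} 0310560353 1240615624 2012100
      (0001000000 ∷ 2001000000 ∷ 0201000000 ∷ 0021000000 ∷ 0000000000 ∷ [])
      (0000000 ∷ 0000000 ∷ 0000000 ∷ 0000000 ∷ 1010010 ∷ 0200000 ∷ 1000000 ∷ 0001100 ∷ 0020000 ∷ 0000200 ∷ [])
    , cert {order = 5} 0120304535 1200143254 000000
      (1000001000 ∷ 0000001000 ∷ 1200001000 ∷ 1020001000 ∷ 0000000000 ∷ [])
      (000000 ∷ 000000 ∷ 000000 ∷ 000000 ∷ 020000 ∷ 100000 ∷ 000000 ∷ 002000 ∷ 010100 ∷ 200020 ∷ []) )
  ∷ ( cert {order = 6} 0231046253 1023051465 1000212
      (0001000000 ∷ 2001000000 ∷ 2001200000 ∷ 0021000000 ∷ 0000000000 ∷ [])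
      (0000000 ∷ 2000000 ∷ 0000000 ∷ 0000000 ∷ 0000000 ∷ 1010100 ∷ 0200000 ∷ 1010000 ∷ 1011110 ∷ 0001000 ∷ [])
    , cert {order = 5} 0312040354 1230014525 000000
      (0001000000 ∷ 2001000000 ∷ 0201000000 ∷ 0021000000 ∷ 0000000000 ∷ [])
      (000000 ∷ 000000 ∷ 000000 ∷ 000000 ∷ 000000 ∷ 020000 ∷ 100000 ∷ 000100 ∷ 002000 ∷ 110010 ∷ []) )
  ∷ ( cert {order = 6} 0231406425 1302501356 1000212
      (0001000000 ∷ 2001000000 ∷ 0201000000 ∷ 2001020000 ∷ 0000000000 ∷ [])
      (0000000 ∷ 0000000 ∷ 2000000 ∷ 0000000 ∷ 1001100 ∷ 0000000 ∷ 0200000 ∷ 2002000 ∷ 0010000 ∷ 1011110 ∷ [])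
    , cert {order = 5} 0123400545 1230104253 000000
      (0001000000 ∷ 2001000000 ∷ 0201000000 ∷ 0021000000 ∷ 0000000000 ∷ [])
      (000000 ∷ 000000 ∷ 000000 ∷ 000000 ∷ 020000 ∷ 000000 ∷ 100000 ∷ 002000 ∷ 110010 ∷ 000200 ∷ []) )
  ∷ ( cert {order = 6} 0312450341 1230560526 1200201
      (1000001000 ∷ 0000001000 ∷ 1200001000 ∷ 1020001000 ∷ 0000000000 ∷ [])
      (0000000 ∷ 0000000 ∷ 0000000 ∷ 2000000 ∷ 1010100 ∷ 1011110 ∷ 0000000 ∷ 0001000 ∷ 2020000 ∷ 0100000 ∷ [])
    , cert {order = 5} 0132400453 1203140525 000000
      (0001000000 ∷ 2001000000 ∷ 0201000000 ∷ 0021000000 ∷ 0000000000 ∷ [])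
      (000000 ∷ 000000 ∷ 000000 ∷ 000000 ∷ 020000 ∷ 100000 ∷ 000000 ∷ 110010 ∷ 002000 ∷ 000100 ∷ []) )
  ∷ ( cert {order = 6} 0213540065 1320415036 0010212
      (0001000000 ∷ 2001000000 ∷ 0201000000 ∷ 0201000200 ∷ 0000000000 ∷ [])
      (0000000 ∷ 0000000 ∷ 0020000 ∷ 0000000 ∷ 0220200 ∷ 0220000 ∷ 1000000 ∷ 0000000 ∷ 0002000 ∷ 1110110 ∷ [])
    , cert {order = 5} 0132405043 1203154025 000000
      (0001000000 ∷ 2001000000 ∷ 0201000000 ∷ 0021000000 ∷ 0000000000 ∷ [])
      (000000 ∷ 000000 ∷ 000000 ∷ 000000 ∷ 020000 ∷ 100000 ∷ 022020 ∷ 000000 ∷ 002000 ∷ 000100 ∷ []) )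
  ∷ ( cert {order = 6} 0312450606 1230514503 0021102
      (0100000010 ∷ 2100000010 ∷ 0000000010 ∷ 0120000010 ∷ 0000000000 ∷ [])
      (0000000 ∷ 0000000 ∷ 0000000 ∷ 0010000 ∷ 1010100 ∷ 0200000 ∷ 1010000 ∷ 2220220 ∷ 0000000 ∷ 0002000 ∷ [])
    , cert {order = 5} 0123450405 1230145203 000000
      (0001000000 ∷ 2001000000 ∷ 0201000000 ∷ 0021000000 ∷ 0000000000 ∷ [])
      (000000 ∷ 000000 ∷ 000000 ∷ 000000 ∷ 020000 ∷ 022020 ∷ 100000 ∷ 002000 ∷ 000000 ∷ 000200 ∷ []) )
  ∷ ( cert {order = 6} 0123450460 1230145620 0012012
      (0010000001 ∷ 2010000001 ∷ 0210000001 ∷ 0000000001 ∷ 0000000000 ∷ [])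
      (0000000 ∷ 0000000 ∷ 0000000 ∷ 0001000 ∷ 0200000 ∷ 1001010 ∷ 1001000 ∷ 1101110 ∷ 0020000 ∷ 0000000 ∷ [])
    , cert {order = 5} 0312450340 1230514520 000000
      (0001000000 ∷ 2001000000 ∷ 0201000000 ∷ 0021000000 ∷ 0000000000 ∷ [])
      (000000 ∷ 000000 ∷ 000000 ∷ 000000 ∷ 101010 ∷ 020000 ∷ 100000 ∷ 000100 ∷ 002000 ∷ 000000 ∷ []) )
  ∷ []

frame-K5 : FrameRep (ImS (incidence K5))
frame-K5 = certified (incidence K5)
  -- These rows are signed facial cycles of an embedding of K₅ in the projective plane, four
  -- triangles and two quadrilaterals: 5 - 10 + 6 = 1. Every edge lies on two faces, hence two
  -- entries per column.
  (matrix 10 (0012000001 ∷ 0102000010 ∷ 1020010000 ∷ 1200100000 ∷ 0000012210 ∷ 0000102101 ∷ []))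
  (matrix 10 (0001000000 ∷ 2001000000 ∷ 0201000000 ∷ 0021000000 ∷ 0000000000 ∷ []))
  (matrix 6 (000000 ∷ 000000 ∷ 000000 ∷ 000000 ∷ 000100 ∷ 001000 ∷ 222211 ∷ 122112 ∷ 010000 ∷ 100000 ∷ []))

valid-K5 : ∀ f → DelCon (incidence K5) f (lookup certs-K5 f)
valid-K5 = toWitness {a? = all? λ f → DelCon? (incidence K5) f (lookup certs-K5 f)} tt

certs-K33 : Vec (Certificate 6 9 × Certificate 6 9) 9
certs-K33 =
    ( cert {order = 4} 012143204 003314042 12210
      (001000000 ∷ 201100000 ∷ 201000100 ∷ 201000000 ∷ 021000000 ∷ 000000000 ∷ [])
      (00000 ∷ 00000 ∷ 00000 ∷ 00000 ∷ 02000 ∷ 00010 ∷ 00000 ∷ 10000 ∷ 00200 ∷ [])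
    , cert {order = 3} 010231302 001312230 0000
      (001000000 ∷ 021010000 ∷ 021210100 ∷ 021210000 ∷ 021000000 ∷ 000000000 ∷ [])
      (0000 ∷ 0000 ∷ 0000 ∷ 0000 ∷ 0000 ∷ 0100 ∷ 0000 ∷ 1110 ∷ 0110 ∷ []) )
  ∷ ( cert {order = 4} 003134402 102413024 21120
      (001000000 ∷ 201100000 ∷ 201000100 ∷ 201000000 ∷ 021000000 ∷ 000000000 ∷ [])
      (00000 ∷ 00000 ∷ 00000 ∷ 00000 ∷ 02000 ∷ 02020 ∷ 00000 ∷ 10000 ∷ 10100 ∷ [])
    , cert {order = 3} 001123230 100231023 0000
      (001000000 ∷ 201100000 ∷ 201000100 ∷ 201000000 ∷ 201120000 ∷ 000000000 ∷ [])
      (0000 ∷ 0000 ∷ 0000 ∷ 0000 ∷ 0000 ∷ 0200 ∷ 0000 ∷ 0020 ∷ 1000 ∷ []) )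
  ∷ ( cert {order = 4} 030143420 120431042 21120
      (001000000 ∷ 201100000 ∷ 201000100 ∷ 201000000 ∷ 021000000 ∷ 000000000 ∷ [])
      (00000 ∷ 00000 ∷ 00000 ∷ 00000 ∷ 02020 ∷ 02000 ∷ 00000 ∷ 10100 ∷ 10000 ∷ [])
    , cert {order = 3} 010132203 100213032 0000
      (100201000 ∷ 000001000 ∷ 000201100 ∷ 000201000 ∷ 120201000 ∷ 000000000 ∷ [])
      (0000 ∷ 0000 ∷ 0000 ∷ 0000 ∷ 0200 ∷ 0000 ∷ 0000 ∷ 1000 ∷ 0020 ∷ []) )
  ∷ ( cert {order = 4} 012030324 120014432 21021
      (001000000 ∷ 201100000 ∷ 201000100 ∷ 201000000 ∷ 021000000 ∷ 000000000 ∷ [])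
      (00000 ∷ 00000 ∷ 00000 ∷ 00000 ∷ 02000 ∷ 10000 ∷ 00000 ∷ 02020 ∷ 02220 ∷ [])
    , cert {order = 3} 012023130 120032013 0000
      (001000000 ∷ 021010000 ∷ 201000100 ∷ 201000000 ∷ 021000000 ∷ 000000000 ∷ [])
      (0000 ∷ 0000 ∷ 0000 ∷ 0000 ∷ 0000 ∷ 0020 ∷ 0000 ∷ 0200 ∷ 1000 ∷ []) )
  ∷ ( cert {order = 4} 021302134 102004341 10221
      (001000000 ∷ 021010000 ∷ 201000100 ∷ 201000000 ∷ 021000000 ∷ 000000000 ∷ [])
      (00000 ∷ 00000 ∷ 00000 ∷ 20000 ∷ 00000 ∷ 00100 ∷ 00000 ∷ 10010 ∷ 02000 ∷ [])
    , cert {order = 3} 021103302 102301023 0000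
      (001000000 ∷ 201100000 ∷ 201000100 ∷ 201000000 ∷ 021000000 ∷ 000000000 ∷ [])
      (0000 ∷ 0000 ∷ 0000 ∷ 0000 ∷ 0000 ∷ 0200 ∷ 0000 ∷ 1000 ∷ 1010 ∷ []) )
  ∷ ( cert {order = 4} 012320143 120040314 10221
      (001000000 ∷ 000001000 ∷ 201000100 ∷ 201000000 ∷ 021000000 ∷ 000000000 ∷ [])
      (00000 ∷ 00000 ∷ 00000 ∷ 20000 ∷ 00100 ∷ 00000 ∷ 00000 ∷ 02000 ∷ 10010 ∷ [])
    , cert {order = 3} 012130320 120310032 0000
      (001000000 ∷ 201100000 ∷ 201000100 ∷ 201000000 ∷ 021000000 ∷ 000000000 ∷ [])
      (0000 ∷ 0000 ∷ 0000 ∷ 0000 ∷ 0200 ∷ 0000 ∷ 0000 ∷ 1010 ∷ 1000 ∷ []) )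
  ∷ ( cert {order = 4} 012423040 120342013 21012
      (001000000 ∷ 201100000 ∷ 201000100 ∷ 201000000 ∷ 021000000 ∷ 000000000 ∷ [])
      (00000 ∷ 00000 ∷ 00000 ∷ 00000 ∷ 10110 ∷ 10010 ∷ 00000 ∷ 02000 ∷ 10000 ∷ [])
    , cert {order = 3} 012130023 120013032 0000
      (001000000 ∷ 201100000 ∷ 021000010 ∷ 201000000 ∷ 021000000 ∷ 000000000 ∷ [])
      (0000 ∷ 0000 ∷ 0000 ∷ 0000 ∷ 0200 ∷ 1000 ∷ 0000 ∷ 0000 ∷ 0020 ∷ []) )
  ∷ ( cert {order = 4} 021134302 102341004 10221
      (001000000 ∷ 201100000 ∷ 021000010 ∷ 201000000 ∷ 021000000 ∷ 000000000 ∷ [])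
      (00000 ∷ 00000 ∷ 00000 ∷ 00000 ∷ 10010 ∷ 02000 ∷ 20000 ∷ 00000 ∷ 00100 ∷ [])
    , cert {order = 3} 012123300 120312003 0000
      (001000000 ∷ 201100000 ∷ 201000100 ∷ 201000000 ∷ 021000000 ∷ 000000000 ∷ [])
      (0000 ∷ 0000 ∷ 0000 ∷ 0000 ∷ 0200 ∷ 0220 ∷ 0000 ∷ 0000 ∷ 1000 ∷ []) )
  ∷ ( cert {order = 4} 012143320 120314040 10221
      (001000000 ∷ 201100000 ∷ 000000001 ∷ 201000000 ∷ 021000000 ∷ 000000000 ∷ [])
      (00000 ∷ 00000 ∷ 00000 ∷ 00000 ∷ 02000 ∷ 10010 ∷ 20000 ∷ 00100 ∷ 00000 ∷ [])
    , cert {order = 3} 021132300 102321030 0000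
      (001000000 ∷ 201100000 ∷ 201000100 ∷ 201000000 ∷ 021000000 ∷ 000000000 ∷ [])
      (0000 ∷ 0000 ∷ 0000 ∷ 0000 ∷ 0220 ∷ 0200 ∷ 0000 ∷ 1000 ∷ 0000 ∷ []) )
  ∷ []

frame-K33 : FrameRep (ImS (incidence K33))
frame-K33 = certified (incidence K33)
  -- Again the faces of a projective embedding, three quadrilaterals and a hexagon: 6 - 9 + 4 = 1.
  (matrix 9 (102000201 ∷ 120210000 ∷ 000012021 ∷ 012201120 ∷ []))
  (matrix 9 (001000000 ∷ 201100000 ∷ 201000100 ∷ 201000000 ∷ 021000000 ∷ 000000000 ∷ []))
  (matrix 4 (0000 ∷ 0000 ∷ 0000 ∷ 0000 ∷ 0100 ∷ 2212 ∷ 0000 ∷ 2211 ∷ 1000 ∷ []))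

valid-K33 : ∀ f → DelCon (incidence K33) f (lookup certs-K33 f)
valid-K33 = toWitness {a? = all? λ f → DelCon? (incidence K33) f (lookup certs-K33 f)} tt

certs-K33' : Vec (Certificate 6 10 × Certificate 6 10) 9
certs-K33' =
    ( cert {order = 5} 0121532053 0034150524 122010
      (0010000000 ∷ 2011000000 ∷ 2010001000 ∷ 2010000000 ∷ 0210000000 ∷ 0000000000 ∷ [])
      (000000 ∷ 000000 ∷ 000000 ∷ 000000 ∷ 020000 ∷ 000110 ∷ 000000 ∷ 100000 ∷ 002000 ∷ 000020 ∷ [])
    , cert {order = 4} 0124033410 0013424132 00000
      (0010000000 ∷ 0210100000 ∷ 0212101000 ∷ 0212100000 ∷ 0210000000 ∷ 0000000000 ∷ [])
      (00000 ∷ 00000 ∷ 00000 ∷ 00000 ∷ 00000 ∷ 20200 ∷ 00000 ∷ 22220 ∷ 20220 ∷ 10000 ∷ []) )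
  ∷ ( cert {order = 5} 1030344120 0024531245 021201
      (0010000000 ∷ 2011000000 ∷ 2010001000 ∷ 2010000000 ∷ 0210000000 ∷ 0000000000 ∷ [])
      (000000 ∷ 000000 ∷ 000000 ∷ 000000 ∷ 011110 ∷ 011010 ∷ 000000 ∷ 010000 ∷ 011000 ∷ 100000 ∷ [])
    , cert {order = 4} 1020343410 0013421342 00000
      (0010000000 ∷ 2011000000 ∷ 2010001000 ∷ 2010000000 ∷ 2011200000 ∷ 0000000000 ∷ [])
      (00000 ∷ 00000 ∷ 00000 ∷ 00000 ∷ 00000 ∷ 20200 ∷ 00000 ∷ 00020 ∷ 01000 ∷ 10000 ∷ []) )
  ∷ ( cert {order = 5} 1300434210 0204351425 021201
      (0010000000 ∷ 2011000000 ∷ 2010001000 ∷ 2010000000 ∷ 0210000000 ∷ 0000000000 ∷ [])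
      (000000 ∷ 000000 ∷ 000000 ∷ 000000 ∷ 011010 ∷ 011110 ∷ 000000 ∷ 011000 ∷ 010000 ∷ 100000 ∷ [])
    , cert {order = 4} 1200433140 0103241432 00000
      (1002010000 ∷ 0000010000 ∷ 0002011000 ∷ 0002010000 ∷ 1202010000 ∷ 0000000000 ∷ [])
      (00000 ∷ 00000 ∷ 00000 ∷ 00000 ∷ 20200 ∷ 00000 ∷ 00000 ∷ 01000 ∷ 00020 ∷ 10000 ∷ []) )
  ∷ ( cert {order = 5} 1230414350 0310255432 120021
      (0010000000 ∷ 2011000000 ∷ 2010001000 ∷ 2010000000 ∷ 0210000000 ∷ 0000000000 ∷ [])
      (000000 ∷ 000000 ∷ 000000 ∷ 000000 ∷ 202000 ∷ 010000 ∷ 000000 ∷ 202020 ∷ 202220 ∷ 100000 ∷ [])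
    , cert {order = 4} 0130241402 1200430143 00000
      (0010000000 ∷ 0210100000 ∷ 2010001000 ∷ 2010000000 ∷ 0210000000 ∷ 0000000000 ∷ [])
      (00000 ∷ 00000 ∷ 00000 ∷ 00000 ∷ 00000 ∷ 00220 ∷ 00000 ∷ 02000 ∷ 10000 ∷ 00100 ∷ []) )
  ∷ ( cert {order = 5} 1230054510 0314031452 002112
      (0010000000 ∷ 0210100000 ∷ 2010001000 ∷ 2010000000 ∷ 0210000000 ∷ 0000000000 ∷ [])
      (000000 ∷ 000000 ∷ 000000 ∷ 101000 ∷ 000000 ∷ 000200 ∷ 000000 ∷ 202020 ∷ 010000 ∷ 002000 ∷ [])
    , cert {order = 4} 1230044120 0124031243 00000
      (0010000000 ∷ 2011000000 ∷ 2010001000 ∷ 2010000000 ∷ 0210000000 ∷ 0000000000 ∷ [])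
      (00000 ∷ 00000 ∷ 00000 ∷ 00000 ∷ 00000 ∷ 20020 ∷ 00000 ∷ 01000 ∷ 01100 ∷ 10000 ∷ []) )
  ∷ ( cert {order = 5} 1230504150 0124201543 001212
      (0010000000 ∷ 0000010000 ∷ 2010001000 ∷ 2010000000 ∷ 0210000000 ∷ 0000000000 ∷ [])
      (000000 ∷ 000000 ∷ 000000 ∷ 100100 ∷ 002000 ∷ 000000 ∷ 000000 ∷ 010000 ∷ 200220 ∷ 000200 ∷ [])
    , cert {order = 4} 1230404310 0314201432 00000
      (0010000000 ∷ 2011000000 ∷ 2010001000 ∷ 2010000000 ∷ 0210000000 ∷ 0000000000 ∷ [])
      (00000 ∷ 00000 ∷ 00000 ∷ 00000 ∷ 20200 ∷ 00000 ∷ 00000 ∷ 01010 ∷ 01000 ∷ 10000 ∷ []) )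
  ∷ ( cert {order = 5} 0135240502 1204530143 210012
      (0010000000 ∷ 2011000000 ∷ 2010001000 ∷ 2010000000 ∷ 0210000000 ∷ 0000000000 ∷ [])
      (000000 ∷ 000000 ∷ 000000 ∷ 000000 ∷ 101110 ∷ 100010 ∷ 000000 ∷ 020000 ∷ 100000 ∷ 200220 ∷ [])
    , cert {order = 4} 1230410340 0311240432 00000
      (0010000000 ∷ 2011000000 ∷ 0210000100 ∷ 2010000000 ∷ 0210000000 ∷ 0000000000 ∷ [])
      (00000 ∷ 00000 ∷ 00000 ∷ 00000 ∷ 20200 ∷ 01000 ∷ 00000 ∷ 00000 ∷ 00020 ∷ 10000 ∷ []) )
  ∷ ( cert {order = 5} 1230454020 0124531053 012021
      (0010000000 ∷ 2011000000 ∷ 0210000100 ∷ 2010000000 ∷ 0210000000 ∷ 0000000000 ∷ [])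
      (000000 ∷ 000000 ∷ 000000 ∷ 000000 ∷ 010010 ∷ 200200 ∷ 020000 ∷ 000000 ∷ 001000 ∷ 100000 ∷ [])
    , cert {order = 4} 1230344010 0314231042 00000
      (0010000000 ∷ 2011000000 ∷ 2010001000 ∷ 2010000000 ∷ 0210000000 ∷ 0000000000 ∷ [])
      (00000 ∷ 00000 ∷ 00000 ∷ 00000 ∷ 20200 ∷ 20220 ∷ 00000 ∷ 00000 ∷ 01000 ∷ 10000 ∷ []) )
  ∷ ( cert {order = 5} 1320544200 0214351503 012021
      (0010000000 ∷ 2011000000 ∷ 0000000010 ∷ 2010000000 ∷ 0210000000 ∷ 0000000000 ∷ [])
      (000000 ∷ 000000 ∷ 000000 ∷ 000000 ∷ 200200 ∷ 010010 ∷ 020000 ∷ 001000 ∷ 000000 ∷ 100000 ∷ [])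
    , cert {order = 4} 1230424100 0124231403 00000
      (0010000000 ∷ 2011000000 ∷ 2010001000 ∷ 2010000000 ∷ 0210000000 ∷ 0000000000 ∷ [])
      (00000 ∷ 00000 ∷ 00000 ∷ 00000 ∷ 20220 ∷ 20020 ∷ 00000 ∷ 01000 ∷ 00000 ∷ 10000 ∷ []) )
  ∷ []

frame-K33' : FrameRep (ImS (incidence K33'))
frame-K33' = certified (incidence K33')
  -- Two triangles on `e'`, two quadrilaterals and a hexagon, the faces of a projective embedding
  -- with 6 - 10 + 5 = 1.
  (matrix 10 (2001000001 ∷ 0020010001 ∷ 1200002100 ∷ 0000120210 ∷ 0212101020 ∷ []))
  (matrix 10 (0010000000 ∷ 2011000000 ∷ 2010001000 ∷ 2010000000 ∷ 0210000000 ∷ 0000000000 ∷ []))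
  (matrix 5 (00000 ∷ 00000 ∷ 00000 ∷ 00000 ∷ 12222 ∷ 21000 ∷ 00000 ∷ 00100 ∷ 12221 ∷ 10000 ∷ []))

valid-K33' : ∀ f → DelCon (incidence K33') (f ↑ˡ 1) (lookup certs-K33' f)
valid-K33' = toWitness {a? = all? λ f → DelCon? (incidence K33') (f ↑ˡ 1) (lookup certs-K33' f)} tt

-- A generator matrix of the tetracode, all of whose nonzero words have weight 3. The code is
-- self-dual, so cocircuits have three elements as well.
A-U24 : Matrix 2 4
A-U24 = matrix 4 (1110 ∷ 0121 ∷ [])

certs-U24 : Vec (Certificate 2 4 × Certificate 2 4) 4
certs-U24 =
    ( cert {order = 2} 0110 0022 111
      (1000 ∷ 2100 ∷ [])
      (000 ∷ 000 ∷ 010 ∷ 100 ∷ [])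
    , cert {order = 1} 0101 0010 00
      (0220 ∷ 0210 ∷ [])
      (00 ∷ 00 ∷ 00 ∷ 20 ∷ []) )
  ∷ ( cert {order = 2} 0020 1012 222
      (1000 ∷ 2100 ∷ [])
      (000 ∷ 000 ∷ 020 ∷ 100 ∷ [])
    , cert {order = 1} 1000 0011 00
      (1000 ∷ 1020 ∷ [])
      (00 ∷ 00 ∷ 00 ∷ 10 ∷ []) )
  ∷ ( cert {order = 2} 0001 1202 111
      (1000 ∷ 1020 ∷ [])
      (000 ∷ 100 ∷ 000 ∷ 010 ∷ [])
    , cert {order = 1} 0100 1001 00
      (1000 ∷ 2100 ∷ [])
      (00 ∷ 00 ∷ 00 ∷ 10 ∷ []) )
  ∷ ( cert {order = 2} 0210 1020 111
      (1000 ∷ 0001 ∷ [])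
      (000 ∷ 200 ∷ 010 ∷ 000 ∷ [])
    , cert {order = 1} 0000 1110 00
      (1000 ∷ 2100 ∷ [])
      (00 ∷ 00 ∷ 10 ∷ 00 ∷ []) )
  ∷ []

frame-U24 : FrameRep (ImS A-U24)
frame-U24 = certified A-U24
  (matrix 4 (1201 ∷ 1110 ∷ []))
  (matrix 4 (1000 ∷ 2100 ∷ []))
  (matrix 2 (00 ∷ 00 ∷ 01 ∷ 10 ∷ []))

valid-U24 : ∀ f → DelCon A-U24 f (lookup certs-U24 f)
valid-U24 = toWitness {a? = all? λ f → DelCon? A-U24 f (lookup certs-U24 f)} tt

-- Stars in a biased graph

⟦_⟧ : Bool → ℕ
⟦ true ⟧ = 1
⟦ false ⟧ = 0

sum-mono₃ : ∀ {n} {f a b c : Fin n → ℕ} → (∀ w → f w ≤ a w + b w + c w) →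
  NS.sum f ≤ NS.sum a + NS.sum b + NS.sum c
sum-mono₃ {a = a} {b} {c} h = ≤-trans (sum-mono h) (≤-reflexive
  (trans (NS.∑-distrib-+ (λ w → a w + b w) c) (cong (_+ NS.sum c) (NS.∑-distrib-+ a b))))

sum-* : ∀ {n} k (f : Fin n → ℕ) → NS.sum (λ i → k * f i) ≡ k * NS.sum f
sum-* k f = sym (NS.*-distribˡ-sum k f)

-- The stars S w of the vertices w of a biased graph, restricted to one side of a 2-sum with
-- basepoint e; the flag σ w tells whether the star of w also meets the other side.
module Stars {v n V : ℕ} (A : Matrix v n) (e : Fin n) (c p : ℕ)
  (big-avoid : ∀ {Z} → MinDep (KerS A) Z → e ∉ Z → c ≤ ∣ Z ∣)
  (big-through : ∀ {Z} → MinDep (KerS A) Z → e ∈ Z → suc p ≤ ∣ Z ∣)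
  (S : Fin V → Subset n) (e∉S : ∀ w → e ∉ S w) (σ : Fin V → Bool)
  (σ-nonempty : ∀ w → σ w ≡ true → Nonempty (S w))
  (cover : ∀ j → NS.sum (λ w → χ (S w) j) ≤ 2)
  (hit-inner : ∀ {w j K} → σ w ≡ false → j ∈ S w → MinDep (ImS A) K → j ∈ K → (∀ {i} → i ∈ K → i ∈ S w → i ≡ j) → ⊥)
  (hit-shared : ∀ {w j K} → j ∈ S w → MinDep (ImS A) K → j ∈ K → e ∉ K → (∀ {i} → i ∈ K → i ∈ S w → i ≡ j) → ⊥)
  (hit-single : ∀ {w K} → NS.sum (λ w → ⟦ σ w ⟧) ≡ 1 → σ w ≡ true → MinDep (ImS A) K → e ∈ K → (∀ {i} → i ∈ K → i ∉ S w) → ⊥)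
  where

  data Choice (w : Fin V) : Set where
    none    : σ w ≡ false → ¬ Nonempty (S w) → Choice w
    inner   : ∀ Z → σ w ≡ false → MinDep (KerS A) Z → Z ⊆ S w → Choice w
    through : ∀ Z → σ w ≡ true → MinDep (KerS A) Z → e ∈ Z → Z ⊆ S w ∪ ⁅ e ⁆ → Choice w
    avoid   : ∀ Z → σ w ≡ true → NS.sum (λ w → ⟦ σ w ⟧) ≢ 1 → MinDep (KerS A) Z → Z ⊆ S w → Choice w

  private
    co-vec : ∀ {z j} → Im A z → z j ≢ 𝟘 → ∃[ K ] (K ⊆ supp z × j ∈ K × MinDep (ImS A) K)
    co-vec {z} {j} im zj = DepAt⇒MinDep (ImS A) {j} {supp z} (z , im , ∈sel⁺ (λ i → ¬? (z i ≟F 𝟘)) , zj)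

    nz : ∀ (z : Fin n → F) {i} → i ∈ supp z → z i ≢ 𝟘
    nz z = ∈sel⁻ (λ i → ¬? (z i ≟F 𝟘))

    -- Circuits of the summand are minimal supports of `Im`, cocircuits those of `Ker`. By
    -- `alternative`, either `j` lies in a cocircuit inside `T`, or a circuit meets `T` in `j`
    -- alone, which `h` forbids.
    star-cycle : ∀ {w j} → j ∈ S w → (T : Subset n) → S w ⊆ T →
      (∀ {K} → MinDep (ImS A) K → j ∈ K → (∀ {i} → i ∈ K → i ∈ T → i ≡ j) → ⊥) →
      ∃[ Z ] (Z ⊆ T × j ∈ Z × MinDep (KerS A) Z)
    star-cycle {w} {j} jS T s h with alternative A (T - j) (λ q → proj₂ (∈-⁻ {p = T} q) refl)
    ... | inj₁ d = let Z , sZ , jZ , m = DepAt⇒MinDep (KerS A) d in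
          Z , (λ r → [ (λ q → proj₁ (∈-⁻ q)) , (λ q → subst (_∈ T) (sym (x∈⁅y⁆⇒x≡y j q)) (s jS)) ]′ (x∈p∪q⁻ (T - j) ⁅ j ⁆ (sZ r))) , jZ , m
    ... | inj₂ (z , im , z0 , zj) = let K , sK , jK , m = co-vec im zj in
          ⊥-elim (h m jK λ {i} iK iT → decidable-stable (i ≟ j) λ q → nz z (sK iK) (z0 (x∈p∧x≢y⇒x∈p-y iT q)))

    through-cycle : ∀ {w} → (∀ {K} → MinDep (ImS A) K → e ∈ K → (∀ {i} → i ∈ K → i ∉ S w) → ⊥) →
      ∃[ Z ] (Z ⊆ S w ∪ ⁅ e ⁆ × e ∈ Z × MinDep (KerS A) Z)
    through-cycle {w} h with alternative A (S w) (e∉S w)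
    ... | inj₁ d = DepAt⇒MinDep (KerS A) d
    ... | inj₂ (z , im , z0 , ze) = let K , sK , eK , m = co-vec im ze in ⊥-elim (h m eK λ iK iS → nz z (sK iK) (z0 iS))

    -- With a single shared vertex the cocircuit has to be taken through `e`: the values `kx = 0`
    -- and `kz = 1` would satisfy all size bounds for K₅ and for K₃,₃.
    shared : ∀ {w} → σ w ≡ true → Dec (NS.sum (λ w → ⟦ σ w ⟧) ≡ 1) → Choice w
    shared {w} q (yes one) = let Z , s , eZ , m = through-cycle (hit-single one q) in through Z q m eZ s
    shared {w} q (no many) with star-cycle (proj₂ (σ-nonempty w q)) (S w ∪ ⁅ e ⁆) (x∈p∪q⁺ ∘ inj₁)
             (λ m jK h → hit-shared (proj₂ (σ-nonempty w q)) m jK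
                (λ eK → e∉S w (subst (_∈ S w) (sym (h eK (x∈p∪q⁺ {p = S w} (inj₂ (x∈⁅x⁆ e))))) (proj₂ (σ-nonempty w q))))
                (λ iK iS → h iK (x∈p∪q⁺ (inj₁ iS))))
    ... | Z , s , jZ , m with e ∈? Z
    ...   | yes eZ = through Z q m eZ s
    ...   | no eZ = avoid Z q many m λ r → [ id , (λ t → contradiction (subst (_∈ Z) (x∈⁅y⁆⇒x≡y e t) r) eZ) ]′ (x∈p∪q⁻ (S w) ⁅ e ⁆ (s r))

  abstract
    choice : ∀ w → Choice w
    choice w with σ w in q | nonempty? (S w)
    ... | false | no ne = none q ne
    ... | false | yes (j , jS) = let Z , s , _ , m = star-cycle jS (S w) ⊆-refl (λ m jK h → hit-inner q jS m jK h) in inner Z q m s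
    ... | true | _ = shared q (NS.sum (λ w → ⟦ σ w ⟧) ℕₚ.≟ 1)

  part : ∀ {w} → Choice w → Subset n
  part (none _ _) = ∅
  part (inner Z _ _ _) = Z
  part (through Z _ _ _ _) = Z - e
  part (avoid Z _ _ _ _) = Z

  tᵢ kₓ kₐ : ∀ {w} → Choice w → ℕ
  tᵢ (inner _ _ _ _) = 1
  tᵢ _ = 0
  kₓ (through _ _ _ _ _) = 1
  kₓ _ = 0
  kₐ (avoid _ _ _ _ _) = 1
  kₐ _ = 0

  part⊆S : ∀ {w} (x : Choice w) → part x ⊆ S w
  part⊆S (none _ _) r = ⊥-elim (∉⊥ r)
  part⊆S (inner Z _ _ s) r = s r
  part⊆S {w} (through Z _ _ _ s) r = let a , b = ∈-⁻ {p = Z} r in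
    [ id , (λ q → contradiction (x∈⁅y⁆⇒x≡y e q) b) ]′ (x∈p∪q⁻ (S w) ⁅ e ⁆ (s a))
  part⊆S (avoid Z _ _ _ s) r = s r

  part-size : ∀ {w} (x : Choice w) → c * tᵢ x + p * kₓ x + c * kₐ x ≤ ∣ part x ∣
  part-size (none _ _) = ≤-trans (≤-reflexive (cong₂ _+_ (cong₂ _+_ (*-zeroʳ c) (*-zeroʳ p)) (*-zeroʳ c))) z≤n
  part-size {w} (inner Z _ m s) = ≤-trans (≤-reflexive (trans (cong₂ _+_ (cong₂ _+_ (*-identityʳ c) (*-zeroʳ p)) (*-zeroʳ c)) (trans (+-identityʳ _) (+-identityʳ c))))
    (big-avoid m λ r → e∉S w (s r))
  part-size (through Z _ m eZ _) = ≤-trans (≤-reflexive (trans (cong₂ _+_ (cong₂ _+_ (*-zeroʳ c) (*-identityʳ p)) (*-zeroʳ c)) (+-identityʳ p)))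
    (≤-pred (≤-trans (big-through m eZ) (≤-reflexive (∣∣-remove eZ))))
  part-size {w} (avoid Z _ _ m s) = ≤-trans (≤-reflexive (cong₂ _+_ (cong₂ _+_ (*-zeroʳ c) (*-zeroʳ p)) (*-identityʳ c)))
    (big-avoid m λ r → e∉S w (s r))

  T : Fin V → Subset n
  T w = part (choice w)

  t kx kz : ℕ
  t = NS.sum (λ w → tᵢ (choice w))
  kx = NS.sum (λ w → kₓ (choice w))
  kz = NS.sum (λ w → kₐ (choice w))

  kx+kz : kx + kz ≡ NS.sum (λ w → ⟦ σ w ⟧)
  kx+kz = trans (sym (NS.∑-distrib-+ (λ w → kₓ (choice w)) (λ w → kₐ (choice w)))) (NS.sum-cong-≗ λ w → lem (choice w))
    where
    lem : ∀ {w} (x : Choice w) → kₓ x + kₐ x ≡ ⟦ σ w ⟧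
    lem (none q _) = cong ⟦_⟧ (sym q)
    lem (inner _ q _ _) = cong ⟦_⟧ (sym q)
    lem (through _ q _ _ _) = cong ⟦_⟧ (sym q)
    lem (avoid _ q _ _ _) = cong ⟦_⟧ (sym q)

  single⇒kz≡0 : NS.sum (λ w → ⟦ σ w ⟧) ≡ 1 → kz ≡ 0
  single⇒kz≡0 q = sum≡0⁺ λ w → lem (choice w)
    where
    lem : ∀ {w} (x : Choice w) → kₐ x ≡ 0
    lem (none _ _) = refl
    lem (inner _ _ _ _) = refl
    lem (through _ _ _ _ _) = refl
    lem (avoid _ _ r _ _) = contradiction q r

  inner-count : ∀ w → σ w ≡ false → Nonempty (S w) → tᵢ (choice w) ≡ 1
  inner-count w q ne = lem (choice w)
    where
    lem : (x : Choice w) → tᵢ x ≡ 1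
    lem (none _ r) = contradiction ne r
    lem (inner _ _ _ _) = refl
    lem (through _ r _ _ _) = contradiction (trans (sym q) r) λ ()
    lem (avoid _ r _ _ _) = contradiction (trans (sym q) r) λ ()

  count missing : Fin n → ℕ
  count j = NS.sum (λ w → χ (T w) j)
  -- The basepoint lies in no star. Its two incidences are not counted as missing but appear as the
  -- summand 2 in `total`.
  missing j = if does (e ≟ j) then 0 else 2 ∸ count j

  χ-mono : ∀ {X Y : Subset n} → X ⊆ Y → ∀ j → χ X j ≤ χ Y j
  χ-mono {X} {Y} s j with j ∈? X
  ... | yes q = ≤-reflexive (sym (χ-∈ (s q)))
  ... | no _ = z≤n

  count+missing : ∀ j → count j + missing j + 2 * pt e j ≡ 2
  count+missing j with e ≟ j
  ... | yes refl = cong (λ a → a + 0 + 2) (sum≡0⁺ λ w → χ-∉ {X = T w} λ r → e∉S w (part⊆S (choice w) r))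
  ... | no _ = trans (+-identityʳ _) (m+[n∸m]≡n (≤-trans (sum-mono λ w → χ-mono (part⊆S (choice w)) j) (cover j)))

  M : ℕ
  M = NS.sum missing

  sum-count : NS.sum (λ w → ∣ T w ∣) ≡ NS.sum count
  sum-count = trans (NS.sum-cong-≗ λ w → ∣∣-χ (T w)) (NS.∑-comm (λ w j → χ (T w) j))

  total : c * t + p * kx + c * kz + M + 2 ≤ 2 * n
  total = begin
    c * t + p * kx + c * kz + M + 2 ≤⟨ +-monoˡ-≤ 2 (+-monoˡ-≤ M weights) ⟩
    NS.sum count + M + 2 ≡⟨ cong (NS.sum count + M +_) (trans (cong (2 *_) (sym (sum-pt e))) (sym (sum-* 2 (pt e)))) ⟩
    NS.sum count + M + NS.sum (λ j → 2 * pt e j) ≡⟨ cong (_+ NS.sum (λ j → 2 * pt e j)) (sym (NS.∑-distrib-+ count missing)) ⟩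
    NS.sum (λ j → count j + missing j) + NS.sum (λ j → 2 * pt e j) ≡⟨ NS.∑-distrib-+ (λ j → count j + missing j) (λ j → 2 * pt e j) ⟨
    NS.sum (λ j → count j + missing j + 2 * pt e j) ≡⟨ NS.sum-cong-≗ count+missing ⟩
    NS.sum {n} (λ j → 2) ≡⟨ constant n ⟩
    2 * n ∎
    where
    open ≤-Reasoning
    constant : ∀ m → NS.sum {m} (λ j → 2) ≡ 2 * m
    constant zero = refl
    constant (suc m) = trans (cong (2 +_) (constant m)) (sym (*-suc 2 m))
    weights : c * t + p * kx + c * kz ≤ NS.sum count
    weights = ≤-trans (≤-reflexive (sym (trans
        (NS.∑-distrib-+ (λ w → c * tᵢ (choice w) + p * kₓ (choice w)) (λ w → c * kₐ (choice w)))
        (cong₂ _+_ (trans (NS.∑-distrib-+ (λ w → c * tᵢ (choice w)) (λ w → p * kₓ (choice w)))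
          (cong₂ _+_ (sum-* c (λ w → tᵢ (choice w))) (sum-* p (λ w → kₓ (choice w))))) (sum-* c (λ w → kₐ (choice w)))))))
      (≤-trans (sum-mono λ w → part-size (choice w)) (≤-reflexive sum-count))

  -- When A is the incidence matrix of a graph, every chosen part is a cycle, or a cycle through e
  -- minus e. The degrees at an end a of e then force an uncovered incidence at a when the
  -- number of cycles through e is odd.
  module Parity (g : Graph v n) (cographic : ∀ {Z} → MinDep (KerS A) Z → MinDep (KerS (incidence g)) Z)
    (link : proj₁ (g e) ≢ proj₂ (g e))
    (simple : ∀ j → j ≢ e → ends-at g j (proj₁ (g e)) + ends-at g j (proj₂ (g e)) ≤ 1) where

    private
      halves : ∀ {a} → ends-at g e a ≡ 1 → ∀ {w} (x : Choice w) → ∃[ h ] deg g (part x) a ≡ kₓ x + 2 * h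
      halves q (none _ _) = 0 , deg-∅ g _
      halves {a} q (inner Z _ m _) = sg (deg g Z a) , half (proj₂ (proj₂ (MinDep⇒Cycle g (cographic m))) a)
      halves {a} q (avoid Z _ _ m _) = sg (deg g Z a) , half (proj₂ (proj₂ (MinDep⇒Cycle g (cographic m))) a)
      -- The cycle has degree 2 at `a`, of which `e` accounts for one, so exactly one is left in the
      -- part.
      halves {a} q (through Z _ m eZ _) = 0 , minus 1 1 (deg-─ g (⁅⁆⊆ eZ) a) degZ deg-e
        where
        deg-e : deg g ⁅ e ⁆ a ≡ 1
        deg-e = trans (deg-sum g ⁅ e ⁆ a) (trans (NS.sum-cong-≗ term) (sum-pt e))
          where
          term : ∀ j → χ ⁅ e ⁆ j * ends-at g j a ≡ pt e j
          term j with e ≟ j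
          ... | yes refl = trans (cong (_* ends-at g e a) (χ-∈ (x∈⁅x⁆ e))) (trans (+-identityʳ _) q)
          ... | no r = cong (_* ends-at g j a) (χ-∉ {X = ⁅ e ⁆} λ s → r (sym (x∈⁅y⁆⇒x≡y e s)))
        degZ : deg g Z a ≡ 2
        degZ = two (proj₂ (proj₂ (MinDep⇒Cycle g (cographic m))) a) (≤-trans (≤-reflexive (sym q)) (ends≤deg g eZ a))

    -- The degrees of the parts at `a` add up to `kx` plus an even number, which is odd. If all
    -- elements at `a` other than `e` were covered twice, the sum would be even.
    uncovered-end : ∀ {a} → ends-at g e a ≡ 1 → ∀ h → kx ≡ suc (2 * h) → 1 ≤ NS.sum (λ j → ends-at g j a * missing j)
    uncovered-end {a} q h odd = n≢0⇒n>0 λ z → even≢odd full (h + H) (sym (trans (lem h H) (trans (cong (_+ 2 * H) (sym odd)) (trans (sym degrees) (trans (sym (+-identityʳ _)) (trans (cong (NS.sum (λ w → deg g (T w) a) +_) (sym z)) balance))))))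
      where
      H = NS.sum (λ w → proj₁ (halves q (choice w)))
      full = NS.sum (λ j → ends-at g j a * ⟦ not (does (e ≟ j)) ⟧)
      lem : ∀ h H → suc (2 * (h + H)) ≡ suc (2 * h) + 2 * H
      lem = solve-∀
      degrees : NS.sum (λ w → deg g (T w) a) ≡ kx + 2 * H
      degrees = trans (NS.sum-cong-≗ λ w → proj₂ (halves q (choice w)))
        (trans (NS.∑-distrib-+ (λ w → kₓ (choice w)) (λ w → 2 * proj₁ (halves q (choice w)))) (cong (kx +_) (sum-* 2 (λ w → proj₁ (halves q (choice w))))))
      column : NS.sum (λ w → deg g (T w) a) ≡ NS.sum (λ j → ends-at g j a * count j)
      column = begin
        NS.sum (λ w → deg g (T w) a) ≡⟨ NS.sum-cong-≗ (λ w → deg-sum g (T w) a) ⟩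
        NS.sum (λ w → NS.sum (λ j → χ (T w) j * ends-at g j a)) ≡⟨ NS.∑-comm (λ w j → χ (T w) j * ends-at g j a) ⟩
        NS.sum (λ j → NS.sum (λ w → χ (T w) j * ends-at g j a))
          ≡⟨ NS.sum-cong-≗ (λ j → trans (sym (NS.*-distribʳ-sum (ends-at g j a) (λ w → χ (T w) j))) (*-comm (count j) (ends-at g j a))) ⟩
        NS.sum (λ j → ends-at g j a * count j) ∎
        where open ≡-Reasoning
      balance : NS.sum (λ w → deg g (T w) a) + NS.sum (λ j → ends-at g j a * missing j) ≡ 2 * full
      balance = trans (cong (_+ NS.sum (λ j → ends-at g j a * missing j)) column)
        (trans (sym (NS.∑-distrib-+ (λ j → ends-at g j a * count j) (λ j → ends-at g j a * missing j)))
        (trans (NS.sum-cong-≗ λ j → trans (sym (*-distribˡ-+ (ends-at g j a) (count j) (missing j))) (trans (cong (ends-at g j a *_) (twice j)) (swap (ends-at g j a) ⟦ not (does (e ≟ j)) ⟧)))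
               (sum-* 2 (λ j → ends-at g j a * ⟦ not (does (e ≟ j)) ⟧))))
        where
        swap : ∀ a b → a * (2 * b) ≡ 2 * (a * b)
        swap = solve-∀
        twice : ∀ j → count j + missing j ≡ 2 * ⟦ not (does (e ≟ j)) ⟧
        twice j with e ≟ j | count+missing j
        ... | yes refl | q = +-cancelʳ-≡ 2 _ 0 q
        ... | no _ | q = trans (sym (+-identityʳ _)) q

    -- No element besides `e` meets both ends of `e`, so the incidences missing at the two ends are
    -- counted at different elements and add up.
    odd⇒2≤M : ∀ h → kx ≡ suc (2 * h) → 2 ≤ M
    odd⇒2≤M h odd = ≤-trans (+-mono-≤ (uncovered-end enda h odd) (uncovered-end endb h odd))
      (≤-trans (≤-reflexive (sym (NS.∑-distrib-+ (λ j → ends-at g j a * missing j) (λ j → ends-at g j b * missing j)))) (sum-mono each))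
      where
      a = proj₁ (g e)
      b = proj₂ (g e)
      enda : ends-at g e a ≡ 1
      enda = cong₂ _+_ (pt-refl a) (pt-≢ (link ∘ sym))
      endb : ends-at g e b ≡ 1
      endb = cong₂ _+_ (pt-≢ link) (pt-refl b)
      each : ∀ j → ends-at g j a * missing j + ends-at g j b * missing j ≤ missing j
      each j with e ≟ j
      ... | yes refl = ≤-reflexive (cong₂ _+_ (*-zeroʳ (ends-at g e a)) (*-zeroʳ (ends-at g e b)))
      ... | no q = ≤-trans (≤-reflexive (sym (*-distribʳ-+ (2 ∸ count j) (ends-at g j a) (ends-at g j b))))
            (≤-trans (*-monoˡ-≤ (2 ∸ count j) (simple j (q ∘ sym))) (≤-reflexive (+-identityʳ _)))

-- Here ν is the rank, and c and p + 1 bound the sizes of cocircuits avoiding e and through e.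
record Pointed {v n : ℕ} (A : Matrix v n) (e : Fin n) : Set where
  field
    c p ν       : ℕ
    p≤c         : p ≤ c
    big-avoid   : ∀ {Z} → MinDep (KerS A) Z → e ∉ Z → c ≤ ∣ Z ∣
    big-through : ∀ {Z} → MinDep (KerS A) Z → e ∈ Z → suc p ≤ ∣ Z ∣
    -- The inequality is strict for each summand. Together the two strict bounds use up exactly the
    -- one vertex by which the rank of the 2-sum falls short of the sum of the ranks.
    counting    : ∀ t k → 1 ≤ k → c * t + p * k + 2 ≤ 2 * n → 2 * t + k < 2 * ν
    frame       : FrameRep (ImS A)
    minors      : ∀ {f} → f ≢ e → GraphicDeletion (ImS A) e f × GraphicContraction (ImS A) e f
    independent : ∀ f → ∃[ J ] (f ∈ J × ∣ J ∣ ≡ ν × ¬ Dep (ImS A) J)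
    avoiding    : ∃[ J ] (e ∉ J × ∣ J ∣ ≡ ν × ¬ Dep (ImS A) J)
    covered     : ∃[ r ] A r e ≢ 𝟘

  loopless : ∀ f → ¬ Dep (ImS A) ⁅ f ⁆
  loopless f d = let J , fJ , _ , ind = independent f in ind (Dep-mono (ImS A) (⁅⁆⊆ fJ) d)

  circuit-through : ∃[ K ] (e ∈ K × MinDep (ImS A) K)
  circuit-through = let r , nz = covered
                        K , _ , eK , m = DepAt⇒MinDep (ImS A) {e} {⊤} ((λ i → δ r ∙ (λ w → A w i)) , (δ r , λ _ → refl) , (λ _ → ∈⊤) ,
                          λ q → nz (trans (sym (trans (∙-comm (δ r) (λ w → A w e)) (∙-δ (λ w → A w e) r))) q))
                    in K , eK , m

record Cographic {v n : ℕ} (g : Graph v n) (e : Fin n) : Set where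
  field
    pointed : Pointed (incidence g) e
    link    : proj₁ (g e) ≢ proj₂ (g e)
    simple  : ∀ j → j ≢ e → ends-at g j (proj₁ (g e)) + ends-at g j (proj₂ (g e)) ≤ 1
  open Pointed pointed public
  field
    infeasible : ∀ t kx kz M → c * t + p * kx + c * kz + M + 2 ≤ 2 * n → suc (2 * t + (kx + kz)) ≡ 2 * ν →
      (kx + kz ≡ 1 → kz ≡ 0) → (∀ h → kx ≡ suc (2 * h) → 2 ≤ M) → ⊥

-- Frame representations of a 2-sum

∣++∣ : ∀ {m n} (X : Subset m) (Y : Subset n) → ∣ X ++ Y ∣ ≡ ∣ X ∣ + ∣ Y ∣
∣++∣ [] Y = refl
∣++∣ (outside ∷ X) Y = ∣++∣ X Y
∣++∣ (inside ∷ X) Y = cong suc (∣++∣ X Y)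

module TwoSum {v₁ n₁ v₂ n₂} {A₁ : Matrix v₁ n₁} {e₁ : Fin n₁} {A₂ : Matrix v₂ n₂} {e₂ : Fin n₂}
  {Circ₁ : Subset n₁ → Set} {Circ₂ : Subset n₂ → Set}
  (rep₁ : ∀ X → Circ₁ X ⇔ MinDep (ImS A₁) X) (rep₂ : ∀ X → Circ₂ X ⇔ MinDep (ImS A₂) X)
  (S₁ : Pointed A₁ e₁) (S₂ : Pointed A₂ e₂) where

  private
    module S₁ = Pointed S₁
    module S₂ = Pointed S₂
    M₁ = mat n₁ ⊤ Circ₁
    M₂ = mat n₂ ⊤ Circ₂
    G = glue (ImS A₁) e₁ (ImS A₂) e₂

  N : Matroid
  N = twoSum M₁ e₁ M₂ e₂

  circuits : ∀ X → Circuit N X ⇔ MinDep G X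
  circuits = twoSum-circuits {M₁} {M₂} {ImS A₁} {ImS A₂} rep₁ rep₂ (S₁.loopless e₁) (S₂.loopless e₂)

  minors-frame : ∀ C D → IsProperMinorPair N C D → IsFrame (minor N C D)
  minors-frame = minors-IsFrame {N} {G} circuits (glue-Supported {W₁ = ImS A₁} {W₂ = ImS A₂}) single
    where
    single : ∀ {f} → f ∈ ground N → SingleMinors G (ground N) f
    single {f} fE with side {n₁} {n₂} f
    ... | left i = let i≢ = proj₂ (∈-⁻ {p = ⊤} (++-∈ˡ⁻ {X = ⊤ - e₁} {⊤ - e₂} fE) ) ; d , k = S₁.minors i≢ in
            single-left {W₁ = ImS A₁} {W₂ = ImS A₂} S₂.frame i≢ d k
    ... | right j = let j≢ = proj₂ (∈-⁻ {p = ⊤} (++-∈ʳ⁻ {X = ⊤ - e₁} {⊤ - e₂} fE) ) ; d , k = S₂.minors j≢ in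
            single-right {W₁ = ImS A₁} {W₂ = ImS A₂} S₁.frame j≢ d k

  left-circuit : ∀ {K} → MinDep (ImS A₁) K → e₁ ∉ K → Circuit N (K ++ ∅)
  left-circuit m q = inj₁ (_ , Equivalence.from (rep₁ _) m , q , refl)

  right-circuit : ∀ {K} → MinDep (ImS A₂) K → e₂ ∉ K → Circuit N (∅ ++ K)
  right-circuit m q = inj₂ (inj₁ (_ , Equivalence.from (rep₂ _) m , q , refl))

  crossing : ∀ {K L} → MinDep (ImS A₁) K → e₁ ∈ K → MinDep (ImS A₂) L → e₂ ∈ L → Circuit N ((K - e₁) ++ (L - e₂))
  crossing m q m' q' = inj₂ (inj₂ (_ , _ , Equivalence.from (rep₁ _) m , q , Equivalence.from (rep₂ _) m' , q' , refl))

  has-other₁ : ∀ {K} → MinDep (ImS A₁) K → e₁ ∈ K → ∃[ i ] i ∈ K - e₁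
  has-other₁ m q = let i , a , b = MinDep-other (ImS A₁) (S₁.loopless e₁) m in i , x∈p∧x≢y⇒x∈p-y a b

  has-other₂ : ∀ {K} → MinDep (ImS A₂) K → e₂ ∈ K → ∃[ i ] i ∈ K - e₂
  has-other₂ m q = let i , a , b = MinDep-other (ImS A₂) (S₂.loopless e₂) m in i , x∈p∧x≢y⇒x∈p-y a b

  no-singleton : ∀ f → ¬ Circuit N ⁅ f ⁆
  no-singleton f (inj₁ (C , c , q , eq)) = let i , iC = MinDep-nonempty (ImS A₁) (Equivalence.to (rep₁ C) c) in
    S₁.loopless i (Dep-mono (ImS A₁) (λ {i'} r → subst (_∈ ⁅ i ⁆) (same iC r) (x∈⁅x⁆ i)) (proj₁ (Equivalence.to (rep₁ C) c)))
    where
    same : ∀ {i i'} → i ∈ C → i' ∈ C → i ≡ i'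
    same {i} {i'} r r' = ↑ˡ-injective n₂ i i' (trans (x∈⁅y⁆⇒x≡y f (subst (i ↑ˡ n₂ ∈_) (sym eq) (++-∈ˡ r)))
                                     (sym (x∈⁅y⁆⇒x≡y f (subst (i' ↑ˡ n₂ ∈_) (sym eq) (++-∈ˡ r')))))
  no-singleton f (inj₂ (inj₁ (C , c , q , eq))) = let i , iC = MinDep-nonempty (ImS A₂) (Equivalence.to (rep₂ C) c) in
    S₂.loopless i (Dep-mono (ImS A₂) (λ {i'} r → subst (_∈ ⁅ i ⁆) (same iC r) (x∈⁅x⁆ i)) (proj₁ (Equivalence.to (rep₂ C) c)))
    where
    same : ∀ {i i'} → i ∈ C → i' ∈ C → i ≡ i'
    same {i} {i'} r r' = ↑ʳ-injective n₁ i i' (trans (x∈⁅y⁆⇒x≡y f (subst (n₁ ↑ʳ i ∈_) (sym eq) (++-∈ʳ {X = ∅} r)))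
                                     (sym (x∈⁅y⁆⇒x≡y f (subst (n₁ ↑ʳ i' ∈_) (sym eq) (++-∈ʳ {X = ∅} r')))))
  no-singleton f (inj₂ (inj₂ (C , D , c , q , d , r , eq))) =
    let i , iC = has-other₁ (Equivalence.to (rep₁ C) c) q ; j , jD = has-other₂ (Equivalence.to (rep₂ D) d) r in
    apart {i} {j} (trans (sym (splitAt-↑ˡ n₁ i n₂)) (trans (cong (splitAt n₁)
      (trans (x∈⁅y⁆⇒x≡y f (subst (i ↑ˡ n₂ ∈_) (sym eq) (++-∈ˡ {Y = D - e₂} iC))) (sym (x∈⁅y⁆⇒x≡y f (subst (n₁ ↑ʳ j ∈_) (sym eq) (++-∈ʳ {X = C - e₁} jD))))))
      (splitAt-↑ʳ n₁ n₂ j)))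
    where
    apart : ∀ {i : Fin n₁} {j : Fin n₂} → inj₁ i ≢ inj₂ j
    apart ()

  -- A basis of the 2-sum: a basis of one summand through its basepoint, with the basepoint removed,
  -- and a basis of the other avoiding its own. Independence of the first forces the shared value to
  -- be zero, after which the second side is independent by itself.
  independent-set : ∃[ X ] (X ⊆ ground N × suc ∣ X ∣ ≡ S₁.ν + S₂.ν × ¬ Dep G X)
  independent-set =
    let J , eJ , sJ , iJ = S₁.independent e₁ ; J' , eJ' , sJ' , iJ' = S₂.avoiding in
    (J - e₁) ++ J' ,
    (λ {k} → ++-⊆ {X = J - e₁} {J'} {ground N} (λ r → ++-∈ˡ {Y = ⊤ - e₂} (x∈p∧x≢y⇒x∈p-y ∈⊤ (proj₂ (∈-⁻ {p = J} r))))
           (λ r → ++-∈ʳ {X = ⊤ - e₁} (x∈p∧x≢y⇒x∈p-y ∈⊤ λ { refl → eJ' r })) {k}) ,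
    trans (cong suc (∣++∣ (J - e₁) J')) (trans (cong (_+ ∣ J' ∣) (sym (∣∣-remove eJ))) (cong₂ _+_ sJ sJ')) ,
    indep eJ iJ eJ' iJ'
    where
    indep : ∀ {J J'} → e₁ ∈ J → ¬ Dep (ImS A₁) J → e₂ ∉ J' → ¬ Dep (ImS A₂) J' → ¬ Dep G ((J - e₁) ++ J')
    indep {J} {J'} eJ iJ eJ' iJ' (x , (x₁ , x₂ , t , p , q) , s , k , xk) = go (side k) xk
      where
      y₁ = set (x ∘ (_↑ˡ n₂)) e₁ t
      y₂ = set (x ∘ (n₁ ↑ʳ_)) e₂ t
      zero₁ : ∀ i → y₁ i ≡ 𝟘
      zero₁ i = decidable-stable (y₁ i ≟F 𝟘) λ r → iJ (y₁ , p , sup , i , r)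
        where
        sup : Supported y₁ J
        sup {i} r with i ≟ e₁
        ... | yes refl = eJ
        ... | no _ = proj₁ (∈-⁻ (++-∈ˡ⁻ {X = J - e₁} {J'} (s r)))
      t≡𝟘 : t ≡ 𝟘
      t≡𝟘 = trans (sym (set-same (x ∘ (_↑ˡ n₂)) e₁ t)) (zero₁ e₁)
      zero₂ : ∀ j → x (n₁ ↑ʳ j) ≡ 𝟘
      zero₂ j = decidable-stable (x (n₁ ↑ʳ j) ≟F 𝟘) λ r → iJ' (x ∘ (n₁ ↑ʳ_) ,
        ext (ImS A₂) (set-id {x = x ∘ (n₁ ↑ʳ_)} (trans x₂ (sym t≡𝟘))) q , (λ r → ++-∈ʳ⁻ {X = J - e₁} {J'} (s r)) , j , r)
      go : ∀ {k} → Side {n₁} {n₂} k → x k ≢ 𝟘 → ⊥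
      go (right j) r = r (zero₂ j)
      go (left i) r with i ≟ e₁
      ... | yes refl = r x₁
      ... | no i≢ = r (trans (sym (set-other (x ∘ (_↑ˡ n₂)) t i≢)) (zero₁ i))

  module Frame {V : ℕ} (Ω : Graph V (n₁ + n₂)) (B : Subset (n₁ + n₂) → Set)
    (biased : IsBiased Ω (ground N) B) (rep : ∀ X → Circuit N X ⇔ (X ⊆ ground N × FrameCircuit Ω B X)) where

    shape : ∀ {X} → Circuit N X → Cycle Ω X ⊎ Bicycle Ω X
    shape {X} c = FrameCircuit-shape Ω (λ {C} b → proj₂ (proj₁ biased C b)) (proj₂ (Equivalence.to (rep X) c))

    connected : ∀ {X} → Circuit N X → Connected Ω X
    connected c = [ (λ y → proj₁ (proj₂ y)) , proj₁ ]′ (shape c)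

    odd : ∀ {X} → Circuit N X → ∀ w → deg Ω X w ≢ 1
    odd c w = [ (λ y → even≢1 (proj₂ (proj₂ y) w)) , (λ b → proj₁ (proj₂ b) w) ]′ (shape c)

    -- Degrees in a circuit are never 1, so `f` would have to be a loop at `w`. Nothing else in the
    -- connected set `X` touches that loop, whence `X` is a single element; but the 2-sum has no
    -- circuits of size one.
    star-hit : ∀ {X f w} → Circuit N X → f ∈ X → 0 < ends-at Ω f w →
      (∀ {f'} → f' ∈ X → 0 < ends-at Ω f' w → f' ≡ f) → ⊥
    star-hit {X} {f} {w} c fX on only = no-singleton f (subst (Circuit N) (sym single) c)
      where
      degX : deg Ω (X ─ ⁅ f ⁆) w ≡ 0
      degX = n≤0⇒n≡0 (≮⇒≥ λ r → let e , q , s = OnV⇒edge Ω r ; a , b = ∈-⁻ {p = X} q in b (only a s))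
      whole : deg Ω ⁅ f ⁆ w ≡ deg Ω X w
      whole = trans (sym (+-identityʳ _)) (trans (cong (deg Ω ⁅ f ⁆ w +_) (sym degX)) (sym (deg-─ Ω (⁅⁆⊆ fX) w)))
      deg⁅⁆ : ∀ x → deg Ω ⁅ f ⁆ x ≡ ends-at Ω f x
      deg⁅⁆ x = trans (deg-sum Ω ⁅ f ⁆ x) (trans (NS.sum-cong-≗ term) (trans (sum-* (ends-at Ω f x) (pt f)) (trans (cong (ends-at Ω f x *_) (sum-pt f)) (*-identityʳ _))))
        where
        term : ∀ j → χ ⁅ f ⁆ j * ends-at Ω j x ≡ ends-at Ω f x * pt f j
        term j with f ≟ j
        ... | yes refl = trans (cong (_* ends-at Ω f x) (χ-∈ (x∈⁅x⁆ f))) (*-comm 1 (ends-at Ω f x))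
        ... | no r = trans (cong (_* ends-at Ω j x) (χ-∉ {X = ⁅ f ⁆} λ s → r (sym (x∈⁅y⁆⇒x≡y f s)))) (sym (*-zeroʳ (ends-at Ω f x)))
      loop : 2 ≤ ends-at Ω f w
      loop = ≤∧≢⇒< on λ q → odd c w (trans (sym whole) (trans (deg⁅⁆ w) (sym q)))
      sep : Separate Ω ⁅ f ⁆ (X ─ ⁅ f ⁆)
      sep x with x ≟ w
      ... | yes refl = inj₂ degX
      ... | no q = inj₁ (trans (deg⁅⁆ x) (n≤0⇒n≡0 (+-cancelˡ-≤ 2 _ 0 (≤-trans (+-monoˡ-≤ (ends-at Ω f x) loop)
          (≤-trans (two-terms (q ∘ sym)) (≤-reflexive (sum-ends Ω f)))))))
        where
        two-terms : ∀ {m} {h : Fin m → ℕ} {a b} → a ≢ b → h a + h b ≤ NS.sum h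
        two-terms {h = h} {a} {b} d = ≤-trans (≤-reflexive (sym (trans (NS.∑-distrib-+ (λ i → h a * pt a i) (λ i → h b * pt b i))
            (cong₂ _+_ (pick a) (pick b))))) (sum-mono each)
          where
          pick : ∀ k → NS.sum (λ i → h k * pt k i) ≡ h k
          pick k = trans (sum-* (h k) (pt k)) (trans (cong (h k *_) (sum-pt k)) (*-identityʳ (h k)))
          each : ∀ i → h a * pt a i + h b * pt b i ≤ h i
          each i with a ≟ i | b ≟ i
          ... | yes refl | yes refl = contradiction refl d
          ... | yes refl | no _ = ≤-reflexive (trans (cong₂ _+_ (*-identityʳ (h a)) (*-zeroʳ (h b))) (+-identityʳ _))
          ... | no _ | yes refl = ≤-reflexive (cong₂ _+_ (*-zeroʳ (h a)) (*-identityʳ (h b)))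
          ... | no _ | no _ = ≤-trans (≤-reflexive (cong₂ _+_ (*-zeroʳ (h a)) (*-zeroʳ (h b)))) z≤n
      single : ⁅ f ⁆ ≡ X
      single = conn-closed Ω (connected c) (⁅⁆⊆ fX) (f , x∈⁅x⁆ f) sep

    private
      on₁? : ∀ w i → Dec (i ≢ e₁ × 0 < ends-at Ω (i ↑ˡ n₂) w)
      on₁? w i = ¬? (i ≟ e₁) ×-dec 0 <? ends-at Ω (i ↑ˡ n₂) w
      on₂? : ∀ w j → Dec (j ≢ e₂ × 0 < ends-at Ω (n₁ ↑ʳ j) w)
      on₂? w j = ¬? (j ≟ e₂) ×-dec 0 <? ends-at Ω (n₁ ↑ʳ j) w

    T₁ : Fin V → Subset n₁
    T₁ w = sel (on₁? w)
    T₂ : Fin V → Subset n₂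
    T₂ w = sel (on₂? w)

    both? : ∀ w → Dec (Nonempty (T₁ w) × Nonempty (T₂ w))
    both? w = nonempty? (T₁ w) ×-dec nonempty? (T₂ w)
    σ : Fin V → Bool
    σ w = does (both? w)

    σ⁻ : ∀ w → σ w ≡ true → Nonempty (T₁ w) × Nonempty (T₂ w)
    σ⁻ w q = decidable-stable (both? w) λ p → contradiction (trans (sym q) (dec-false (both? w) p)) λ ()

    σ⁺ : ∀ {w i j} → i ∈ T₁ w → j ∈ T₂ w → σ w ≡ true
    σ⁺ {w} p q = dec-true (both? w) ((_ , p) , (_ , q))

    in-T₁ : ∀ {w i} → i ≢ e₁ → 0 < ends-at Ω (i ↑ˡ n₂) w → i ∈ T₁ w
    in-T₁ {w} p q = ∈sel⁺ (on₁? w) (p , q)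
    in-T₂ : ∀ {w j} → j ≢ e₂ → 0 < ends-at Ω (n₁ ↑ʳ j) w → j ∈ T₂ w
    in-T₂ {w} p q = ∈sel⁺ (on₂? w) (p , q)

    e₁∉T₁ : ∀ w → e₁ ∉ T₁ w
    e₁∉T₁ w r = proj₁ (∈sel⁻ (on₁? w) r) refl
    e₂∉T₂ : ∀ w → e₂ ∉ T₂ w
    e₂∉T₂ w r = proj₁ (∈sel⁻ (on₂? w) r) refl

    cover₁ : ∀ i → NS.sum (λ w → χ (T₁ w) i) ≤ 2
    cover₁ i = ≤-trans (sum-mono each) (≤-reflexive (sum-ends Ω (i ↑ˡ n₂)))
      where
      each : ∀ w → χ (T₁ w) i ≤ ends-at Ω (i ↑ˡ n₂) w
      each w with i ∈? T₁ w
      ... | yes r = proj₂ (∈sel⁻ (on₁? w) r)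
      ... | no _ = z≤n
    cover₂ : ∀ j → NS.sum (λ w → χ (T₂ w) j) ≤ 2
    cover₂ j = ≤-trans (sum-mono each) (≤-reflexive (sum-ends Ω (n₁ ↑ʳ j)))
      where
      each : ∀ w → χ (T₂ w) j ≤ ends-at Ω (n₁ ↑ʳ j) w
      each w with j ∈? T₂ w
      ... | yes r = proj₂ (∈sel⁻ (on₂? w) r)
      ... | no _ = z≤n

    K₁ = proj₁ S₁.circuit-through
    eK₁ = proj₁ (proj₂ S₁.circuit-through)
    mK₁ = proj₂ (proj₂ S₁.circuit-through)
    K₂ = proj₁ S₂.circuit-through
    eK₂ = proj₁ (proj₂ S₂.circuit-through)
    mK₂ = proj₂ (proj₂ S₂.circuit-through)

    -- The circuit formed by `K` and `L` across the 2-sum is connected as a set of edges of `Ω`, so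
    -- its two halves share a vertex.
    meeting-vertex : ∀ {K L} → MinDep (ImS A₁) K → e₁ ∈ K → MinDep (ImS A₂) L → e₂ ∈ L →
      ∃[ w ] ∃[ i ] ∃[ j ] (i ∈ K × i ∈ T₁ w × j ∈ L × j ∈ T₂ w)
    meeting-vertex {K} {L} m q m' q' =
      let i , iK = has-other₁ m q ; j , jL = has-other₂ m' q'
          w , on , on' = connected (crossing m q m' q') Y Y⊆X (i ↑ˡ n₂ , ++-∈ˡ iK)
              (n₁ ↑ʳ j , x∈p∧x∉q⇒x∈p─q (++-∈ʳ {X = K - e₁} jL) λ r → ∉⊥ (++-∈ʳ⁻ {X = K - e₁} {∅} r))
          f , fY , of = OnV⇒edge Ω on ; f' , fR , of' = OnV⇒edge Ω on'
          i' , iK' , iT = leftward (side f) fY of ; j' , jL' , jT = rightward (side f') (∈─⁻ X Y fR) of'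
      in w , i' , j' , iK' , iT , jL' , jT
      where
      X = (K - e₁) ++ (L - e₂)
      Y = (K - e₁) ++ ∅
      Y⊆X : Y ⊆ X
      Y⊆X {k} = ++-⊆ {X = K - e₁} {∅} {X} (λ r → ++-∈ˡ {Y = L - e₂} r) (λ r → ⊥-elim (∉⊥ r)) {k}
      leftward : ∀ {f w} → Side {n₁} {n₂} f → f ∈ Y → 0 < ends-at Ω f w → ∃[ i ] (i ∈ K × i ∈ T₁ w)
      leftward (left i) r s = let a , b = ∈-⁻ {p = K} (++-∈ˡ⁻ {X = K - e₁} {∅} r) in i , a , in-T₁ b s
      leftward (right j) r s = ⊥-elim (∉⊥ (++-∈ʳ⁻ {X = K - e₁} {∅} r))
      rightward : ∀ {f w} → Side {n₁} {n₂} f → f ∈ X × f ∉ Y → 0 < ends-at Ω f w → ∃[ j ] (j ∈ L × j ∈ T₂ w)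
      rightward (left i) (r , r') s = contradiction (++-∈ˡ {Y = ∅} (++-∈ˡ⁻ {X = K - e₁} {L - e₂} r)) r'
      rightward (right j) (r , _) s = let a , b = ∈-⁻ {p = L} (++-∈ʳ⁻ {X = K - e₁} {L - e₂} r) in j , a , in-T₂ b s

    hit-shared₁ : ∀ {w j K} → j ∈ T₁ w → MinDep (ImS A₁) K → j ∈ K → e₁ ∉ K → (∀ {i} → i ∈ K → i ∈ T₁ w → i ≡ j) → ⊥
    hit-shared₁ {w} {j} {K} jT m jK eK only = star-hit (left-circuit m eK) (++-∈ˡ {Y = ∅} jK) (proj₂ (∈sel⁻ (on₁? w) jT)) (λ {f} → go (side f))
      where
      go : ∀ {f} → Side {n₁} {n₂} f → f ∈ K ++ ∅ → 0 < ends-at Ω f w → f ≡ j ↑ˡ n₂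
      go (left i) r s = let iK = ++-∈ˡ⁻ {X = K} {∅} r in cong (_↑ˡ n₂) (only iK (in-T₁ (λ { refl → eK iK }) s))
      go (right i) r s = ⊥-elim (∉⊥ (++-∈ʳ⁻ {X = K} {∅} r))

    hit-shared₂ : ∀ {w j K} → j ∈ T₂ w → MinDep (ImS A₂) K → j ∈ K → e₂ ∉ K → (∀ {i} → i ∈ K → i ∈ T₂ w → i ≡ j) → ⊥
    hit-shared₂ {w} {j} {K} jT m jK eK only = star-hit (right-circuit m eK) (++-∈ʳ {X = ∅} jK) (proj₂ (∈sel⁻ (on₂? w) jT)) (λ {f} → go (side f))
      where
      go : ∀ {f} → Side {n₁} {n₂} f → f ∈ ∅ ++ K → 0 < ends-at Ω f w → f ≡ n₁ ↑ʳ j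
      go (right i) r s = let iK = ++-∈ʳ⁻ {X = ∅} {K} r in cong (n₁ ↑ʳ_) (only iK (in-T₂ (λ { refl → eK iK }) s))
      go (left i) r s = ⊥-elim (∉⊥ (++-∈ˡ⁻ {X = ∅} {K} r))

    hit-inner₁ : ∀ {w j K} → σ w ≡ false → j ∈ T₁ w → MinDep (ImS A₁) K → j ∈ K → (∀ {i} → i ∈ K → i ∈ T₁ w → i ≡ j) → ⊥
    hit-inner₁ {w} {j} {K} q jT m jK only with e₁ ∈? K
    ... | no eK = hit-shared₁ jT m jK eK only
    -- A circuit through the basepoint is completed on the other side by the fixed circuit `K₂`.
    -- None of that circuit's edges reaches `w`, which is not shared.
    ... | yes eK = star-hit (crossing m eK mK₂ eK₂) (++-∈ˡ {Y = K₂ - e₂} (x∈p∧x≢y⇒x∈p-y jK λ { refl → e₁∉T₁ w jT }))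
                     (proj₂ (∈sel⁻ (on₁? w) jT)) (λ {f} → go (side f))
      where
      go : ∀ {f} → Side {n₁} {n₂} f → f ∈ (K - e₁) ++ (K₂ - e₂) → 0 < ends-at Ω f w → f ≡ j ↑ˡ n₂
      go (left i) r s = let a , b = ∈-⁻ {p = K} (++-∈ˡ⁻ {X = K - e₁} {K₂ - e₂} r) in cong (_↑ˡ n₂) (only a (in-T₁ b s))
      go (right i) r s = let a , b = ∈-⁻ {p = K₂} (++-∈ʳ⁻ {X = K - e₁} {K₂ - e₂} r) in
        contradiction (trans (sym q) (σ⁺ jT (in-T₂ b s))) λ ()

    hit-inner₂ : ∀ {w j K} → σ w ≡ false → j ∈ T₂ w → MinDep (ImS A₂) K → j ∈ K → (∀ {i} → i ∈ K → i ∈ T₂ w → i ≡ j) → ⊥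
    hit-inner₂ {w} {j} {K} q jT m jK only with e₂ ∈? K
    ... | no eK = hit-shared₂ jT m jK eK only
    ... | yes eK = star-hit (crossing mK₁ eK₁ m eK) (++-∈ʳ {X = K₁ - e₁} (x∈p∧x≢y⇒x∈p-y jK λ { refl → e₂∉T₂ w jT }))
                     (proj₂ (∈sel⁻ (on₂? w) jT)) (λ {f} → go (side f))
      where
      go : ∀ {f} → Side {n₁} {n₂} f → f ∈ (K₁ - e₁) ++ (K - e₂) → 0 < ends-at Ω f w → f ≡ n₁ ↑ʳ j
      go (right i) r s = let a , b = ∈-⁻ {p = K} (++-∈ʳ⁻ {X = K₁ - e₁} {K - e₂} r) in cong (n₁ ↑ʳ_) (only a (in-T₂ b s))
      go (left i) r s = let a , b = ∈-⁻ {p = K₁} (++-∈ˡ⁻ {X = K₁ - e₁} {K - e₂} r) in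
        contradiction (trans (sym q) (σ⁺ (in-T₁ b s) jT)) λ ()

    unique : NS.sum (λ w → ⟦ σ w ⟧) ≡ 1 → ∀ {w x} → σ w ≡ true → σ x ≡ true → x ≡ w
    unique one {w} {x} p q with sum≡1 one
    ... | u , _ , h = trans (is q) (sym (is p))
      where
      is : ∀ {y} → σ y ≡ true → y ≡ u
      is {y} r = decidable-stable (y ≟ u) λ s → contradiction (trans (sym (cong ⟦_⟧ r)) (h y s)) λ ()

    -- The halves of the circuit completing `K` by `K₂` meet at a shared vertex, and there is only
    -- one.
    hit-single₁ : ∀ {w K} → NS.sum (λ w → ⟦ σ w ⟧) ≡ 1 → σ w ≡ true → MinDep (ImS A₁) K → e₁ ∈ K → (∀ {i} → i ∈ K → i ∉ T₁ w) → ⊥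
    hit-single₁ one q m eK h = let x , i , j , iK , iT , _ , jT = meeting-vertex m eK mK₂ eK₂ in
      h iK (subst (λ y → i ∈ T₁ y) (unique one q (σ⁺ iT jT)) iT)

    hit-single₂ : ∀ {w K} → NS.sum (λ w → ⟦ σ w ⟧) ≡ 1 → σ w ≡ true → MinDep (ImS A₂) K → e₂ ∈ K → (∀ {i} → i ∈ K → i ∉ T₂ w) → ⊥
    hit-single₂ one q m eK h = let x , i , j , _ , iT , jK , jT = meeting-vertex mK₁ eK₁ m eK in
      h jK (subst (λ y → j ∈ T₂ y) (unique one q (σ⁺ iT jT)) jT)

    module Q₁ = Stars A₁ e₁ S₁.c S₁.p S₁.big-avoid S₁.big-through T₁ e₁∉T₁ σ (λ w q → proj₁ (σ⁻ w q)) cover₁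
      (λ {w} → hit-inner₁ {w}) (λ {w} → hit-shared₁ {w}) (λ {w} → hit-single₁ {w})
    module Q₂ = Stars A₂ e₂ S₂.c S₂.p S₂.big-avoid S₂.big-through T₂ e₂∉T₂ σ (λ w q → proj₂ (σ⁻ w q)) cover₂
      (λ {w} → hit-inner₂ {w}) (λ {w} → hit-shared₂ {w}) (λ {w} → hit-single₂ {w})

    k : ℕ
    k = NS.sum (λ w → ⟦ σ w ⟧)

    1≤k : 1 ≤ k
    1≤k = let w , i , j , _ , iT , _ , jT = meeting-vertex mK₁ eK₁ mK₂ eK₂ in
      ≤-trans (≤-reflexive (cong ⟦_⟧ (sym (σ⁺ iT jT)))) (≤-sum (λ w → ⟦ σ w ⟧) w)

    private
      weaken : ∀ {c p t kx kz M n} → p ≤ c → c * t + p * kx + c * kz + M + 2 ≤ n → c * t + p * (kx + kz) + 2 ≤ n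
      weaken {c} {p} {t} {kx} {kz} {M} le q = ≤-trans (+-monoˡ-≤ 2 (≤-trans (≤-reflexive (lem c p t kx kz))
        (≤-trans (+-monoʳ-≤ (c * t + p * kx) (*-monoˡ-≤ kz le)) (m≤m+n _ M)))) q
        where
        lem : ∀ c p t kx kz → c * t + p * (kx + kz) ≡ c * t + p * kx + p * kz
        lem = solve-∀

    bound₁ : 2 * Q₁.t + k < 2 * S₁.ν
    bound₁ = subst (λ m → 2 * Q₁.t + m < 2 * S₁.ν) Q₁.kx+kz
      (S₁.counting Q₁.t (Q₁.kx + Q₁.kz) (subst (1 ≤_) (sym Q₁.kx+kz) 1≤k) (weaken {S₁.c} {S₁.p} {Q₁.t} {Q₁.kx} {Q₁.kz} {Q₁.M} S₁.p≤c Q₁.total))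
    bound₂ : 2 * Q₂.t + k < 2 * S₂.ν
    bound₂ = subst (λ m → 2 * Q₂.t + m < 2 * S₂.ν) Q₂.kx+kz
      (S₂.counting Q₂.t (Q₂.kx + Q₂.kz) (subst (1 ≤_) (sym Q₂.kx+kz) 1≤k) (weaken {S₂.c} {S₂.p} {Q₂.t} {Q₂.kx} {Q₂.kz} {Q₂.M} S₂.p≤c Q₂.total))

    -- More edges than vertices would give a bicycle, and a bicycle contains a circuit: a balanced
    -- cycle inside it, or else the bicycle itself.
    independent⇒small : ∀ {X} → X ⊆ ground N → ¬ Dep G X → ∣ X ∣ ≤ nv Ω X
    independent⇒small {X} s ind = ≮⇒≥ λ lt → let T , t , b = large⇒Bicycle Ω lt in
      not-circuit t (Equivalence.from (rep T) ((λ r → s (t r)) ,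
        Bicycle⇒FrameCircuit Ω b λ C y u bal → not-circuit (λ r → t (u r))
          (Equivalence.from (rep C) ((λ r → s (t (u r))) , inj₁ bal))))
      where
      not-circuit : ∀ {C} → C ⊆ X → ¬ Circuit N C
      not-circuit {C} t c = ind (Dep-mono G t (proj₁ (Equivalence.to (circuits C) c)))

    innerˡ : ∀ {w i} → σ w ≡ false → i ∈ T₁ w → 1 ≤ Q₁.tᵢ (Q₁.choice w) + Q₂.tᵢ (Q₂.choice w)
    innerˡ {w} {i} r iT = ≤-trans (≤-reflexive (sym (Q₁.inner-count w r (i , iT)))) (m≤m+n (Q₁.tᵢ (Q₁.choice w)) (Q₂.tᵢ (Q₂.choice w)))
    innerʳ : ∀ {w i} → σ w ≡ false → i ∈ T₂ w → 1 ≤ Q₁.tᵢ (Q₁.choice w) + Q₂.tᵢ (Q₂.choice w)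
    innerʳ {w} {i} r iT = ≤-trans (≤-reflexive (sym (Q₂.inner-count w r (i , iT)))) (m≤n+m (Q₂.tᵢ (Q₂.choice w)) (Q₁.tᵢ (Q₁.choice w)))
    edge-in-star : ∀ {w f} → f ∈ ground N → 0 < ends-at Ω f w → (∃[ i ] i ∈ T₁ w) ⊎ (∃[ j ] j ∈ T₂ w)
    edge-in-star {w} {f} fE on = go (side f) fE on
      where
      go : ∀ {f} → Side {n₁} {n₂} f → f ∈ ground N → 0 < ends-at Ω f w → (∃[ i ] i ∈ T₁ w) ⊎ (∃[ j ] j ∈ T₂ w)
      go (left i) r s = inj₁ (i , in-T₁ (proj₂ (∈-⁻ {p = ⊤} (++-∈ˡ⁻ {X = ⊤ - e₁} {⊤ - e₂} r))) s)
      go (right j) r s = inj₂ (j , in-T₂ (proj₂ (∈-⁻ {p = ⊤} (++-∈ʳ⁻ {X = ⊤ - e₁} {⊤ - e₂} r))) s)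

    inner-vertex : ∀ {w} → σ w ≡ false → (∃[ i ] i ∈ T₁ w) ⊎ (∃[ j ] j ∈ T₂ w) → 1 ≤ Q₁.tᵢ (Q₁.choice w) + Q₂.tᵢ (Q₂.choice w)
    inner-vertex r (inj₁ (i , iT)) = innerˡ r iT
    inner-vertex r (inj₂ (j , jT)) = innerʳ r jT

    positive : ∀ {X w} → X ⊆ ground N → 0 < deg Ω X w → ∀ b → σ w ≡ b → 1 ≤ Q₁.tᵢ (Q₁.choice w) + Q₂.tᵢ (Q₂.choice w) + ⟦ b ⟧
    positive s on true q = m≤n+m 1 _
    positive {X} {w} s on false q = let f , fX , on' = OnV⇒edge Ω {X} {w} on in ≤-trans (inner-vertex q (edge-in-star (s fX) on')) (m≤m+n _ 0)

    -- A vertex met by `X` is shared, and then counted by `k`, or its star lies on one side only and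
    -- contributes an inner cocircuit there.
    vertices : ∀ {X} → X ⊆ ground N → nv Ω X ≤ Q₁.t + Q₂.t + k
    vertices {X} s = sum-mono₃ {f = λ w → sg (deg Ω X w)} {λ w → Q₁.tᵢ (Q₁.choice w)} {λ w → Q₂.tᵢ (Q₂.choice w)} {λ w → ⟦ σ w ⟧}
      λ w → sg≤ (deg Ω X w) λ on → positive {X} {w} s on (σ w) refl
      where
      sg≤ : ∀ m {R} → (0 < m → 1 ≤ R) → sg m ≤ R
      sg≤ 0 h = z≤n
      sg≤ (suc m) h = h (s≤s z≤n)

    enough-vertices : S₁.ν + S₂.ν ≤ suc (Q₁.t + Q₂.t + k)
    enough-vertices = let X , s , sz , ind = independent-set in
      subst (_≤ suc (Q₁.t + Q₂.t + k)) sz (s≤s (≤-trans (independent⇒small s ind) (vertices s)))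

    -- Added together, the strict bounds of both sides give at most twice the sum of the ranks,
    -- while `enough-vertices` gives at least that. There is no slack left on either side.
    tight₂ : suc (2 * Q₂.t + k) ≡ 2 * S₂.ν
    tight₂ = ≤-antisym bound₂ (+-cancelˡ-≤ (suc (2 * Q₁.t + k)) _ _ (≤-trans (+-monoˡ-≤ (2 * S₂.ν) bound₁)
      (≤-trans (≤-reflexive (sym (*-distribˡ-+ 2 S₁.ν S₂.ν))) (≤-trans (*-monoʳ-≤ 2 enough-vertices) (≤-reflexive (lem Q₁.t Q₂.t k))))))
      where
      lem : ∀ a b k → 2 * suc (a + b + k) ≡ suc (2 * a + k) + suc (2 * b + k)
      lem = solve-∀

module _ {v₁ n₁ v₂ n₂} {A₁ : Matrix v₁ n₁} {e₁ : Fin n₁} {g : Graph v₂ n₂} {e₂ : Fin n₂}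
  {Circ₁ : Subset n₁ → Set} {Circ₂ : Subset n₂ → Set}
  (rep₁ : ∀ X → Circ₁ X ⇔ MinDep (ImS A₁) X) (rep₂ : ∀ X → Circ₂ X ⇔ MinDep (ImS (incidence g)) X)
  (S₁ : Pointed A₁ e₁) (S₂ : Cographic g e₂) where
  private
    module S₂ = Cographic S₂
    module W = TwoSum rep₁ rep₂ S₁ S₂.pointed

  -- The contradiction is drawn on the second side, where cocircuits are cycles of a graph; the
  -- first side contributes its strict bound. This is why U₂,₄ always stands first.
  not-frame : ¬ IsFrame W.N
  not-frame (V , Ω , B , biased , rep) = S₂.infeasible Fr.Q₂.t Fr.Q₂.kx Fr.Q₂.kz Fr.Q₂.M Fr.Q₂.total
    (trans (cong (λ m → suc (2 * Fr.Q₂.t + m)) Fr.Q₂.kx+kz) Fr.tight₂)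
    (λ q → Fr.Q₂.single⇒kz≡0 (trans (sym Fr.Q₂.kx+kz) q))
    (Fr.Q₂.Parity.odd⇒2≤M g id S₂.link S₂.simple)
    where
    module Fr = W.Frame Ω B biased rep

  excluded-minor : ExcludedMinorFrame (twoSum (mat n₁ ⊤ Circ₁) e₁ (mat n₂ ⊤ Circ₂) e₂)
  excluded-minor = not-frame , W.minors-frame

-- The examples

decideFun : ∀ {n} {P : (Fin n → F) → Set} (resp : ∀ {x y} → x ≗ y → P x → P y) (P? : ∀ x → Dec (P x)) →
  True (¬? (anyFun? (λ e np p → np (resp (sym ∘ e) p)) (λ x → ¬? (P? x)))) → ∀ x → P x
decideFun resp P? t x = decidable-stable (P? x) λ np → toWitness t (x , np)

supp-cong : ∀ {n} {x y : Fin n → F} → x ≗ y → supp x ≡ supp y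
supp-cong p = tabulate-cong λ i → cong (λ a → does (¬? (a ≟F 𝟘))) (p i)

supp⊆ : ∀ {n} {x : Fin n → F} {X} → Supported x X → supp x ⊆ X
supp⊆ {x = x} s r = s (∈sel⁻ (λ i → ¬? (x i ≟F 𝟘)) r)

below₂ : ∀ {P : ℕ → ℕ → Set} b → (∀ (i j : Fin b) → P (toℕ i) (toℕ j)) → ∀ {m k} → m < b → k < b → P m k
below₂ {P} b h p q = subst₂ P (toℕ-fromℕ< p) (toℕ-fromℕ< q) (h (fromℕ< p) (fromℕ< q))

below₃ : ∀ {P : ℕ → ℕ → ℕ → Set} b → (∀ (i j k : Fin b) → P (toℕ i) (toℕ j) (toℕ k)) →
  ∀ {l m k} → l < b → m < b → k < b → P l m k
below₃ {P} b h o p q = subst (λ l → P l _ _) (toℕ-fromℕ< o) (below₂ {P (toℕ (fromℕ< o))} b (h (fromℕ< o)) p q)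

-- `c` and `p` are one less than the weights of the parts. The weights are thereby positive, which
-- bounds `t` and `k` by `2 * n` and turns the inequalities into a finite check.
module Numbers (n c p ν : ℕ) where

  Counting : ℕ → ℕ → Set
  Counting t k = 1 ≤ k → suc c * t + suc p * k + 2 ≤ 2 * n → 2 * t + k < 2 * ν

  Counting? : ∀ t k → Dec (Counting t k)
  Counting? t k = 1 ≤? k →-dec suc c * t + suc p * k + 2 ≤? 2 * n →-dec 2 * t + k <? 2 * ν

  counting : True (all? λ (t : Fin (suc (2 * n))) → all? λ (k : Fin (suc (2 * n))) → Counting? (toℕ t) (toℕ k)) →
    ∀ t k → Counting t k
  counting check t k 1≤k h = below₂ {Counting} _ (toWitness check)
    (s≤s (≤-trans (m≤m+n t (c * t)) (≤-trans (m≤m+n (suc c * t) (suc p * k)) (≤-trans (m≤m+n _ 2) h))))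
    (s≤s (≤-trans (m≤m+n k (p * k)) (≤-trans (m≤n+m (suc p * k) (suc c * t)) (≤-trans (m≤m+n _ 2) h)))) 1≤k h

  -- Either there is no room for all the parts, or, if kx is odd, none for two uncovered incidences.
  Infeasible : ℕ → ℕ → ℕ → Set
  Infeasible t kx kz = suc (2 * t + (kx + kz)) ≡ 2 * ν → (kx + kz ≡ 1 → kz ≡ 0) →
    2 * n < suc c * t + suc p * kx + suc c * kz + 2 ⊎
    (∃[ h ] kx ≡ suc (2 * toℕ {2 * ν} h)) × 2 * n < suc c * t + suc p * kx + suc c * kz + 4

  Infeasible? : ∀ t kx kz → Dec (Infeasible t kx kz)
  Infeasible? t kx kz = (suc (2 * t + (kx + kz)) ℕₚ.≟ 2 * ν) →-dec ((kx + kz ℕₚ.≟ 1) →-dec (kz ℕₚ.≟ 0)) →-dec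
    ((2 * n <? suc c * t + suc p * kx + suc c * kz + 2) ⊎-dec
     ((any? λ h → kx ℕₚ.≟ suc (2 * toℕ {2 * ν} h)) ×-dec 2 * n <? suc c * t + suc p * kx + suc c * kz + 4))

  infeasible : True (all? λ (t : Fin (2 * ν)) → all? λ (kx : Fin (2 * ν)) → all? λ (kz : Fin (2 * ν)) → Infeasible? (toℕ t) (toℕ kx) (toℕ kz)) →
    ∀ t kx kz M → suc c * t + suc p * kx + suc c * kz + M + 2 ≤ 2 * n → suc (2 * t + (kx + kz)) ≡ 2 * ν →
      (kx + kz ≡ 1 → kz ≡ 0) → (∀ h → kx ≡ suc (2 * h) → 2 ≤ M) → ⊥
  infeasible check t kx kz M le eq one two =
    [ (λ q → <⇒≱ q (≤-trans (+-monoˡ-≤ 2 (m≤m+n used M)) le))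
    , (λ ((h , odd) , q) → <⇒≱ q (≤-trans (≤-reflexive (sym (+-assoc used 2 2)))
        (≤-trans (+-monoˡ-≤ 2 (+-monoʳ-≤ used (two (toℕ h) odd))) le))) ]′
    (below₃ {Infeasible} (2 * ν) (toWitness check)
      -- Here the range of the check comes from the tightness equation, which keeps all three
      -- numbers below `2 * ν`.
      (≤-trans (s≤s (≤-trans (m≤m+n t (t + 0)) (m≤m+n (2 * t) (kx + kz)))) (≤-reflexive eq))
      (≤-trans (s≤s (≤-trans (m≤m+n kx kz) (m≤n+m (kx + kz) (2 * t)))) (≤-reflexive eq))
      (≤-trans (s≤s (≤-trans (m≤n+m kz kx) (m≤n+m (kx + kz) (2 * t)))) (≤-reflexive eq)) eq one)
    where
    used = suc c * t + suc p * kx + suc c * kz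

module _ {v n : ℕ} (A : Matrix v n) where

  -- If this holds for all `y`, no nonzero vector of the row space is supported on `J`. Quantifying
  -- over coefficients makes the search one over vectors of length `v`, not `n`.
  Kills : Subset n → (Fin v → F) → Set
  Kills J y = (∀ i → i ∉ J → y ∙ (λ w → A w i) ≡ 𝟘) → ∀ i → y ∙ (λ w → A w i) ≡ 𝟘

  Kills? : ∀ J y → Dec (Kills J y)
  Kills? J y = (all? λ i → ¬? (i ∈? J) →-dec y ∙ (λ w → A w i) ≟F 𝟘) →-dec all? λ i → y ∙ (λ w → A w i) ≟F 𝟘

  Kills-resp : ∀ J {y z} → y ≗ z → Kills J y → Kills J z
  Kills-resp J e h k i = trans (∙-congˡ _ (sym ∘ e)) (h (λ i r → trans (∙-congˡ _ e) (k i r)) i)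

  Independent? : ∀ J → Dec (¬ (∃[ y ] ¬ Kills J y))
  Independent? J = ¬? (anyFun? (λ e np p → np (Kills-resp J (sym ∘ e) p)) (λ y → ¬? (Kills? J y)))

  Kills⇒¬Dep : ∀ {J} → ¬ (∃[ y ] ¬ Kills J y) → ¬ Dep (ImS A) J
  Kills⇒¬Dep {J} h (x , (y , p) , s , i , xi) = xi (trans (sym (p i)) (decidable-stable (Kills? J y) (λ k → h (y , k))
    (λ i r → trans (p i) (∉-Supported {x = x} s r)) i))

  module Family {m} (ν : ℕ) (family : Vec (Subset n) m)
    (check : True (all? λ k → (∣ lookup family k ∣ ℕₚ.≟ ν) ×-dec Independent? (lookup family k))) where

    independent : True (all? λ f → any? λ k → f ∈? lookup family k) → ∀ f → ∃[ J ] (f ∈ J × ∣ J ∣ ≡ ν × ¬ Dep (ImS A) J)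
    independent t f = let k , r = toWitness t f ; s , h = toWitness check k in lookup family k , r , s , Kills⇒¬Dep h

    avoiding : True (all? λ e → any? λ k → ¬? (e ∈? lookup family k)) → ∀ e → ∃[ J ] (e ∉ J × ∣ J ∣ ≡ ν × ¬ Dep (ImS A) J)
    avoiding t e = let k , r = toWitness t e ; s , h = toWitness check k in lookup family k , r , s , Kills⇒¬Dep h

subset : ∀ n → ℕ → Subset n
subset n k = tabulate λ i → does (digit n k i ℕₚ.≟ 1)

module _ {v n : ℕ} (g : Graph v n) (bound : Subset n → ℕ) where

  -- Only degrees are tested, which keeps the search cheap; a disjoint union of cycles is longer
  -- than its members and meets the same bounds.
  ShortCycle : Subset n → Set
  ShortCycle Z = ∣ Z ∣ < bound Z × Nonempty Z × (∀ w → deg g Z w ≡ 0 ⊎ deg g Z w ≡ 2)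

  ShortCycle? : ∀ Z → Dec (ShortCycle Z)
  ShortCycle? Z = ∣ Z ∣ <? bound Z ×-dec nonempty? Z ×-dec all? λ w → (deg g Z w ℕₚ.≟ 0) ⊎-dec (deg g Z w ℕₚ.≟ 2)

  girth : True (¬? (anySubset? ShortCycle?)) → ∀ {Z} → MinDep (KerS (incidence g)) Z → bound Z ≤ ∣ Z ∣
  girth t {Z} m = let ne , _ , h = MinDep⇒Cycle g m in ≮⇒≥ λ lt → toWitness t (Z , lt , ne , h)

Link : ∀ {v n} → Graph v n → Fin n → Set
Link g e = proj₁ (g e) ≢ proj₂ (g e) × (∀ j → j ≢ e → ends-at g j (proj₁ (g e)) + ends-at g j (proj₂ (g e)) ≤ 1)

Link? : ∀ {v n} (g : Graph v n) e → Dec (Link g e)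
Link? g e = ¬? (proj₁ (g e) ≟ proj₂ (g e)) ×-dec
  all? λ j → ¬? (j ≟ e) →-dec (ends-at g j (proj₁ (g e)) + ends-at g j (proj₂ (g e)) ≤? 1)

-- For the graphs, the listed sets are complements of spanning trees, hence bases of the dual.
-- Within each list every element belongs to one set and is missed by another.
module Fam-K5 = Family (incidence K5) 6 (subset 10 0000111111 ∷ subset 10 0111001101 ∷ subset 10 1011110010 ∷ []) tt
module Fam-K33 = Family (incidence K33) 4 (subset 9 000011011 ∷ subset 9 001010101 ∷ subset 9 110100010 ∷ []) tt
module Fam-K33' = Family (incidence K33') 5 (subset 10 0000111011 ∷ subset 10 1111000100 ∷ []) tt
module Fam-U24 = Family A-U24 2 (subset 4 1100 ∷ subset 4 0011 ∷ []) tt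

cographic-K5 : ∀ e → Cographic K5 e
cographic-K5 e = record
  { pointed = record
    -- K₅ has girth 3, and the rank of its dual is 10 - 4 = 6.
    { c = 3 ; p = 2 ; ν = 6 ; p≤c = s≤s (s≤s z≤n)
    ; big-avoid = λ m _ → girth K5 (λ _ → 3) tt m
    ; big-through = λ m _ → girth K5 (λ _ → 3) tt m
    ; counting = Numbers.counting 10 2 1 6 tt
    ; frame = frame-K5
    ; minors = λ {f} q → DelCon⇒Graphic (incidence K5) {f} {lookup certs-K5 f} (valid-K5 f) (q ∘ sym)
    ; independent = Fam-K5.independent tt
    ; avoiding = Fam-K5.avoiding tt e
    ; covered = toWitness {a? = all? λ e → any? λ r → ¬? (incidence K5 r e ≟F 𝟘)} tt e }
  ; link = proj₁ (links e) ; simple = proj₂ (links e)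
  ; infeasible = Numbers.infeasible 10 2 1 6 tt }
  where
  links : ∀ e → Link K5 e
  links = toWitness {a? = all? (Link? K5)} tt

cographic-K33 : ∀ e → Cographic K33 e
cographic-K33 e = record
  { pointed = record
    -- K₃,₃ has girth 4, and the rank of its dual is 9 - 5 = 4.
    { c = 4 ; p = 3 ; ν = 4 ; p≤c = s≤s (s≤s (s≤s z≤n))
    ; big-avoid = λ m _ → girth K33 (λ _ → 4) tt m
    ; big-through = λ m _ → girth K33 (λ _ → 4) tt m
    ; counting = Numbers.counting 9 3 2 4 tt
    ; frame = frame-K33
    ; minors = λ {f} q → DelCon⇒Graphic (incidence K33) {f} {lookup certs-K33 f} (valid-K33 f) (q ∘ sym)
    ; independent = Fam-K33.independent tt
    ; avoiding = Fam-K33.avoiding tt e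
    ; covered = toWitness {a? = all? λ e → any? λ r → ¬? (incidence K33 r e ≟F 𝟘)} tt e }
  ; link = proj₁ (links e) ; simple = proj₂ (links e)
  ; infeasible = Numbers.infeasible 9 3 2 4 tt }
  where
  links : ∀ e → Link K33 e
  links = toWitness {a? = all? (Link? K33)} tt

cographic-K33' : Cographic K33' e'
cographic-K33' = record
  { pointed = record
    -- Cycles avoiding `e'` lie in K₃,₃ and have length at least 4, while `e'` lies on triangles;
    -- the rank of the dual is 10 - 5 = 5.
    { c = 4 ; p = 2 ; ν = 5 ; p≤c = s≤s (s≤s z≤n)
    ; big-avoid = λ {Z} m q → subst (λ b → (if b then 3 else 4) ≤ ∣ Z ∣) (dec-false (e' ∈? Z) q) (girth K33' bound tt m)
    ; big-through = λ {Z} m q → subst (λ b → (if b then 3 else 4) ≤ ∣ Z ∣) (dec-true (e' ∈? Z) q) (girth K33' bound tt m)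
    ; counting = Numbers.counting 10 3 1 5 tt
    ; frame = frame-K33'
    ; minors = λ {f} → minors (side f)
    ; independent = Fam-K33'.independent tt
    ; avoiding = Fam-K33'.avoiding tt e'
    ; covered = zero , λ () }
  ; link = proj₁ links ; simple = proj₂ links
  ; infeasible = Numbers.infeasible 10 3 1 5 tt }
  where
  bound : Subset 10 → ℕ
  bound Z = if does (e' ∈? Z) then 3 else 4
  minors : ∀ {f} → Side {9} {1} f → f ≢ e' → GraphicDeletion (ImS (incidence K33')) e' f × GraphicContraction (ImS (incidence K33')) e' f
  minors (left i) q = DelCon⇒Graphic (incidence K33') {i ↑ˡ 1} {lookup certs-K33' i} (valid-K33' i) (q ∘ sym)
  minors (right zero) q = contradiction refl q
  links : Link K33' e'
  links = toWitness {a? = Link? K33' e'} tt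

U24-circuits : ∀ X → ∣ X ∣ ≡ 3 ⇔ MinDep (ImS A-U24) X
U24-circuits = Minimal-antichain three⇒Dep Dep⇒three (λ p q s → ⊆-∣∣-≡ s (≤-reflexive (trans q (sym p))))
  where
  word : (Fin 2 → F) → Fin 4 → F
  word y i = y ∙ (λ w → A-U24 w i)
  word-cong : ∀ {y z} → y ≗ z → word y ≗ word z
  word-cong e i = ∙-congˡ (λ w → A-U24 w i) e
  Spans : Subset 4 → (Fin 2 → F) → Set
  Spans X y = (∀ i → word y i ≢ 𝟘 → i ∈ X) × (∃[ i ] word y i ≢ 𝟘)
  spans? : ∀ X y → Dec (Spans X y)
  spans? X y = (all? λ i → ¬? (word y i ≟F 𝟘) →-dec i ∈? X) ×-dec any? λ i → ¬? (word y i ≟F 𝟘)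
  spans-resp : ∀ X {y z} → y ≗ z → Spans X y → Spans X z
  spans-resp X e (s , i , p) = (λ i q → s i λ r → q (trans (sym (word-cong e i)) r)) , i , λ r → p (trans (word-cong e i) r)
  three⇒Dep : ∀ {X} → ∣ X ∣ ≡ 3 → Dep (ImS A-U24) X
  three⇒Dep {X} q = let y , s , nz = decidable-stable (anyFun? (spans-resp X) (spans? X)) λ h → all-three (X , q , h) in
    word y , (y , λ _ → refl) , (λ {i} → s i) , nz
    where
    all-three : ¬ (∃[ X ] (∣ X ∣ ≡ 3 × ¬ ∃ (Spans X)))
    all-three = toWitness {a? = ¬? (anySubset? λ X → (∣ X ∣ ℕₚ.≟ 3) ×-dec ¬? (anyFun? (spans-resp X) (spans? X)))} tt
  weight : ∀ y → (∃[ i ] word y i ≢ 𝟘) → ∣ supp (word y) ∣ ≡ 3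
  weight = decideFun (λ e h (i , p) → trans (cong ∣_∣ (supp-cong λ i → sym (word-cong e i))) (h (i , λ r → p (trans (sym (word-cong e i)) r))))
    (λ y → (any? λ i → ¬? (word y i ≟F 𝟘)) →-dec (∣ supp (word y) ∣ ℕₚ.≟ 3)) tt
  Dep⇒three : ∀ {X} → Dep (ImS A-U24) X → ∃[ Y ] (Y ⊆ X × ∣ Y ∣ ≡ 3)
  Dep⇒three {X} (x , (y , p) , s , i , xi) = supp (word y) ,
    (λ {j} → supp⊆ {x = word y} {X} (λ {i} q → s λ r → q (trans (p i) r)) {j}) , weight y (i , λ r → xi (trans (sym (p i)) r))

pointed-U24 : ∀ e → Pointed A-U24 e
pointed-U24 e = record
  { c = 3 ; p = 2 ; ν = 2 ; p≤c = s≤s (s≤s z≤n)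
  ; big-avoid = λ m _ → large m
  ; big-through = λ m _ → large m
  ; counting = Numbers.counting 4 2 1 2 tt
  ; frame = frame-U24
  ; minors = λ {f} q → DelCon⇒Graphic A-U24 {f} {lookup certs-U24 f} (valid-U24 f) (q ∘ sym)
  ; independent = Fam-U24.independent tt
  ; avoiding = Fam-U24.avoiding tt e
  ; covered = toWitness {a? = all? λ e → any? λ r → ¬? (A-U24 r e ≟F 𝟘)} tt e }
  where
  weight : ∀ x → Ker A-U24 x → (∃[ i ] x i ≢ 𝟘) → 3 ≤ ∣ supp x ∣
  weight = decideFun
    (λ {x} {y} e h k (i , p) → subst (λ S → 3 ≤ ∣ S ∣) (supp-cong e) (h (ext (KerS A-U24) (sym ∘ e) k) (i , λ r → p (trans (sym (e i)) r))))
    (λ x → V? (KerS A-U24) x →-dec (any? λ i → ¬? (x i ≟F 𝟘)) →-dec 3 ≤? ∣ supp x ∣) tt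
  large : ∀ {Z} → MinDep (KerS A-U24) Z → 3 ≤ ∣ Z ∣
  large ((x , k , s , nz) , _) = ≤-trans (weight x k nz) (p⊆q⇒∣p∣≤∣q∣ (supp⊆ {x = x} s))

theorem3p1 : (∀ (H : Gr) (a : Fin 4) (b : Fin (size (Mstar H))) → Basepoint H b →
    ExcludedMinorFrame (twoSum U24 a (Mstar H) b))
    × (∀ (H₁ H₂ : Gr) (a : Fin (size (Mstar H₁))) (b : Fin (size (Mstar H₂))) →
    Basepoint H₁ a → Basepoint H₂ b →
    ExcludedMinorFrame (twoSum (Mstar H₁) a (Mstar H₂) b))
theorem3p1 = mixed , cographic
  where
  open Cographic using (pointed)
  mixed : ∀ H a (b : Fin (size (Mstar H))) → Basepoint H b → ExcludedMinorFrame (twoSum U24 a (Mstar H) b)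
  mixed k5 a b _ = excluded-minor U24-circuits (dual-circuits K5) (pointed-U24 a) (cographic-K5 b)
  mixed k33 a b _ = excluded-minor U24-circuits (dual-circuits K33) (pointed-U24 a) (cographic-K33 b)
  mixed k33' a b refl = excluded-minor U24-circuits (dual-circuits K33') (pointed-U24 a) cographic-K33'
  cographic : ∀ H₁ H₂ (a : Fin (size (Mstar H₁))) (b : Fin (size (Mstar H₂))) → Basepoint H₁ a → Basepoint H₂ b →
    ExcludedMinorFrame (twoSum (Mstar H₁) a (Mstar H₂) b)
  cographic k5 k5 a b _ _ = excluded-minor (dual-circuits K5) (dual-circuits K5) (pointed (cographic-K5 a)) (cographic-K5 b)
  cographic k5 k33 a b _ _ = excluded-minor (dual-circuits K5) (dual-circuits K33) (pointed (cographic-K5 a)) (cographic-K33 b)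
  cographic k5 k33' a b _ refl = excluded-minor (dual-circuits K5) (dual-circuits K33') (pointed (cographic-K5 a)) cographic-K33'
  cographic k33 k5 a b _ _ = excluded-minor (dual-circuits K33) (dual-circuits K5) (pointed (cographic-K33 a)) (cographic-K5 b)
  cographic k33 k33 a b _ _ = excluded-minor (dual-circuits K33) (dual-circuits K33) (pointed (cographic-K33 a)) (cographic-K33 b)
  cographic k33 k33' a b _ refl = excluded-minor (dual-circuits K33) (dual-circuits K33') (pointed (cographic-K33 a)) cographic-K33'
  cographic k33' k5 a b refl _ = excluded-minor (dual-circuits K33') (dual-circuits K5) (pointed cographic-K33') (cographic-K5 b)
  cographic k33' k33 a b refl _ = excluded-minor (dual-circuits K33') (dual-circuits K33) (pointed cographic-K33') (cographic-K33 b)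
  cographic k33' k33' a b refl refl = excluded-minor (dual-circuits K33') (dual-circuits K33') (pointed cographic-K33') cographic-K33'
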